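{- Let $d$ be a positive rational number such that $\sqrt d\notin\mathbb{Q}$. There exist constants $\eta_d>0$, $\kappa_d>0$ and $N_d$, depending only on $d$, such that for every convergent $\frac{\alpha}{\beta}$ (with $\alpha,\beta$ positive integers) of the continued fraction expansion of $\sqrt d$ with $\alpha,\beta\geq N_d$, we have $$\left|\sqrt d-\frac{n}{\alpha^m}\right|\geq\frac{1}{(\eta_d\alpha)^m}\quad\text{and}\quad\left|\sqrt d-\frac{n}{\beta^m}\right|\geq\frac{1}{(\kappa_d\beta)^m}$$ for every integer $n\in\mathbb{Z}$ and every integer $m$ sufficiently large with respect to $d,\alpha,\beta$. -}

module Defs where

open import Data.Nat as ℕ using (ℕ; zero; suc)
open import Data.Nat.DivMod as ℕD using ()
open import Data.Integer as ℤ using (ℤ)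
open import Data.Rational as ℚ using (ℚ; _≤_; _+_; _-_; _*_; 0ℚ; 1ℚ; ↥_; ↧ₙ_)
open import Data.Rational.Properties using (_≟_)
open import Data.Product using (_×_; _,_; proj₁; proj₂)
open import Data.Sum using (_⊎_)
open import Relation.Nullary using (yes; no)
open import Data.Bool using (if_then_else_)

-- Comparisons with √d, for a rational d > 0, written out in ℚ.
-- (√d itself is not a rational number, so we never form it.)

_≤√_ : ℚ → ℚ → Set
x ≤√ d = x ≤ 0ℚ ⊎ x * x ≤ d

√_≤_ : ℚ → ℚ → Set
√ d ≤ x = 0ℚ ≤ x × d ≤ x * x

DistFromSqrtGe : (d x r : ℚ) → Set
DistFromSqrtGe d x r = (x + r) ≤√ d ⊎ √ d ≤ (x - r)

_^ℚ_ : ℚ → ℕ → ℚ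
q ^ℚ zero  = 1ℚ
q ^ℚ suc m = q * (q ^ℚ m)

-- n / k as a rational (junk value 0 when k = 0; only used with k ≥ 1)
frac : ℤ → ℕ → ℚ
frac n zero    = 0ℚ
frac n (suc k) = n ℚ./ suc k

-- 1 / q (junk value 0 when q = 0; only used with q > 0)
recip : ℚ → ℚ
recip q with q ≟ 0ℚ
... | yes _  = 0ℚ
... | no q≢0 = ℚ.1/_ q {{ℚ.≢-nonZero q≢0}}

-- Continued fraction expansion of √d, d = p/q > 0 rational.
-- Write √d = √D / q with D = p q.  The complete quotients are
-- x_k = (P_k + √D) / Q_k with P_k ≥ 0, Q_k > 0 naturals
-- (standard algorithm for quadratic irrationals):
--   P_0 = 0, Q_0 = q,
--   a_k = ⌊(P_k + √D)/Q_k⌋ = ⌊(P_k + ⌊√D⌋)/Q_k⌋,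
--   P_{k+1} = a_k Q_k - P_k,  Q_{k+1} = (D - P_{k+1}²)/Q_k.

isqrtStep : ℕ → ℕ → ℕ
isqrtStep m r = if suc r ℕ.* suc r ℕ.≤ᵇ m then suc r else r

isqrt : ℕ → ℕ
isqrt zero = zero
isqrt (suc n) = isqrtStep (suc n) (isqrt n)

-- floor division on ℕ (junk value 0 for divisor 0; never used)
_div_ : ℕ → ℕ → ℕ
m div zero  = zero
m div suc k = m ℕD./ suc k

radicand : ℚ → ℕ
radicand d = ℤ.∣ ↥ d ∣ ℕ.* ↧ₙ d

cfStep : (D s : ℕ) → ℕ × ℕ → ℕ × ℕ
cfStep D s (P , Q) = nextQ (((P ℕ.+ s) div Q) ℕ.* Q ℕ.∸ P)
  where
  nextQ : ℕ → ℕ × ℕ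
  nextQ P′ = (P′ , (D ℕ.∸ P′ ℕ.* P′) div Q)

completeQuotient : ℚ → ℕ → ℕ × ℕ
completeQuotient d zero = (0 , ↧ₙ d)
completeQuotient d (suc k) = cfStep (radicand d) (isqrt (radicand d)) (completeQuotient d k)

pqOf : ℕ → ℕ × ℕ → ℕ
pqOf s (P , Q) = (P ℕ.+ s) div Q

partialQuotient : ℚ → ℕ → ℕ
partialQuotient d k = pqOf (isqrt (radicand d)) (completeQuotient d k)

-- (p_k , q_k , p_{k-1} , q_{k-1}) with p_{-1} = 1, q_{-1} = 0
convergentData : ℚ → ℕ → ℕ × ℕ × ℕ × ℕ
convergentData d zero = (partialQuotient d 0 , 1 , 1 , 0)
convergentData d (suc k) = next (partialQuotient d (suc k)) (convergentData d k)
  where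
  next : ℕ → ℕ × ℕ × ℕ × ℕ → ℕ × ℕ × ℕ × ℕ
  next a (p , q , p′ , q′) = (a ℕ.* p ℕ.+ p′ , a ℕ.* q ℕ.+ q′ , p , q)

convergent : ℚ → ℕ → ℕ × ℕ
convergent d k = proj₁ (convergentData d k) , proj₁ (proj₂ (convergentData d k))

{-# OPTIONS --safe #-}
module Submission where

-- If p/q is a convergent of √d, with d = A/B in lowest terms, then B p² − A q² = ±Q for a complete-quotient
-- denominator 0 < Q ≤ A B.  Hence √d is a rational multiple of √(1 − x) with x = e/h, where e ≠ 0 is bounded in terms
-- of d and h is B p² or A q².  The Padé approximants P a b / Q a b of √(1 − x), of degree a over degree b,
-- are within (C/h)^(a+b+1) of √(1 − x), and (4h)^a P, (4h)^b Q are integers.  When a ≤ b + k the rational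
-- N / h^k therefore differs from P/Q by at least a constant to the power a + b times h^(−k−b), unless they coincide,
-- and two neighbouring approximants cannot both coincide with N / h^k.  Taking b proportional to k / log h, so that
-- h^b outweighs the constants, this distance exceeds the approximation error while h^b itself is only exponential
-- in k with a base independent of h.

open import Defs
open import Data.Nat as ℕ using (ℕ; zero; suc; _^_)
import Data.Nat.Properties as ℕₚ
import Data.Nat.DivMod as ℕD
open import Data.Nat.Divisibility using (_∣_; ∣m+n∣m⇒∣n; n∣m*n)
open import Data.Integer as ℤ using (ℤ; +_; -[1+_]; +[1+_]; +0)
import Data.Integer.Properties as ℤₚ
open import Data.Rational using (ℚ; mkℚ; toℚᵘ; 0ℚ; 1ℚ; ½; _<_; _≤_; _*_; _+_; _-_; -_; 1/_; _/_; ∣_∣; ↥_; ↧ₙ_; *≤*; *<*; positive; nonNegative; ≢-nonZero)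
open import Data.Rational.Literals using (fromℤ)
open import Data.Rational.Properties
import Data.Rational.Unnormalised.Base as ℚᵘ
import Data.Rational.Unnormalised.Properties as ℚᵘₚ
open import Data.Bool as Bool using (true; false)
open import Data.Unit using (tt)
open import Data.Empty using (⊥-elim)
open import Data.Product using (Σ; _×_; _,_; proj₁; proj₂)
open import Data.Sum using (inj₁; inj₂)
open import Data.Maybe.Base using (Maybe; just; nothing)
open import Relation.Nullary using (¬_; yes; no)
open import Relation.Binary.PropositionalEquality using (_≡_; _≢_; refl; sym; trans; cong; cong₂; subst; subst₂; module ≡-Reasoning)
open import Tactic.RingSolver using (solve-∀)
open import Tactic.RingSolver.Core.AlmostCommutativeRing using (AlmostCommutativeRing; fromCommutativeRing)
open import Data.Nat.Tactic.RingSolver using () renaming (solve-∀ to solveℕ-∀)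
open import Data.Integer.Tactic.RingSolver using () renaming (solve-∀ to solveℤ-∀)
open import Level using (0ℓ)

-- Continued fraction of √d

-- Taylor polynomials are not enough: with b = 0 the error bound is of order C^k h^(-k-1), and for
-- fixed h and growing k it does not stay below the spacing h^(-k) of the rationals N / h^k. Raising
-- both degrees by one costs one factor h in the common denominator and gains two in accuracy, so a
-- suitable b pays for the constants. The extra k in the degree a comes for free, because h^k
-- already stands in the denominator of N / h^k. The Padé pairs are built from a Pascal recurrence
-- instead of explicit coefficients. Integrality and growth follow by induction on it. Together with
-- a contiguous relation it makes the cross determinant of neighbours a single monomial in x, which
-- measures the steps of the table and also shows that they are not zero. No real number is formed:
-- √(1 - x) is enclosed by two rationals whose product is 1 - x. The denominator α^m corresponds to
-- h^k with 2k close to m, since h is a multiple of α². What is left over is independent of m and is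
-- swallowed by 2^m, which explains the factor 2 in the final constants.

IsSqrt : ℕ → ℕ → Set
IsSqrt n r = r ℕ.* r ℕ.≤ n × n ℕ.< suc r ℕ.* suc r

isqrt-correct : ∀ n → IsSqrt n (isqrt n)
isqrt-correct zero    = ℕ.z≤n , ℕ.s≤s ℕ.z≤n
isqrt-correct (suc n) = step (isqrt n) (isqrt-correct n)
  where
  step : ∀ r → IsSqrt n r → IsSqrt (suc n) (isqrtStep (suc n) r)
  step r (r²≤n , n<) with suc r ℕ.* suc r ℕ.≤ᵇ suc n in eq
  ... | true  = ℕₚ.≤ᵇ⇒≤ _ _ (subst Bool.T (sym eq) tt) , ℕₚ.≤-<-trans n< (ℕₚ.*-mono-< (ℕₚ.n<1+n (suc r)) (ℕₚ.n<1+n (suc r)))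
  ... | false = ℕₚ.m≤n⇒m≤1+n r²≤n , ℕₚ.≰⇒> (λ le → subst Bool.T eq (ℕₚ.≤⇒≤ᵇ le))

div-lower : ∀ m {n} → 1 ℕ.≤ n → (m div n) ℕ.* n ℕ.≤ m
div-lower m {suc n} _ = ℕD.m/n*n≤m m (suc n)

div-upper : ∀ m {n} → 1 ℕ.≤ n → m ℕ.< (m div n) ℕ.* n ℕ.+ n
div-upper m {suc n} _ = ℕₚ.≤-<-trans (ℕₚ.≤-reflexive (trans (ℕD.m≡m%n+[m/n]*n m (suc n)) (ℕₚ.+-comm _ ((m ℕD./ suc n) ℕ.* suc n))))
  (ℕₚ.+-monoʳ-< ((m ℕD./ suc n) ℕ.* suc n) (ℕD.m%n<n m (suc n)))

div-exact : ∀ {m n} → 1 ℕ.≤ n → n ∣ m → (m div n) ℕ.* n ≡ m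
div-exact {n = suc n} _ = ℕD.m/n*n≡m

-- `Q′` is the denominator preceding `Q`. Keeping the product `Q * Q′` makes the next division
-- exact, and `P≤aQ` ensures that the subtraction in `cfStep` does not truncate.
record Reduced (D s P Q Q′ : ℕ) : Set where
  field
    1≤Q     : 1 ℕ.≤ Q
    1≤Q′    : 1 ℕ.≤ Q′
    P≤s     : P ℕ.≤ s
    QQ′+P²  : Q ℕ.* Q′ ℕ.+ P ℕ.* P ≡ D
    P≤aQ    : P ℕ.≤ ((P ℕ.+ s) div Q) ℕ.* Q

module Step (D s : ℕ) (sqrt : IsSqrt D s) (nonsquare : ∀ r → r ℕ.* r ≢ D) {P Q Q′ : ℕ} (red : Reduced D s P Q Q′) where

  open Reduced red
  open ℕₚ.≤-Reasoning

  a P⁺ Q⁺ : ℕ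
  a  = (P ℕ.+ s) div Q
  P⁺ = a ℕ.* Q ℕ.∸ P
  Q⁺ = (D ℕ.∸ P⁺ ℕ.* P⁺) div Q

  P⁺+P : P⁺ ℕ.+ P ≡ a ℕ.* Q
  P⁺+P = ℕₚ.m∸n+n≡m P≤aQ

  P⁺≤s : P⁺ ℕ.≤ s
  P⁺≤s = ℕₚ.+-cancelʳ-≤ P P⁺ s (begin
    P⁺ ℕ.+ P    ≡⟨ P⁺+P ⟩
    a ℕ.* Q     ≤⟨ div-lower (P ℕ.+ s) 1≤Q ⟩
    P ℕ.+ s     ≡⟨ ℕₚ.+-comm P s ⟩
    s ℕ.+ P     ∎)

  s<P⁺+Q : s ℕ.< P⁺ ℕ.+ Q
  s<P⁺+Q = ℕₚ.+-cancelˡ-< P s (P⁺ ℕ.+ Q) (begin-strict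
    P ℕ.+ s               <⟨ div-upper (P ℕ.+ s) 1≤Q ⟩
    a ℕ.* Q ℕ.+ Q         ≡⟨ cong (ℕ._+ Q) P⁺+P ⟨
    P⁺ ℕ.+ P ℕ.+ Q        ≡⟨ lemma P⁺ P Q ⟩
    P ℕ.+ (P⁺ ℕ.+ Q)      ∎)
    where
    lemma : ∀ p p′ q → p ℕ.+ p′ ℕ.+ q ≡ p′ ℕ.+ (p ℕ.+ q)
    lemma = solveℕ-∀

  P⁺²≤D : P⁺ ℕ.* P⁺ ℕ.≤ D
  P⁺²≤D = ℕₚ.≤-trans (ℕₚ.*-mono-≤ P⁺≤s P⁺≤s) (proj₁ sqrt)

  P⁺²<D : P⁺ ℕ.* P⁺ ℕ.< D
  P⁺²<D = ℕₚ.≤∧≢⇒< P⁺²≤D (nonsquare P⁺)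

  -- Since `P⁺ + P = a Q`, one has `D − P⁺² = Q Q′ − (P⁺ − P) a Q`. Written without negative terms,
  -- this gives both the divisibility by `Q` and the linear recurrence for `Q⁺`.
  balance : P⁺ ℕ.* (a ℕ.* Q) ℕ.+ (D ℕ.∸ P⁺ ℕ.* P⁺) ≡ (Q′ ℕ.+ P ℕ.* a) ℕ.* Q
  balance = ℕₚ.+-cancelʳ-≡ (P⁺ ℕ.* P⁺) _ _ (begin-equality
    P⁺ ℕ.* (a ℕ.* Q) ℕ.+ (D ℕ.∸ P⁺ ℕ.* P⁺) ℕ.+ P⁺ ℕ.* P⁺
      ≡⟨ ℕₚ.+-assoc (P⁺ ℕ.* (a ℕ.* Q)) _ _ ⟩
    P⁺ ℕ.* (a ℕ.* Q) ℕ.+ (D ℕ.∸ P⁺ ℕ.* P⁺ ℕ.+ P⁺ ℕ.* P⁺)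
      ≡⟨ cong₂ ℕ._+_ (cong (P⁺ ℕ.*_) (sym P⁺+P)) (trans (ℕₚ.m∸n+n≡m P⁺²≤D) (sym QQ′+P²)) ⟩
    P⁺ ℕ.* (P⁺ ℕ.+ P) ℕ.+ (Q ℕ.* Q′ ℕ.+ P ℕ.* P)
      ≡⟨ lemma P⁺ P Q Q′ ⟩
    Q′ ℕ.* Q ℕ.+ P ℕ.* (P⁺ ℕ.+ P) ℕ.+ P⁺ ℕ.* P⁺
      ≡⟨ cong (λ m → Q′ ℕ.* Q ℕ.+ P ℕ.* m ℕ.+ P⁺ ℕ.* P⁺) P⁺+P ⟩
    Q′ ℕ.* Q ℕ.+ P ℕ.* (a ℕ.* Q) ℕ.+ P⁺ ℕ.* P⁺
      ≡⟨ cong (ℕ._+ P⁺ ℕ.* P⁺) (lemma′ Q′ Q P a) ⟩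
    (Q′ ℕ.+ P ℕ.* a) ℕ.* Q ℕ.+ P⁺ ℕ.* P⁺ ∎)
    where
    lemma : ∀ p⁺ p q q′ → p⁺ ℕ.* (p⁺ ℕ.+ p) ℕ.+ (q ℕ.* q′ ℕ.+ p ℕ.* p) ≡ q′ ℕ.* q ℕ.+ p ℕ.* (p⁺ ℕ.+ p) ℕ.+ p⁺ ℕ.* p⁺
    lemma = solveℕ-∀
    lemma′ : ∀ q′ q p a → q′ ℕ.* q ℕ.+ p ℕ.* (a ℕ.* q) ≡ (q′ ℕ.+ p ℕ.* a) ℕ.* q
    lemma′ = solveℕ-∀

  Q⁺Q : Q⁺ ℕ.* Q ≡ D ℕ.∸ P⁺ ℕ.* P⁺
  Q⁺Q = div-exact 1≤Q (∣m+n∣m⇒∣n (subst (Q ∣_) (sym balance) (n∣m*n (Q′ ℕ.+ P ℕ.* a)))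
    (subst (Q ∣_) (ℕₚ.*-assoc P⁺ a Q) (n∣m*n (P⁺ ℕ.* a))))

  Q⁺+P⁺a : Q⁺ ℕ.+ P⁺ ℕ.* a ≡ Q′ ℕ.+ P ℕ.* a
  Q⁺+P⁺a = ℕₚ.*-cancelʳ-≡ _ _ Q (begin-equality
    (Q⁺ ℕ.+ P⁺ ℕ.* a) ℕ.* Q                     ≡⟨ lemma Q⁺ P⁺ a Q ⟩
    P⁺ ℕ.* (a ℕ.* Q) ℕ.+ Q⁺ ℕ.* Q               ≡⟨ cong (P⁺ ℕ.* (a ℕ.* Q) ℕ.+_) Q⁺Q ⟩
    P⁺ ℕ.* (a ℕ.* Q) ℕ.+ (D ℕ.∸ P⁺ ℕ.* P⁺)      ≡⟨ balance ⟩
    (Q′ ℕ.+ P ℕ.* a) ℕ.* Q                      ∎)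
    where
    instance _ = ℕ.>-nonZero 1≤Q
    lemma : ∀ q⁺ p⁺ a q → (q⁺ ℕ.+ p⁺ ℕ.* a) ℕ.* q ≡ p⁺ ℕ.* (a ℕ.* q) ℕ.+ q⁺ ℕ.* q
    lemma = solveℕ-∀

  Q⁺Q+P⁺² : Q⁺ ℕ.* Q ℕ.+ P⁺ ℕ.* P⁺ ≡ D
  Q⁺Q+P⁺² = trans (cong (ℕ._+ P⁺ ℕ.* P⁺) Q⁺Q) (ℕₚ.m∸n+n≡m P⁺²≤D)

  1≤Q⁺ : 1 ℕ.≤ Q⁺
  1≤Q⁺ = ℕₚ.n≢0⇒n>0 (λ Q⁺≡0 → ℕₚ.<⇒≢ P⁺²<D (trans (cong (λ q → q ℕ.* Q ℕ.+ P⁺ ℕ.* P⁺) (sym Q⁺≡0)) Q⁺Q+P⁺²))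

  -- The integer form of the next complete quotient being at least 1. If `Q⁺ ≥ P⁺ + s + 1`, then
  -- together with `Q ≥ s − P⁺ + 1` the factorisation of `(s + 1)² − P⁺²` would give `(s + 1)² ≤ D`.
  Q⁺≤P⁺+s : Q⁺ ℕ.≤ P⁺ ℕ.+ s
  Q⁺≤P⁺+s = ℕₚ.≮⇒≥ (λ P⁺+s<Q⁺ → ℕₚ.<⇒≱ (proj₂ sqrt) (begin
    suc s ℕ.* suc s                                   ≡⟨ cong (λ m → suc m ℕ.* suc m) (ℕₚ.m+[n∸m]≡n P⁺≤s) ⟨
    suc (P⁺ ℕ.+ j) ℕ.* suc (P⁺ ℕ.+ j)                 ≡⟨ lemma P⁺ j ⟩
    suc (P⁺ ℕ.+ (P⁺ ℕ.+ j)) ℕ.* suc j ℕ.+ P⁺ ℕ.* P⁺   ≡⟨ cong (λ m → suc (P⁺ ℕ.+ m) ℕ.* suc j ℕ.+ P⁺ ℕ.* P⁺) (ℕₚ.m+[n∸m]≡n P⁺≤s) ⟩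
    suc (P⁺ ℕ.+ s) ℕ.* suc j ℕ.+ P⁺ ℕ.* P⁺            ≤⟨ ℕₚ.+-monoˡ-≤ (P⁺ ℕ.* P⁺) (ℕₚ.*-mono-≤ P⁺+s<Q⁺ j<Q) ⟩
    Q⁺ ℕ.* Q ℕ.+ P⁺ ℕ.* P⁺                            ≡⟨ Q⁺Q+P⁺² ⟩
    D                                                 ∎))
    where
    j : ℕ
    j = s ℕ.∸ P⁺
    j<Q : j ℕ.< Q
    j<Q = ℕₚ.+-cancelˡ-< P⁺ j Q (subst (ℕ._< P⁺ ℕ.+ Q) (sym (ℕₚ.m+[n∸m]≡n P⁺≤s)) s<P⁺+Q)
    lemma : ∀ p j → suc (p ℕ.+ j) ℕ.* suc (p ℕ.+ j) ≡ suc (p ℕ.+ (p ℕ.+ j)) ℕ.* suc j ℕ.+ p ℕ.* p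
    lemma = solveℕ-∀

  P⁺≤a⁺Q⁺ : P⁺ ℕ.≤ ((P⁺ ℕ.+ s) div Q⁺) ℕ.* Q⁺
  P⁺≤a⁺Q⁺ with Q⁺ ℕₚ.≤? s
  ... | yes Q⁺≤s = ℕₚ.+-cancelʳ-≤ Q⁺ P⁺ _ (ℕₚ.≤-trans (ℕₚ.+-monoʳ-≤ P⁺ Q⁺≤s) (ℕₚ.<⇒≤ (div-upper (P⁺ ℕ.+ s) 1≤Q⁺)))
  -- Here `P⁺ ≤ s < Q⁺`, so it suffices that the next partial quotient is not 0.
  ... | no  Q⁺≰s with (P⁺ ℕ.+ s) div Q⁺ | div-upper (P⁺ ℕ.+ s) 1≤Q⁺
  ...   | zero   | P⁺+s<Q⁺ = ⊥-elim (ℕₚ.<⇒≱ P⁺+s<Q⁺ Q⁺≤P⁺+s)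
  ...   | suc a⁺ | _       = ℕₚ.≤-trans P⁺≤s (ℕₚ.≤-trans (ℕₚ.<⇒≤ (ℕₚ.≰⇒> Q⁺≰s)) (ℕₚ.m≤m+n Q⁺ (a⁺ ℕ.* Q⁺)))

  reduced⁺ : Reduced D s P⁺ Q⁺ Q
  reduced⁺ = record { 1≤Q = 1≤Q⁺ ; 1≤Q′ = 1≤Q ; P≤s = P⁺≤s ; QQ′+P² = Q⁺Q+P⁺² ; P≤aQ = P⁺≤a⁺Q⁺ }

-- Rational arithmetic

0≟ : ∀ p → Maybe (0ℚ ≡ p)
0≟ p with 0ℚ ≟ p
... | yes 0≡p = just 0≡p
... | no _    = nothing

ring : AlmostCommutativeRing 0ℓ 0ℓ
ring = fromCommutativeRing +-*-commutativeRing 0≟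

≤-by-difference : ∀ {p q} r → 0ℚ ≤ r → q ≡ p + r → p ≤ q
≤-by-difference {p} r 0≤r refl = subst (_≤ p + r) (+-identityʳ p) (+-monoʳ-≤ p 0≤r)

p≤q⇒0≤q-p : ∀ {p q} → p ≤ q → 0ℚ ≤ q - p
p≤q⇒0≤q-p {p} {q} p≤q = subst (_≤ q - p) (+-inverseʳ p) (+-monoˡ-≤ (- p) p≤q)

0≤+ : ∀ {p q} → 0ℚ ≤ p → 0ℚ ≤ q → 0ℚ ≤ p + q
0≤+ 0≤p 0≤q = +-mono-≤ 0≤p 0≤q

0≤* : ∀ {p q} → 0ℚ ≤ p → 0ℚ ≤ q → 0ℚ ≤ p * q
0≤* {p} {q} 0≤p 0≤q = nonNegative⁻¹ (p * q) {{nonNeg*nonNeg⇒nonNeg p {{nonNegative 0≤p}} q {{nonNegative 0≤q}}}}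

0<* : ∀ {p q} → 0ℚ < p → 0ℚ < q → 0ℚ < p * q
0<* {p} {q} 0<p 0<q = positive⁻¹ (p * q) {{pos*pos⇒pos p {{positive 0<p}} q {{positive 0<q}}}}

*-monoʳ-≤ : ∀ {p q} r → 0ℚ ≤ r → p ≤ q → p * r ≤ q * r
*-monoʳ-≤ r 0≤r = *-monoʳ-≤-nonNeg r {{nonNegative 0≤r}}

*-monoˡ-≤ : ∀ {p q} r → 0ℚ ≤ r → p ≤ q → r * p ≤ r * q
*-monoˡ-≤ r 0≤r = *-monoˡ-≤-nonNeg r {{nonNegative 0≤r}}

*-mono-≤ : ∀ {p q r s} → 0ℚ ≤ p → 0ℚ ≤ r → p ≤ q → r ≤ s → p * r ≤ q * s
*-mono-≤ {p} {q} {r} {s} 0≤p 0≤r p≤q r≤s =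
  ≤-trans (*-monoʳ-≤ r 0≤r p≤q) (*-monoˡ-≤ q (≤-trans 0≤p p≤q) r≤s)

*-cancelˡ-≤ : ∀ {p q} r → 0ℚ < r → r * p ≤ r * q → p ≤ q
*-cancelˡ-≤ r 0<r = *-cancelˡ-≤-pos r {{positive 0<r}}

*-cancelˡ-≡ : ∀ {p q} r → 0ℚ < r → r * p ≡ r * q → p ≡ q
*-cancelˡ-≡ r 0<r eq = ≤-antisym
  (*-cancelˡ-≤ r 0<r (≤-reflexive eq)) (*-cancelˡ-≤ r 0<r (≤-reflexive (sym eq)))

*-nonZero : ∀ {p q} → p ≢ 0ℚ → q ≢ 0ℚ → p * q ≢ 0ℚ
*-nonZero {p} {q} p≢0 q≢0 pq≡0 = q≢0 (begin
  q                 ≡⟨ *-identityˡ q ⟨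
  1ℚ * q            ≡⟨ cong (_* q) (*-inverseˡ p) ⟨
  (1/ p * p) * q    ≡⟨ *-assoc (1/ p) p q ⟩
  1/ p * (p * q)    ≡⟨ cong (1/ p *_) pq≡0 ⟩
  1/ p * 0ℚ         ≡⟨ *-zeroʳ (1/ p) ⟩
  0ℚ                ∎)
  where
  open ≡-Reasoning
  instance
    _ = ≢-nonZero p≢0

p≤∣p∣ : ∀ p → p ≤ ∣ p ∣
p≤∣p∣ p with ≤-total 0ℚ p
... | inj₁ 0≤p = ≤-reflexive (sym (0≤p⇒∣p∣≡p 0≤p))
... | inj₂ p≤0 = ≤-trans p≤0 (0≤∣p∣ p)

-∣p∣≤p : ∀ p → - ∣ p ∣ ≤ p
-∣p∣≤p p = subst₂ _≤_ (cong -_ (∣-p∣≡∣p∣ p)) (lemma p) (neg-antimono-≤ (p≤∣p∣ (- p)))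
  where
  lemma : ∀ p → - - p ≡ p
  lemma = solve-∀ ring

∣p-q∣≡∣q-p∣ : ∀ p q → ∣ p - q ∣ ≡ ∣ q - p ∣
∣p-q∣≡∣q-p∣ p q = trans (sym (∣-p∣≡∣p∣ (p - q))) (cong ∣_∣ (lemma p q))
  where
  lemma : ∀ p q → - (p - q) ≡ q - p
  lemma = solve-∀ ring

∣p-r∣≤∣p-q∣+∣q-r∣ : ∀ p q r → ∣ p - r ∣ ≤ ∣ p - q ∣ + ∣ q - r ∣
∣p-r∣≤∣p-q∣+∣q-r∣ p q r =
  subst (λ s → ∣ s ∣ ≤ ∣ p - q ∣ + ∣ q - r ∣) (lemma p q r) (∣p+q∣≤∣p∣+∣q∣ (p - q) (q - r))
  where
  lemma : ∀ p q r → (p - q) + (q - r) ≡ p - r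
  lemma = solve-∀ ring

p-∣p-q∣≤q : ∀ p q → p - ∣ p - q ∣ ≤ q
p-∣p-q∣≤q p q = ≤-by-difference (∣ p - q ∣ - (p - q)) (p≤q⇒0≤q-p (p≤∣p∣ (p - q))) (lemma p q ∣ p - q ∣)
  where
  lemma : ∀ p q a → q ≡ (p - a) + (a - (p - q))
  lemma = solve-∀ ring

q≤p+∣p-q∣ : ∀ p q → q ≤ p + ∣ p - q ∣
q≤p+∣p-q∣ p q = ≤-by-difference ((p - q) - - ∣ p - q ∣) (p≤q⇒0≤q-p (-∣p∣≤p (p - q))) (lemma p q ∣ p - q ∣)
  where
  lemma : ∀ p q a → p + a ≡ q + ((p - q) - - a)
  lemma = solve-∀ ring

^ℚ-+ : ∀ q m n → q ^ℚ (m ℕ.+ n) ≡ q ^ℚ m * q ^ℚ n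
^ℚ-+ q zero    n = sym (*-identityˡ (q ^ℚ n))
^ℚ-+ q (suc m) n = trans (cong (q *_) (^ℚ-+ q m n)) (sym (*-assoc q (q ^ℚ m) (q ^ℚ n)))

^ℚ-distrib-* : ∀ p q n → (p * q) ^ℚ n ≡ p ^ℚ n * q ^ℚ n
^ℚ-distrib-* p q zero    = refl
^ℚ-distrib-* p q (suc n) = trans (cong (p * q *_) (^ℚ-distrib-* p q n)) (lemma p q (p ^ℚ n) (q ^ℚ n))
  where
  lemma : ∀ p q r s → p * q * (r * s) ≡ p * r * (q * s)
  lemma = solve-∀ ring

0<^ℚ : ∀ {q} → 0ℚ < q → ∀ n → 0ℚ < q ^ℚ n
0<^ℚ 0<q zero    = *<* (ℤ.+<+ (ℕ.s≤s ℕ.z≤n))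
0<^ℚ 0<q (suc n) = 0<* 0<q (0<^ℚ 0<q n)

0≤^ℚ : ∀ {q} → 0ℚ ≤ q → ∀ n → 0ℚ ≤ q ^ℚ n
0≤^ℚ 0≤q zero    = *≤* (ℤ.+≤+ ℕ.z≤n)
0≤^ℚ 0≤q (suc n) = 0≤* 0≤q (0≤^ℚ 0≤q n)

^ℚ-monoˡ-≤ : ∀ {p q} → 0ℚ ≤ p → p ≤ q → ∀ n → p ^ℚ n ≤ q ^ℚ n
^ℚ-monoˡ-≤ 0≤p p≤q zero    = ≤-refl
^ℚ-monoˡ-≤ 0≤p p≤q (suc n) = *-mono-≤ 0≤p (0≤^ℚ 0≤p n) p≤q (^ℚ-monoˡ-≤ 0≤p p≤q n)

∣^ℚ∣ : ∀ q n → ∣ q ^ℚ n ∣ ≡ ∣ q ∣ ^ℚ n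
∣^ℚ∣ q zero    = refl
∣^ℚ∣ q (suc n) = trans (∣p*q∣≡∣p∣*∣q∣ q (q ^ℚ n)) (cong (∣ q ∣ *_) (∣^ℚ∣ q n))

^ℚ-nonZero : ∀ {q} → q ≢ 0ℚ → ∀ n → q ^ℚ n ≢ 0ℚ
^ℚ-nonZero q≢0 zero    = λ ()
^ℚ-nonZero q≢0 (suc n) = *-nonZero q≢0 (^ℚ-nonZero q≢0 n)

/1≡fromℤ : ∀ z → z / 1 ≡ fromℤ z
/1≡fromℤ z = ↥p/↧p≡p (fromℤ z)

fromℤ-+ : ∀ a b → fromℤ (a ℤ.+ b) ≡ fromℤ a + fromℤ b
fromℤ-+ a b = trans (sym (/1≡fromℤ (a ℤ.+ b)))
  (cong (_/ 1) (sym (cong₂ ℤ._+_ (ℤₚ.*-identityʳ a) (ℤₚ.*-identityʳ b))))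

fromℤ-* : ∀ a b → fromℤ (a ℤ.* b) ≡ fromℤ a * fromℤ b
fromℤ-* a b = sym (/1≡fromℤ (a ℤ.* b))

fromℤ-neg : ∀ a → fromℤ (ℤ.- a) ≡ - fromℤ a
fromℤ-neg +0       = refl
fromℤ-neg +[1+ n ] = refl
fromℤ-neg -[1+ n ] = refl

fromℤ-mono-≤ : ∀ {a b} → a ℤ.≤ b → fromℤ a ≤ fromℤ b
fromℤ-mono-≤ {a} {b} a≤b = *≤* (subst₂ ℤ._≤_ (sym (ℤₚ.*-identityʳ a)) (sym (ℤₚ.*-identityʳ b)) a≤b)

fromℤ-nonZero : ∀ {a} → a ≢ ℤ.0ℤ → fromℤ a ≢ 0ℚ
fromℤ-nonZero a≢0 eq = a≢0 (cong ↥_ eq)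

-- A unary embedding: `⟦ suc n ⟧` unfolds to `⟦ n ⟧ + 1ℚ`, the shape in which the recurrences and
-- the ring solver meet it.
⟦_⟧ : ℕ → ℚ
⟦ zero  ⟧ = 0ℚ
⟦ suc n ⟧ = ⟦ n ⟧ + 1ℚ

⟦⟧≡fromℤ : ∀ n → ⟦ n ⟧ ≡ fromℤ (+ n)
⟦⟧≡fromℤ zero    = refl
⟦⟧≡fromℤ (suc n) = trans (cong (_+ 1ℚ) (⟦⟧≡fromℤ n)) (trans (+-comm (fromℤ (+ n)) 1ℚ) (sym (fromℤ-+ (+ 1) (+ n))))

⟦⟧-+ : ∀ m n → ⟦ m ℕ.+ n ⟧ ≡ ⟦ m ⟧ + ⟦ n ⟧
⟦⟧-+ m n = trans (⟦⟧≡fromℤ (m ℕ.+ n)) (trans (fromℤ-+ (+ m) (+ n)) (sym (cong₂ _+_ (⟦⟧≡fromℤ m) (⟦⟧≡fromℤ n))))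

⟦⟧-* : ∀ m n → ⟦ m ℕ.* n ⟧ ≡ ⟦ m ⟧ * ⟦ n ⟧
⟦⟧-* m n = begin
  ⟦ m ℕ.* n ⟧                ≡⟨ ⟦⟧≡fromℤ (m ℕ.* n) ⟩
  fromℤ (+ (m ℕ.* n))        ≡⟨ cong fromℤ (ℤₚ.pos-* m n) ⟩
  fromℤ (+ m ℤ.* + n)        ≡⟨ fromℤ-* (+ m) (+ n) ⟩
  fromℤ (+ m) * fromℤ (+ n)  ≡⟨ cong₂ _*_ (⟦⟧≡fromℤ m) (⟦⟧≡fromℤ n) ⟨
  ⟦ m ⟧ * ⟦ n ⟧              ∎
  where open ≡-Reasoning

⟦⟧-^ : ∀ m n → ⟦ m ^ n ⟧ ≡ ⟦ m ⟧ ^ℚ n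
⟦⟧-^ m zero    = refl
⟦⟧-^ m (suc n) = trans (⟦⟧-* m (m ^ n)) (cong (⟦ m ⟧ *_) (⟦⟧-^ m n))

⟦⟧-mono-≤ : ∀ {m n} → m ℕ.≤ n → ⟦ m ⟧ ≤ ⟦ n ⟧
⟦⟧-mono-≤ {m} {n} m≤n = subst₂ _≤_ (sym (⟦⟧≡fromℤ m)) (sym (⟦⟧≡fromℤ n)) (fromℤ-mono-≤ (ℤ.+≤+ m≤n))

0≤⟦⟧ : ∀ n → 0ℚ ≤ ⟦ n ⟧
0≤⟦⟧ n = ⟦⟧-mono-≤ {n = n} ℕ.z≤n

0<⟦suc⟧ : ∀ n → 0ℚ < ⟦ n ⟧ + 1ℚ
0<⟦suc⟧ n = subst (0ℚ <_) (sym (⟦⟧≡fromℤ (suc n))) (*<* (ℤ.+<+ (ℕ.s≤s ℕ.z≤n)))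

0<⟦⟧ : ∀ {n} → 1 ℕ.≤ n → 0ℚ < ⟦ n ⟧
0<⟦⟧ {suc n} _ = 0<⟦suc⟧ n

∣fromℤ∣ : ∀ a → ∣ fromℤ a ∣ ≡ ⟦ ℤ.∣ a ∣ ⟧
∣fromℤ∣ a = sym (⟦⟧≡fromℤ ℤ.∣ a ∣)

IsInteger : ℚ → Set
IsInteger q = Σ ℤ λ a → q ≡ fromℤ a

fromℤ-isInteger : ∀ a → IsInteger (fromℤ a)
fromℤ-isInteger a = a , refl

+-isInteger : ∀ {p q} → IsInteger p → IsInteger q → IsInteger (p + q)
+-isInteger (a , refl) (b , refl) = a ℤ.+ b , sym (fromℤ-+ a b)

*-isInteger : ∀ {p q} → IsInteger p → IsInteger q → IsInteger (p * q)
*-isInteger (a , refl) (b , refl) = a ℤ.* b , sym (fromℤ-* a b)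

neg-isInteger : ∀ {p} → IsInteger p → IsInteger (- p)
neg-isInteger (a , refl) = ℤ.- a , sym (fromℤ-neg a)

minus-isInteger : ∀ {p q} → IsInteger p → IsInteger q → IsInteger (p - q)
minus-isInteger p∈ℤ q∈ℤ = +-isInteger p∈ℤ (neg-isInteger q∈ℤ)

⟦⟧-isInteger : ∀ n → IsInteger ⟦ n ⟧
⟦⟧-isInteger n = + n , ⟦⟧≡fromℤ n

^ℚ-isInteger : ∀ {q} → IsInteger q → ∀ n → IsInteger (q ^ℚ n)
^ℚ-isInteger q∈ℤ zero    = fromℤ-isInteger (+ 1)
^ℚ-isInteger q∈ℤ (suc n) = *-isInteger q∈ℤ (^ℚ-isInteger q∈ℤ n)

1≤∣integer∣ : ∀ {q} → IsInteger q → q ≢ 0ℚ → 1ℚ ≤ ∣ q ∣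
1≤∣integer∣ (+0       , refl) q≢0 = ⊥-elim (q≢0 refl)
1≤∣integer∣ (+[1+ n ] , refl) q≢0 = fromℤ-mono-≤ (ℤ.+≤+ (ℕ.s≤s ℕ.z≤n))
1≤∣integer∣ (-[1+ n ] , refl) q≢0 = fromℤ-mono-≤ (ℤ.+≤+ (ℕ.s≤s ℕ.z≤n))

recip-inverseˡ : ∀ {q} → 0ℚ < q → recip q * q ≡ 1ℚ
recip-inverseˡ {q} 0<q with q ≟ 0ℚ
... | yes q≡0 = ⊥-elim (<⇒≢ 0<q (sym q≡0))
... | no  q≢0 = *-inverseˡ q {{≢-nonZero q≢0}}

recip-inverseʳ : ∀ {q} → 0ℚ < q → q * recip q ≡ 1ℚ
recip-inverseʳ {q} 0<q = trans (*-comm q (recip q)) (recip-inverseˡ 0<q)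

0<recip : ∀ {q} → 0ℚ < q → 0ℚ < recip q
0<recip {q} 0<q with q ≟ 0ℚ
... | yes q≡0 = ⊥-elim (<⇒≢ 0<q (sym q≡0))
... | no  q≢0 = positive⁻¹ _ {{1/pos⇒pos q {{positive 0<q}}}}

recip-≤ : ∀ {p q} → 0ℚ < p → 1ℚ ≤ q * p → recip p ≤ q
recip-≤ {p} {q} 0<p 1≤qp = *-cancelˡ-≤ p 0<p
  (subst₂ _≤_ (sym (recip-inverseʳ 0<p)) (*-comm q p) 1≤qp)

-- The Padé table of √(1 − 4s)

-- The binomial coefficient of `a + b` over `a`, indexed like the Padé table.
bin : ℕ → ℕ → ℕ
bin zero    b       = 1
bin (suc a) zero    = 1
bin (suc a) (suc b) = bin (suc a) b ℕ.+ bin a (suc b)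

-- Both sides equal (a + b + 1)! / (a! b!). This is the relation `Shift` at x = 0.
bin-shift : ∀ a b → suc b ℕ.* bin a (suc b) ≡ suc a ℕ.* bin (suc a) b
bin-shift zero zero = refl
bin-shift zero (suc b) = begin
  suc (suc b) ℕ.* 1                ≡⟨ lemma b ⟩
  suc b ℕ.* 1 ℕ.+ 1                ≡⟨ cong (ℕ._+ 1) (bin-shift zero b) ⟩
  1 ℕ.* bin 1 b ℕ.+ 1              ≡⟨ lemma′ (bin 1 b) ⟩
  1 ℕ.* (bin 1 b ℕ.+ 1)            ∎
  where
  open ≡-Reasoning
  lemma : ∀ b → suc (suc b) ℕ.* 1 ≡ suc b ℕ.* 1 ℕ.+ 1
  lemma = solveℕ-∀
  lemma′ : ∀ c → 1 ℕ.* c ℕ.+ 1 ≡ 1 ℕ.* (c ℕ.+ 1)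
  lemma′ = solveℕ-∀
bin-shift (suc a) zero = begin
  1 ℕ.* (1 ℕ.+ bin a 1)            ≡⟨ lemma (bin a 1) ⟩
  1 ℕ.+ 1 ℕ.* bin a 1              ≡⟨ cong (1 ℕ.+_) (bin-shift a zero) ⟩
  1 ℕ.+ suc a ℕ.* 1                ≡⟨ lemma′ a ⟩
  suc (suc a) ℕ.* 1                ∎
  where
  open ≡-Reasoning
  lemma : ∀ c → 1 ℕ.* (1 ℕ.+ c) ≡ 1 ℕ.+ 1 ℕ.* c
  lemma = solveℕ-∀
  lemma′ : ∀ a → 1 ℕ.+ suc a ℕ.* 1 ≡ suc (suc a) ℕ.* 1
  lemma′ = solveℕ-∀
bin-shift (suc a) (suc b) = begin
  suc (suc b) ℕ.* (bin (suc a) (suc b) ℕ.+ bin a (suc (suc b)))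
    ≡⟨ ℕₚ.*-distribˡ-+ (suc (suc b)) (bin (suc a) (suc b)) _ ⟩
  suc (suc b) ℕ.* bin (suc a) (suc b) ℕ.+ suc (suc b) ℕ.* bin a (suc (suc b))
    ≡⟨ cong (suc (suc b) ℕ.* bin (suc a) (suc b) ℕ.+_) (bin-shift a (suc b)) ⟩
  suc (suc b) ℕ.* bin (suc a) (suc b) ℕ.+ suc a ℕ.* bin (suc a) (suc b)
    ≡⟨ lemma a b (bin (suc a) (suc b)) ⟩
  suc b ℕ.* bin (suc a) (suc b) ℕ.+ suc (suc a) ℕ.* bin (suc a) (suc b)
    ≡⟨ cong (ℕ._+ suc (suc a) ℕ.* bin (suc a) (suc b)) (bin-shift (suc a) b) ⟩
  suc (suc a) ℕ.* bin (suc (suc a)) b ℕ.+ suc (suc a) ℕ.* bin (suc a) (suc b)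
    ≡⟨ ℕₚ.*-distribˡ-+ (suc (suc a)) (bin (suc (suc a)) b) _ ⟨
  suc (suc a) ℕ.* (bin (suc (suc a)) b ℕ.+ bin (suc a) (suc b)) ∎
  where
  open ≡-Reasoning
  lemma : ∀ a b c → suc (suc b) ℕ.* c ℕ.+ suc a ℕ.* c ≡ suc b ℕ.* c ℕ.+ suc (suc a) ℕ.* c
  lemma = solveℕ-∀

central : ℕ → ℕ
central k = bin k k

central-suc : ∀ k → suc k ℕ.* central (suc k) ≡ 2 ℕ.* (2 ℕ.* k ℕ.+ 1) ℕ.* central k
central-suc k = begin
  suc k ℕ.* (bin (suc k) k ℕ.+ bin k (suc k))
    ≡⟨ ℕₚ.*-distribˡ-+ (suc k) (bin (suc k) k) _ ⟩
  suc k ℕ.* bin (suc k) k ℕ.+ suc k ℕ.* bin k (suc k)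
    ≡⟨ cong₂ ℕ._+_ (below k) (trans (bin-shift k k) (below k)) ⟩
  (2 ℕ.* k ℕ.+ 1) ℕ.* bin k k ℕ.+ (2 ℕ.* k ℕ.+ 1) ℕ.* bin k k
    ≡⟨ lemma (2 ℕ.* k ℕ.+ 1) (bin k k) ⟩
  2 ℕ.* (2 ℕ.* k ℕ.+ 1) ℕ.* bin k k ∎
  where
  open ≡-Reasoning
  lemma : ∀ n c → n ℕ.* c ℕ.+ n ℕ.* c ≡ 2 ℕ.* n ℕ.* c
  lemma = solveℕ-∀
  lemma′ : ∀ k c → suc k ℕ.* c ℕ.+ suc (suc k) ℕ.* c ≡ (2 ℕ.* suc k ℕ.+ 1) ℕ.* c
  lemma′ = solveℕ-∀
  below : ∀ k → suc k ℕ.* bin (suc k) k ≡ (2 ℕ.* k ℕ.+ 1) ℕ.* bin k k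
  below zero    = refl
  below (suc k) = begin
    suc (suc k) ℕ.* (bin (suc (suc k)) k ℕ.+ bin (suc k) (suc k))
      ≡⟨ ℕₚ.*-distribˡ-+ (suc (suc k)) (bin (suc (suc k)) k) _ ⟩
    suc (suc k) ℕ.* bin (suc (suc k)) k ℕ.+ suc (suc k) ℕ.* bin (suc k) (suc k)
      ≡⟨ cong (ℕ._+ suc (suc k) ℕ.* bin (suc k) (suc k)) (bin-shift (suc k) k) ⟨
    suc k ℕ.* bin (suc k) (suc k) ℕ.+ suc (suc k) ℕ.* bin (suc k) (suc k)
      ≡⟨ lemma′ k (bin (suc k) (suc k)) ⟩
    (2 ℕ.* suc k ℕ.+ 1) ℕ.* bin (suc k) (suc k) ∎

4ℚ : ℚ
4ℚ = ⟦ 4 ⟧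

-- The coefficients of 1/√(1 − 4s).
c : ℕ → ℚ
c k = ⟦ central k ⟧

c-suc : ∀ k → (⟦ k ⟧ + 1ℚ) * c (suc k) ≡ 4ℚ * (⟦ k ⟧ + ½) * c k
c-suc k = begin
  (⟦ k ⟧ + 1ℚ) * c (suc k)                     ≡⟨⟩
  ⟦ suc k ⟧ * c (suc k)                        ≡⟨ ⟦⟧-* (suc k) (central (suc k)) ⟨
  ⟦ suc k ℕ.* central (suc k) ⟧                ≡⟨ cong ⟦_⟧ (central-suc k) ⟩
  ⟦ 2 ℕ.* (2 ℕ.* k ℕ.+ 1) ℕ.* central k ⟧      ≡⟨ ⟦⟧-* (2 ℕ.* (2 ℕ.* k ℕ.+ 1)) (central k) ⟩
  ⟦ 2 ℕ.* (2 ℕ.* k ℕ.+ 1) ⟧ * c k              ≡⟨ cong (_* c k) (⟦⟧-* 2 (2 ℕ.* k ℕ.+ 1)) ⟩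
  ⟦ 2 ⟧ * ⟦ 2 ℕ.* k ℕ.+ 1 ⟧ * c k              ≡⟨ cong (λ q → ⟦ 2 ⟧ * q * c k) (⟦⟧-+ (2 ℕ.* k) 1) ⟩
  ⟦ 2 ⟧ * (⟦ 2 ℕ.* k ⟧ + 1ℚ) * c k             ≡⟨ cong (λ q → ⟦ 2 ⟧ * (q + 1ℚ) * c k) (⟦⟧-* 2 k) ⟩
  ⟦ 2 ⟧ * (⟦ 2 ⟧ * ⟦ k ⟧ + 1ℚ) * c k           ≡⟨ lemma ⟦ k ⟧ (c k) ⟩
  4ℚ * (⟦ k ⟧ + ½) * c k                       ∎
  where
  open ≡-Reasoning
  lemma : ∀ k c → fromℤ (+ 2) * (fromℤ (+ 2) * k + 1ℚ) * c ≡ fromℤ (+ 4) * (k + ½) * c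
  lemma = solve-∀ ring

-- The coefficients of √(1 − 4s).
y : ℕ → ℚ
y zero    = 1ℚ
y (suc k) = c (suc k) - 4ℚ * c k

-- The definition of `y` as a difference makes integrality evident; this form, minus twice a Catalan
-- number, shows that the coefficients do not vanish and yields their recurrence.
y-closed : ∀ k → (⟦ k ⟧ + 1ℚ) * y (suc k) ≡ - ⟦ 2 ⟧ * c k
y-closed k = begin
  (⟦ k ⟧ + 1ℚ) * (c (suc k) - 4ℚ * c k)             ≡⟨ lemma ⟦ k ⟧ (c (suc k)) (c k) ⟩
  (⟦ k ⟧ + 1ℚ) * c (suc k) - (⟦ k ⟧ + 1ℚ) * 4ℚ * c k ≡⟨ cong (_- (⟦ k ⟧ + 1ℚ) * 4ℚ * c k) (c-suc k) ⟩
  4ℚ * (⟦ k ⟧ + ½) * c k - (⟦ k ⟧ + 1ℚ) * 4ℚ * c k   ≡⟨ lemma′ ⟦ k ⟧ (c k) ⟩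
  - ⟦ 2 ⟧ * c k                                      ∎
  where
  open ≡-Reasoning
  lemma : ∀ k c′ c → (k + 1ℚ) * (c′ - fromℤ (+ 4) * c) ≡ (k + 1ℚ) * c′ - (k + 1ℚ) * fromℤ (+ 4) * c
  lemma = solve-∀ ring
  lemma′ : ∀ k c → fromℤ (+ 4) * (k + ½) * c - (k + 1ℚ) * fromℤ (+ 4) * c ≡ - fromℤ (+ 2) * c
  lemma′ = solve-∀ ring

y-suc : ∀ k → (⟦ suc k ⟧ + 1ℚ) * y (suc (suc k)) ≡ 4ℚ * (⟦ k ⟧ + ½) * y (suc k)
y-suc k = *-cancelˡ-≡ (⟦ k ⟧ + 1ℚ) (0<⟦suc⟧ k) (begin
  (⟦ k ⟧ + 1ℚ) * ((⟦ suc k ⟧ + 1ℚ) * y (suc (suc k)))   ≡⟨ cong ((⟦ k ⟧ + 1ℚ) *_) (y-closed (suc k)) ⟩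
  (⟦ k ⟧ + 1ℚ) * (- ⟦ 2 ⟧ * c (suc k))                  ≡⟨ lemma ⟦ k ⟧ (c (suc k)) ⟩
  - ⟦ 2 ⟧ * ((⟦ k ⟧ + 1ℚ) * c (suc k))                  ≡⟨ cong (- ⟦ 2 ⟧ *_) (c-suc k) ⟩
  - ⟦ 2 ⟧ * (4ℚ * (⟦ k ⟧ + ½) * c k)                    ≡⟨ lemma′ ⟦ k ⟧ (c k) ⟩
  4ℚ * (⟦ k ⟧ + ½) * (- ⟦ 2 ⟧ * c k)                    ≡⟨ cong (4ℚ * (⟦ k ⟧ + ½) *_) (y-closed k) ⟨
  4ℚ * (⟦ k ⟧ + ½) * ((⟦ k ⟧ + 1ℚ) * y (suc k))         ≡⟨ lemma″ ⟦ k ⟧ (y (suc k)) ⟩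
  (⟦ k ⟧ + 1ℚ) * (4ℚ * (⟦ k ⟧ + ½) * y (suc k))         ∎)
  where
  open ≡-Reasoning
  lemma : ∀ k c → (k + 1ℚ) * (- fromℤ (+ 2) * c) ≡ - fromℤ (+ 2) * ((k + 1ℚ) * c)
  lemma = solve-∀ ring
  lemma′ : ∀ k c → - fromℤ (+ 2) * (fromℤ (+ 4) * (k + ½) * c) ≡ fromℤ (+ 4) * (k + ½) * (- fromℤ (+ 2) * c)
  lemma′ = solve-∀ ring
  lemma″ : ∀ k y → fromℤ (+ 4) * (k + ½) * ((k + 1ℚ) * y) ≡ (k + 1ℚ) * (fromℤ (+ 4) * (k + ½) * y)
  lemma″ = solve-∀ ring

p≡q⇒p-q≡0 : ∀ {p q} → p ≡ q → p - q ≡ 0ℚ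
p≡q⇒p-q≡0 {p} refl = +-inverseʳ p

p-q≡0⇒p≡q : ∀ {p q} → p - q ≡ 0ℚ → p ≡ q
p-q≡0⇒p≡q {p} {q} eq = trans (lemma p q) (trans (cong (_+ q) eq) (+-identityˡ q))
  where
  lemma : ∀ p q → p ≡ p - q + q
  lemma = solve-∀ ring

Pascal : ℚ → (ℕ → ℕ → ℚ) → Set
Pascal x w = ∀ a b → w (suc a) (suc b) ≡ w (suc a) b + w a (suc b) - x * w a b

-- A contiguous relation of hypergeometric polynomials. Numerators and denominators obey it with the
-- same coefficients, so the `x` term drops out of cross determinants.
Shift : ℚ → (ℕ → ℕ → ℚ) → ℕ → ℕ → Set
Shift x w a b = (⟦ b ⟧ + 1ℚ) * w a (suc b) ≡ (⟦ a ⟧ + 1ℚ) * w (suc a) b + (⟦ b ⟧ - ⟦ a ⟧ + ½) * x * w a b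

-- The defect of the shift relation itself obeys the Pascal recurrence, so it vanishes once it does on the boundary.
shift-step : ∀ A B x w₁ w₂ w₃ w₄ w₅ w₆ u₁ u₂ →
  u₁ ≡ w₁ + w₂ - x * w₃ → u₂ ≡ w₄ + w₁ - x * w₅ → w₁ ≡ w₅ + w₃ - x * w₆ →
  (B + 1ℚ + 1ℚ) * w₂ ≡ (A + 1ℚ) * w₁ + (B + 1ℚ - A + ½) * x * w₃ →
  (B + 1ℚ) * w₁ ≡ (A + 1ℚ + 1ℚ) * w₄ + (B - (A + 1ℚ) + ½) * x * w₅ →
  (B + 1ℚ) * w₃ ≡ (A + 1ℚ) * w₅ + (B - A + ½) * x * w₆ →
  (B + 1ℚ + 1ℚ) * u₁ ≡ (A + 1ℚ + 1ℚ) * u₂ + (B + 1ℚ - (A + 1ℚ) + ½) * x * w₁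
shift-step A B x w₁ w₂ w₃ w₄ w₅ w₆ _ _ refl refl w₁-eq e₁ e₂ e₃ = p-q≡0⇒p≡q (begin
  (B + 1ℚ + 1ℚ) * (w₁ + w₂ - x * w₃) - ((A + 1ℚ + 1ℚ) * (w₄ + w₁ - x * w₅) + (B + 1ℚ - (A + 1ℚ) + ½) * x * w₁)
    ≡⟨ cong (λ w → (B + 1ℚ + 1ℚ) * (w₁ + w₂ - x * w₃) - ((A + 1ℚ + 1ℚ) * (w₄ + w₁ - x * w₅) + (B + 1ℚ - (A + 1ℚ) + ½) * x * w)) w₁-eq ⟩
  (B + 1ℚ + 1ℚ) * (w₁ + w₂ - x * w₃) - ((A + 1ℚ + 1ℚ) * (w₄ + w₁ - x * w₅) + (B + 1ℚ - (A + 1ℚ) + ½) * x * (w₅ + w₃ - x * w₆))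
    ≡⟨ lemma A B x w₁ w₂ w₃ w₄ w₅ w₆ ⟩
  ((B + 1ℚ + 1ℚ) * w₂ - ((A + 1ℚ) * w₁ + (B + 1ℚ - A + ½) * x * w₃))
    + ((B + 1ℚ) * w₁ - ((A + 1ℚ + 1ℚ) * w₄ + (B - (A + 1ℚ) + ½) * x * w₅))
    - x * ((B + 1ℚ) * w₃ - ((A + 1ℚ) * w₅ + (B - A + ½) * x * w₆))
    ≡⟨ cong₂ _-_ (cong₂ _+_ (p≡q⇒p-q≡0 e₁) (p≡q⇒p-q≡0 e₂)) (cong (x *_) (p≡q⇒p-q≡0 e₃)) ⟩
  0ℚ + 0ℚ - x * 0ℚ
    ≡⟨ zeros x ⟩
  0ℚ ∎)
  where
  open ≡-Reasoning
  lemma : ∀ A B x w₁ w₂ w₃ w₄ w₅ w₆ →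
    (B + 1ℚ + 1ℚ) * (w₁ + w₂ - x * w₃) - ((A + 1ℚ + 1ℚ) * (w₄ + w₁ - x * w₅) + (B + 1ℚ - (A + 1ℚ) + ½) * x * (w₅ + w₃ - x * w₆))
    ≡ ((B + 1ℚ + 1ℚ) * w₂ - ((A + 1ℚ) * w₁ + (B + 1ℚ - A + ½) * x * w₃))
      + ((B + 1ℚ) * w₁ - ((A + 1ℚ + 1ℚ) * w₄ + (B - (A + 1ℚ) + ½) * x * w₅))
      - x * ((B + 1ℚ) * w₃ - ((A + 1ℚ) * w₅ + (B - A + ½) * x * w₆))
  lemma = solve-∀ ring
  zeros : ∀ x → 0ℚ + 0ℚ - x * 0ℚ ≡ 0ℚ
  zeros = solve-∀ ring

shift-from-boundary : ∀ {x w} → Pascal x w → (∀ a → Shift x w a 0) → (∀ b → Shift x w 0 b) → ∀ a b → Shift x w a b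
shift-from-boundary {x} {w} pascal bottom left = go
  where
  go : ∀ a b → Shift x w a b
  go zero    b       = left b
  go (suc a) zero    = bottom (suc a)
  go (suc a) (suc b) = shift-step ⟦ a ⟧ ⟦ b ⟧ x
    (w (suc a) (suc b)) (w a (suc (suc b))) (w a (suc b)) (w (suc (suc a)) b) (w (suc a) b) (w a b)
    (w (suc a) (suc (suc b))) (w (suc (suc a)) (suc b))
    (pascal a (suc b)) (pascal (suc a) b) (pascal a b) (go a (suc b)) (go (suc a) b) (go a b)

module PadéTable (s : ℚ) where

  x : ℚ
  x = 4ℚ * s

  -- The Padé pair of degrees (a, b), normalised so that Q a b = binom(a + b, a) at x = 0: with this scaling
  -- numerators and denominators satisfy a Pascal recurrence, and their coefficients in s are integers.
  P Q : ℕ → ℕ → ℚ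
  P zero    b       = 1ℚ
  P (suc a) zero    = P a zero + y (suc a) * s ^ℚ suc a
  P (suc a) (suc b) = P (suc a) b + P a (suc b) - x * P a b
  Q zero    zero    = 1ℚ
  Q (suc a) zero    = 1ℚ
  Q zero    (suc b) = Q zero b + c (suc b) * s ^ℚ suc b
  Q (suc a) (suc b) = Q (suc a) b + Q a (suc b) - x * Q a b

  Q-zeroʳ : ∀ a → Q a 0 ≡ 1ℚ
  Q-zeroʳ zero    = refl
  Q-zeroʳ (suc a) = refl

  P-left : ∀ b → Shift x P 0 b
  P-left zero = lemma s
    where
    lemma : ∀ s → (0ℚ + 1ℚ) * 1ℚ ≡ (0ℚ + 1ℚ) * (1ℚ + (fromℤ (+ 2) - fromℤ (+ 4) * fromℤ (+ 1)) * (s * 1ℚ)) + (0ℚ - 0ℚ + ½) * (fromℤ (+ 4) * s) * 1ℚ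
    lemma = solve-∀ ring
  P-left (suc b) = begin
    (⟦ b ⟧ + 1ℚ + 1ℚ) * 1ℚ                                             ≡⟨ lemma ⟦ b ⟧ ⟩
    (⟦ b ⟧ + 1ℚ) * 1ℚ + 1ℚ                                             ≡⟨ cong (_+ 1ℚ) (P-left b) ⟩
    (⟦ 0 ⟧ + 1ℚ) * P 1 b + (⟦ b ⟧ - ⟦ 0 ⟧ + ½) * x * 1ℚ + 1ℚ           ≡⟨ lemma′ ⟦ b ⟧ x (P 1 b) ⟩
    (⟦ 0 ⟧ + 1ℚ) * (P 1 b + 1ℚ - x * 1ℚ) + (⟦ b ⟧ + 1ℚ - ⟦ 0 ⟧ + ½) * x * 1ℚ ∎
    where
    open ≡-Reasoning
    lemma : ∀ b → (b + 1ℚ + 1ℚ) * 1ℚ ≡ (b + 1ℚ) * 1ℚ + 1ℚ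
    lemma = solve-∀ ring
    lemma′ : ∀ b x p → (0ℚ + 1ℚ) * p + (b - 0ℚ + ½) * x * 1ℚ + 1ℚ ≡ (0ℚ + 1ℚ) * (p + 1ℚ - x * 1ℚ) + (b + 1ℚ - 0ℚ + ½) * x * 1ℚ
    lemma′ = solve-∀ ring

  -- Along the Taylor polynomials the defect of the relation changes from `a` to `suc a` by a
  -- multiple of the defect of `y-suc`, which is zero. `Q-left` works in the same way with `c-suc`.
  P-bottom : ∀ a → Shift x P a 0
  P-bottom zero = P-left zero
  P-bottom (suc a) =
    p-q≡0⇒p≡q (trans (lemma ⟦ a ⟧ s (P a 1) (P a 0) (y (suc a)) (y (suc (suc a))) (s ^ℚ a))
      (trans (cong₂ _-_ (p≡q⇒p-q≡0 (P-bottom a)) (cong (_* (s * (s * s ^ℚ a))) (p≡q⇒p-q≡0 (y-suc a)))) (zeros (s * (s * s ^ℚ a)))))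
    where
    zeros : ∀ x → 0ℚ - 0ℚ * x ≡ 0ℚ
    zeros = solve-∀ ring
    lemma : ∀ a s p₁ p₀ y₁ y₂ t →
      (0ℚ + 1ℚ) * (p₀ + y₁ * (s * t) + p₁ - fromℤ (+ 4) * s * p₀)
        - ((a + 1ℚ + 1ℚ) * (p₀ + y₁ * (s * t) + y₂ * (s * (s * t))) + (0ℚ - (a + 1ℚ) + ½) * (fromℤ (+ 4) * s) * (p₀ + y₁ * (s * t)))
      ≡ ((0ℚ + 1ℚ) * p₁ - ((a + 1ℚ) * (p₀ + y₁ * (s * t)) + (0ℚ - a + ½) * (fromℤ (+ 4) * s) * p₀))
        - ((a + 1ℚ + 1ℚ) * y₂ - fromℤ (+ 4) * (a + ½) * y₁) * (s * (s * t))
    lemma = solve-∀ ring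

  Q-bottom : ∀ a → Shift x Q a 0
  Q-bottom zero = lemma s
    where
    lemma : ∀ s → (0ℚ + 1ℚ) * (1ℚ + fromℤ (+ 2) * (s * 1ℚ)) ≡ (0ℚ + 1ℚ) * 1ℚ + (0ℚ - 0ℚ + ½) * (fromℤ (+ 4) * s) * 1ℚ
    lemma = solve-∀ ring
  Q-bottom (suc a) = begin
    (⟦ 0 ⟧ + 1ℚ) * (1ℚ + Q a 1 - x * Q a 0)                                     ≡⟨ lemma (Q a 1) x (Q a 0) ⟩
    (⟦ 0 ⟧ + 1ℚ) * Q a 1 + (1ℚ - x * Q a 0)                                      ≡⟨ cong (_+ (1ℚ - x * Q a 0)) (Q-bottom a) ⟩
    (⟦ a ⟧ + 1ℚ) * 1ℚ + (⟦ 0 ⟧ - ⟦ a ⟧ + ½) * x * Q a 0 + (1ℚ - x * Q a 0)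
      ≡⟨ cong (λ q → (⟦ a ⟧ + 1ℚ) * 1ℚ + (⟦ 0 ⟧ - ⟦ a ⟧ + ½) * x * q + (1ℚ - x * q)) (Q-zeroʳ a) ⟩
    (⟦ a ⟧ + 1ℚ) * 1ℚ + (⟦ 0 ⟧ - ⟦ a ⟧ + ½) * x * 1ℚ + (1ℚ - x * 1ℚ)             ≡⟨ lemma′ ⟦ a ⟧ x ⟩
    (⟦ a ⟧ + 1ℚ + 1ℚ) * 1ℚ + (⟦ 0 ⟧ - (⟦ a ⟧ + 1ℚ) + ½) * x * 1ℚ                 ∎
    where
    open ≡-Reasoning
    lemma : ∀ q x q₀ → (0ℚ + 1ℚ) * (1ℚ + q - x * q₀) ≡ (0ℚ + 1ℚ) * q + (1ℚ - x * q₀)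
    lemma = solve-∀ ring
    lemma′ : ∀ a x → (a + 1ℚ) * 1ℚ + (0ℚ - a + ½) * x * 1ℚ + (1ℚ - x * 1ℚ) ≡ (a + 1ℚ + 1ℚ) * 1ℚ + (0ℚ - (a + 1ℚ) + ½) * x * 1ℚ
    lemma′ = solve-∀ ring

  Q-left : ∀ b → Shift x Q 0 b
  Q-left zero = Q-bottom zero
  Q-left (suc b) =
    p-q≡0⇒p≡q (trans (lemma ⟦ b ⟧ s (Q 0 b) (Q 1 b) (c (suc b)) (c (suc (suc b))) (s ^ℚ b))
      (trans (cong₂ _+_ (p≡q⇒p-q≡0 (Q-left b)) (cong (_* (s * (s * s ^ℚ b))) (p≡q⇒p-q≡0 (c-suc (suc b))))) (zeros (s * (s * s ^ℚ b)))))
    where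
    zeros : ∀ x → 0ℚ + 0ℚ * x ≡ 0ℚ
    zeros = solve-∀ ring
    lemma : ∀ b s q₀ q₁ c₁ c₂ t →
      (b + 1ℚ + 1ℚ) * (q₀ + c₁ * (s * t) + c₂ * (s * (s * t)))
        - ((0ℚ + 1ℚ) * (q₁ + (q₀ + c₁ * (s * t)) - fromℤ (+ 4) * s * q₀) + (b + 1ℚ - 0ℚ + ½) * (fromℤ (+ 4) * s) * (q₀ + c₁ * (s * t)))
      ≡ ((b + 1ℚ) * (q₀ + c₁ * (s * t)) - ((0ℚ + 1ℚ) * q₁ + (b - 0ℚ + ½) * (fromℤ (+ 4) * s) * q₀))
        + ((b + 1ℚ + 1ℚ) * c₂ - fromℤ (+ 4) * (b + 1ℚ + ½) * c₁) * (s * (s * t))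
    lemma = solve-∀ ring

  P-shift : ∀ a b → Shift x P a b
  P-shift = shift-from-boundary (λ a b → refl) P-bottom P-left

  Q-shift : ∀ a b → Shift x Q a b
  Q-shift = shift-from-boundary (λ a b → refl) Q-bottom Q-left

  -- Cross determinants of neighbours in the direction of `a` and of `b`; divided by the two
  -- denominators they are the differences of neighbouring approximants.
  D V : ℕ → ℕ → ℚ
  D a b = P (suc a) b * Q a b - P a b * Q (suc a) b
  V a b = P a (suc b) * Q a b - P a b * Q a (suc b)

  V-D : ∀ a b → (⟦ b ⟧ + 1ℚ) * V a b ≡ (⟦ a ⟧ + 1ℚ) * D a b
  V-D a b = begin
    (⟦ b ⟧ + 1ℚ) * V a b
      ≡⟨ lemma (⟦ b ⟧ + 1ℚ) (P a (suc b)) (Q a b) (P a b) (Q a (suc b)) ⟩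
    ((⟦ b ⟧ + 1ℚ) * P a (suc b)) * Q a b - P a b * ((⟦ b ⟧ + 1ℚ) * Q a (suc b))
      ≡⟨ cong₂ (λ p q → p * Q a b - P a b * q) (P-shift a b) (Q-shift a b) ⟩
    ((⟦ a ⟧ + 1ℚ) * P (suc a) b + κ * x * P a b) * Q a b - P a b * ((⟦ a ⟧ + 1ℚ) * Q (suc a) b + κ * x * Q a b)
      ≡⟨ lemma′ (⟦ a ⟧ + 1ℚ) (κ * x) (P (suc a) b) (P a b) (Q (suc a) b) (Q a b) ⟩
    (⟦ a ⟧ + 1ℚ) * D a b ∎
    where
    open ≡-Reasoning
    κ = ⟦ b ⟧ - ⟦ a ⟧ + ½
    lemma : ∀ n p q p′ q′ → n * (p * q - p′ * q′) ≡ (n * p) * q - p′ * (n * q′)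
    lemma = solve-∀ ring
    lemma′ : ∀ n m p₁ p₀ q₁ q₀ → (n * p₁ + m * p₀) * q₀ - p₀ * (n * q₁ + m * q₀) ≡ n * (p₁ * q₀ - p₀ * q₁)
    lemma′ = solve-∀ ring

  -- Pascal eliminates the entry at `(suc a, suc b)` and the shift relation the one at `(a, suc b)`.
  -- Starting from `D a 0`, a multiple of `s ^ℚ suc a`, it follows that `D a b` is a nonzero
  -- constant times the power `a + b + 1` of `s`.
  D-suc : ∀ a b → (⟦ b ⟧ + 1ℚ) * D a (suc b) ≡ (⟦ b ⟧ + 1ℚ + ½) * x * D a b
  D-suc a b = begin
    (⟦ b ⟧ + 1ℚ) * D a (suc b)
      ≡⟨ lemma (⟦ b ⟧ + 1ℚ) x (P (suc a) b) (P a (suc b)) (P a b) (Q (suc a) b) (Q a (suc b)) (Q a b) ⟩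
    (P (suc a) b - x * P a b) * ((⟦ b ⟧ + 1ℚ) * Q a (suc b)) - ((⟦ b ⟧ + 1ℚ) * P a (suc b)) * (Q (suc a) b - x * Q a b)
      ≡⟨ cong₂ (λ p q → (P (suc a) b - x * P a b) * q - p * (Q (suc a) b - x * Q a b)) (P-shift a b) (Q-shift a b) ⟩
    (P (suc a) b - x * P a b) * ((⟦ a ⟧ + 1ℚ) * Q (suc a) b + (⟦ b ⟧ - ⟦ a ⟧ + ½) * x * Q a b)
      - ((⟦ a ⟧ + 1ℚ) * P (suc a) b + (⟦ b ⟧ - ⟦ a ⟧ + ½) * x * P a b) * (Q (suc a) b - x * Q a b)
      ≡⟨ lemma′ ⟦ a ⟧ ⟦ b ⟧ x (P (suc a) b) (P a b) (Q (suc a) b) (Q a b) ⟩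
    (⟦ b ⟧ + 1ℚ + ½) * x * D a b ∎
    where
    open ≡-Reasoning
    lemma : ∀ n x p₁ p₂ p₀ q₁ q₂ q₀ →
      n * ((p₁ + p₂ - x * p₀) * q₂ - p₂ * (q₁ + q₂ - x * q₀)) ≡ (p₁ - x * p₀) * (n * q₂) - (n * p₂) * (q₁ - x * q₀)
    lemma = solve-∀ ring
    lemma′ : ∀ a b x p₁ p₀ q₁ q₀ →
      (p₁ - x * p₀) * ((a + 1ℚ) * q₁ + (b - a + ½) * x * q₀) - ((a + 1ℚ) * p₁ + (b - a + ½) * x * p₀) * (q₁ - x * q₀)
      ≡ (b + 1ℚ + ½) * x * (p₁ * q₀ - p₀ * q₁)
    lemma′ = solve-∀ ring

-- Bounds for coefficients and denominators when |x| ≤ 1/4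

bin-pos : ∀ a b → 1 ℕ.≤ bin a b
bin-pos zero    b       = ℕ.s≤s ℕ.z≤n
bin-pos (suc a) zero    = ℕ.s≤s ℕ.z≤n
bin-pos (suc a) (suc b) = ℕₚ.≤-trans (bin-pos (suc a) b) (ℕₚ.m≤m+n _ _)

0<c : ∀ k → 0ℚ < c k
0<c k = 0<⟦⟧ (bin-pos k k)

c-suc-≤ : ∀ k → c (suc k) ≤ 4ℚ * c k
c-suc-≤ k = *-cancelˡ-≤ (⟦ k ⟧ + 1ℚ) (0<⟦suc⟧ k) (≤-by-difference (⟦ 2 ⟧ * c k) (0≤* (0≤⟦⟧ 2) (<⇒≤ (0<c k)))
  (trans (lemma ⟦ k ⟧ (c k)) (cong (_+ ⟦ 2 ⟧ * c k) (sym (c-suc k)))))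
  where
  lemma : ∀ k c → (k + 1ℚ) * (fromℤ (+ 4) * c) ≡ fromℤ (+ 4) * (k + ½) * c + fromℤ (+ 2) * c
  lemma = solve-∀ ring

c≤4^ : ∀ k → c k ≤ 4ℚ ^ℚ k
c≤4^ zero    = ≤-refl
c≤4^ (suc k) = ≤-trans (c-suc-≤ k) (*-monoˡ-≤ 4ℚ (0≤⟦⟧ 4) (c≤4^ k))

∣y∣≤4^ : ∀ k → ∣ y (suc k) ∣ ≤ 4ℚ ^ℚ suc k
∣y∣≤4^ k = begin
  ∣ c (suc k) - 4ℚ * c k ∣   ≡⟨ ∣p-q∣≡∣q-p∣ (c (suc k)) (4ℚ * c k) ⟩
  ∣ 4ℚ * c k - c (suc k) ∣   ≡⟨ 0≤p⇒∣p∣≡p (p≤q⇒0≤q-p (c-suc-≤ k)) ⟩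
  4ℚ * c k - c (suc k)       ≤⟨ ≤-by-difference (c (suc k)) (<⇒≤ (0<c (suc k))) (lemma (4ℚ * c k) (c (suc k))) ⟩
  4ℚ * c k                   ≤⟨ *-monoˡ-≤ 4ℚ (0≤⟦⟧ 4) (c≤4^ k) ⟩
  4ℚ ^ℚ suc k                ∎
  where
  open ≤-Reasoning
  lemma : ∀ p q → p ≡ p - q + q
  lemma = solve-∀ ring

y-nonZero : ∀ k → y (suc k) ≢ 0ℚ
y-nonZero k y≡0 = *-nonZero { - ⟦ 2 ⟧} {c k} (λ ()) (λ c≡0 → <⇒≢ (0<c k) (sym c≡0))
  (trans (sym (y-closed k)) (trans (cong ((⟦ k ⟧ + 1ℚ) *_) y≡0) (*-zeroʳ (⟦ k ⟧ + 1ℚ))))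

1+n≤2^n : ∀ n → ⟦ n ⟧ + 1ℚ ≤ ⟦ 2 ⟧ ^ℚ n
1+n≤2^n zero    = ≤-refl
1+n≤2^n (suc n) = ≤-trans
  (≤-by-difference ⟦ n ⟧ (0≤⟦⟧ n) (lemma ⟦ n ⟧))
  (*-monoˡ-≤ ⟦ 2 ⟧ (0≤⟦⟧ 2) (1+n≤2^n n))
  where
  lemma : ∀ n → fromℤ (+ 2) * (n + 1ℚ) ≡ n + 1ℚ + 1ℚ + n
  lemma = solve-∀ ring

-- The induction drops the first step and replaces `C` by `C * t`; then `2 C t + C ≤ 2 C` because
-- `t ≤ ½`.
geometric-path : ∀ {C t} (f : ℕ → ℚ) → 0ℚ ≤ C → 0ℚ ≤ t → t ≤ ½ →
  (∀ n → ∣ f (suc n) - f n ∣ ≤ C * t ^ℚ n) → ∀ n → ∣ f n - f 0 ∣ ≤ ⟦ 2 ⟧ * C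
geometric-path {C} {t} f 0≤C 0≤t t≤½ step zero = subst (_≤ ⟦ 2 ⟧ * C) (cong ∣_∣ (sym (+-inverseʳ (f 0)))) (0≤* (0≤⟦⟧ 2) 0≤C)
geometric-path {C} {t} f 0≤C 0≤t t≤½ step (suc n) = begin
  ∣ f (suc n) - f 0 ∣                       ≤⟨ ∣p-r∣≤∣p-q∣+∣q-r∣ (f (suc n)) (f 1) (f 0) ⟩
  ∣ f (suc n) - f 1 ∣ + ∣ f 1 - f 0 ∣       ≤⟨ +-mono-≤ (geometric-path (λ n → f (suc n)) (0≤* 0≤C 0≤t) 0≤t t≤½
                                                 (λ n → ≤-trans (step (suc n)) (≤-reflexive (sym (*-assoc C t (t ^ℚ n))))) n) (step 0) ⟩
  ⟦ 2 ⟧ * (C * t) + C * 1ℚ                  ≤⟨ +-monoˡ-≤ (C * 1ℚ) (*-monoˡ-≤ ⟦ 2 ⟧ (0≤⟦⟧ 2) (*-monoˡ-≤ C 0≤C t≤½)) ⟩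
  ⟦ 2 ⟧ * (C * ½) + C * 1ℚ                  ≡⟨ lemma C ⟩
  ⟦ 2 ⟧ * C                                 ∎
  where
  open ≤-Reasoning
  lemma : ∀ C → fromℤ (+ 2) * (C * ½) + C * 1ℚ ≡ fromℤ (+ 2) * C
  lemma = solve-∀ ring

¼ : ℚ
¼ = + 1 / 4

module Estimates (s : ℚ) (∣x∣≤¼ : ∣ PadéTable.x s ∣ ≤ ¼) where

  open PadéTable s

  -- The factor 2 in `t` absorbs the ratio (b + 3/2) / (b + 1) from `D-suc` and, through
  -- `a + 1 ≤ 2^a`, the factor from `V-D`, so that one bound serves both determinants.
  X t : ℚ
  X = ∣ x ∣
  t = ⟦ 2 ⟧ * X

  0≤X : 0ℚ ≤ X
  0≤X = 0≤∣p∣ x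

  0≤t : 0ℚ ≤ t
  0≤t = 0≤* (0≤⟦⟧ 2) 0≤X

  t≤½ : t ≤ ½
  t≤½ = *-monoˡ-≤ ⟦ 2 ⟧ (0≤⟦⟧ 2) ∣x∣≤¼

  X≤t : X ≤ t
  X≤t = ≤-by-difference X 0≤X (lemma X)
    where
    lemma : ∀ X → fromℤ (+ 2) * X ≡ X + X
    lemma = solve-∀ ring

  ∣term∣≤ : ∀ q k → ∣ q ∣ ≤ 4ℚ ^ℚ k → ∣ q * s ^ℚ k ∣ ≤ X ^ℚ k
  ∣term∣≤ q k ∣q∣≤ = begin
    ∣ q * s ^ℚ k ∣             ≡⟨ ∣p*q∣≡∣p∣*∣q∣ q (s ^ℚ k) ⟩
    ∣ q ∣ * ∣ s ^ℚ k ∣         ≤⟨ *-monoʳ-≤ ∣ s ^ℚ k ∣ (0≤∣p∣ (s ^ℚ k)) ∣q∣≤ ⟩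
    4ℚ ^ℚ k * ∣ s ^ℚ k ∣       ≡⟨ cong (4ℚ ^ℚ k *_) (∣^ℚ∣ s k) ⟩
    4ℚ ^ℚ k * ∣ s ∣ ^ℚ k       ≡⟨ ^ℚ-distrib-* 4ℚ ∣ s ∣ k ⟨
    (4ℚ * ∣ s ∣) ^ℚ k          ≡⟨ cong (_^ℚ k) (∣p*q∣≡∣p∣*∣q∣ 4ℚ s) ⟨
    X ^ℚ k                     ∎
    where open ≤-Reasoning

  ∣c-term∣≤ : ∀ k → ∣ c k * s ^ℚ k ∣ ≤ X ^ℚ k
  ∣c-term∣≤ k = ∣term∣≤ (c k) k (≤-trans (≤-reflexive (0≤p⇒∣p∣≡p (<⇒≤ (0<c k)))) (c≤4^ k))

  -- The summand `½ * X ^ℚ b` is the slack that carries the induction: the next term is at least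
  -- `- X ^ℚ suc b`, and `½ X^b ≥ (3/2) X^(b+1)` for `X ≤ ¼`. `Z-upper` uses its subtracted power
  -- likewise.
  Z-lower : ∀ b → ½ + ½ * X ^ℚ b ≤ Q 0 b
  Z-lower zero    = ≤-refl
  Z-lower (suc b) = ≤-by-difference _
    (0≤+ (0≤+ (p≤q⇒0≤q-p (Z-lower b))
              (p≤q⇒0≤q-p (≤-trans (neg-antimono-≤ (∣c-term∣≤ (suc b))) (-∣p∣≤p (c (suc b) * s ^ℚ suc b)))))
         (0≤* (0≤+ (0≤* (0≤⟦⟧ 2) (p≤q⇒0≤q-p ∣x∣≤¼)) (0≤* {½} (≤ᵇ⇒≤ _) 0≤X)) (0≤^ℚ 0≤X b)))
    (lemma (Q 0 b) (c (suc b) * s ^ℚ suc b) X (X ^ℚ b))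
    where
    lemma : ∀ q m X T → q + m ≡ ½ + ½ * (X * T) + ((q - (½ + ½ * T)) + (m - - (X * T)) + (fromℤ (+ 2) * ((+ 1 / 4) - X) + ½ * X) * T)
    lemma = solve-∀ ring

  Z-upper : ∀ b → Q 0 b ≤ ⟦ 2 ⟧ - X ^ℚ b
  Z-upper zero    = ≤-refl
  Z-upper (suc b) = ≤-by-difference _
    (0≤+ (0≤+ (p≤q⇒0≤q-p (Z-upper b))
              (p≤q⇒0≤q-p (≤-trans (p≤∣p∣ (c (suc b) * s ^ℚ suc b)) (∣c-term∣≤ (suc b)))))
         (0≤* (0≤+ (0≤* (0≤⟦⟧ 2) (p≤q⇒0≤q-p ∣x∣≤¼)) (≤ᵇ⇒≤ {q = ½} _)) (0≤^ℚ 0≤X b)))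
    (lemma (Q 0 b) (c (suc b) * s ^ℚ suc b) X (X ^ℚ b))
    where
    lemma : ∀ q m X T → fromℤ (+ 2) - X * T ≡ q + m + ((fromℤ (+ 2) - T - q) + (X * T - m) + (fromℤ (+ 2) * ((+ 1 / 4) - X) + ½) * T)
    lemma = solve-∀ ring

  xq≤¼q : ∀ {q} → 0ℚ ≤ q → x * q ≤ ¼ * q
  xq≤¼q {q} 0≤q = *-monoʳ-≤ q 0≤q (≤-trans (p≤∣p∣ x) ∣x∣≤¼)

  -xq≤¼q : ∀ {q} → 0ℚ ≤ q → - (x * q) ≤ ¼ * q
  -xq≤¼q {q} 0≤q = subst (_≤ ¼ * q) (sym (neg-distribˡ-* x q))
    (*-monoʳ-≤ q 0≤q (≤-trans (≤-trans (p≤∣p∣ (- x)) (≤-reflexive (∣-p∣≡∣p∣ x))) ∣x∣≤¼))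

  -- Proved together with monotonicity in `a`: by Pascal the increment is `Q (suc a) b − x * Q a b`,
  -- which is at least `¾ Q a b` once `Q a b` is known to be positive.
  ½≤Q : ∀ a b → ½ ≤ Q a b
  Q-monoˡ : ∀ a b → Q a b ≤ Q (suc a) b

  0≤Q : ∀ a b → 0ℚ ≤ Q a b
  0≤Q a b = ≤-trans (≤ᵇ⇒≤ _) (½≤Q a b)

  ½≤Q zero    b = ≤-trans (≤-by-difference (½ * X ^ℚ b) (0≤* (≤ᵇ⇒≤ {q = ½} _) (0≤^ℚ 0≤X b)) refl) (Z-lower b)
  ½≤Q (suc a) b = ≤-trans (½≤Q a b) (Q-monoˡ a b)

  Q-monoˡ a zero    = ≤-reflexive (Q-zeroʳ a)
  Q-monoˡ a (suc b) = ≤-by-difference _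
    (0≤+ (0≤+ (p≤q⇒0≤q-p (Q-monoˡ a b)) (p≤q⇒0≤q-p (xq≤¼q 0≤q))) (0≤* {1ℚ - ¼} (≤ᵇ⇒≤ _) 0≤q))
    (lemma (Q (suc a) b) (Q a (suc b)) (Q a b) x)
    where
    0≤q : 0ℚ ≤ Q a b
    0≤q = ≤-trans (≤ᵇ⇒≤ _) (½≤Q a b)
    lemma : ∀ q₁ q₂ q₀ x → q₁ + q₂ - x * q₀ ≡ q₂ + ((q₁ - q₀) + ((+ 1 / 4) * q₀ - x * q₀) + (1ℚ - (+ 1 / 4)) * q₀)
    lemma = solve-∀ ring

  0<Q : ∀ a b → 0ℚ < Q a b
  0<Q a b = <-≤-trans (*<* (ℤ.+<+ (ℕ.s≤s ℕ.z≤n))) (½≤Q a b)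

  Q-upper : ∀ a b → Q a b ≤ ⟦ 2 ⟧ * ⟦ 3 ⟧ ^ℚ (a ℕ.+ b)
  Q-upper zero b = begin
    Q 0 b               ≤⟨ Z-upper b ⟩
    ⟦ 2 ⟧ - X ^ℚ b      ≤⟨ ≤-by-difference (X ^ℚ b) (0≤^ℚ 0≤X b) (lemma (X ^ℚ b)) ⟩
    ⟦ 2 ⟧ * 1ℚ          ≤⟨ *-monoˡ-≤ ⟦ 2 ⟧ (0≤⟦⟧ 2) (1≤3^ b) ⟩
    ⟦ 2 ⟧ * ⟦ 3 ⟧ ^ℚ b  ∎
    where
    open ≤-Reasoning
    lemma : ∀ T → fromℤ (+ 2) * 1ℚ ≡ fromℤ (+ 2) - T + T
    lemma = solve-∀ ring
    1≤3^ : ∀ n → 1ℚ ≤ ⟦ 3 ⟧ ^ℚ n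
    1≤3^ zero    = ≤-refl
    1≤3^ (suc n) = ≤-trans (≤ᵇ⇒≤ _) (*-monoˡ-≤ ⟦ 3 ⟧ (0≤⟦⟧ 3) (1≤3^ n))
  Q-upper (suc a) zero = ≤-trans (≤-trans (≤-reflexive (sym (Q-zeroʳ a))) (Q-upper a zero))
    (*-monoˡ-≤ ⟦ 2 ⟧ (0≤⟦⟧ 2) (≤-by-difference {⟦ 3 ⟧ ^ℚ (a ℕ.+ 0)} _ (0≤* (0≤⟦⟧ 2) (0≤^ℚ (0≤⟦⟧ 3) (a ℕ.+ 0))) (lemma (⟦ 3 ⟧ ^ℚ (a ℕ.+ 0)))))
    where
    lemma : ∀ T → fromℤ (+ 3) * T ≡ T + fromℤ (+ 2) * T
    lemma = solve-∀ ring
  Q-upper (suc a) (suc b) = begin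
    Q (suc a) b + Q a (suc b) - x * Q a b
      ≤⟨ +-mono-≤ (+-mono-≤ (Q-upper (suc a) b) (Q-upper a (suc b))) (≤-trans (-xq≤¼q (0≤Q a b)) (*-monoˡ-≤ ¼ (≤ᵇ⇒≤ _) (Q-upper a b))) ⟩
    ⟦ 2 ⟧ * (⟦ 3 ⟧ * T) + ⟦ 2 ⟧ * ⟦ 3 ⟧ ^ℚ (a ℕ.+ suc b) + ¼ * (⟦ 2 ⟧ * T)
      ≡⟨ cong (λ n → ⟦ 2 ⟧ * (⟦ 3 ⟧ * T) + ⟦ 2 ⟧ * ⟦ 3 ⟧ ^ℚ n + ¼ * (⟦ 2 ⟧ * T)) (ℕₚ.+-suc a b) ⟩
    ⟦ 2 ⟧ * (⟦ 3 ⟧ * T) + ⟦ 2 ⟧ * (⟦ 3 ⟧ * T) + ¼ * (⟦ 2 ⟧ * T)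
      -- The base 3 suffices because 3 + 3 + 1/4 ≤ 9; twice the remaining 11/4 is the 11/2.
      ≤⟨ ≤-by-difference _ (0≤* {(+ 11 / 2)} (≤ᵇ⇒≤ _) (0≤^ℚ (0≤⟦⟧ 3) (a ℕ.+ b))) (lemma T) ⟩
    ⟦ 2 ⟧ * (⟦ 3 ⟧ * (⟦ 3 ⟧ * T))
      ≡⟨ cong (λ n → ⟦ 2 ⟧ * (⟦ 3 ⟧ * ⟦ 3 ⟧ ^ℚ n)) (ℕₚ.+-suc a b) ⟨
    ⟦ 2 ⟧ * (⟦ 3 ⟧ * ⟦ 3 ⟧ ^ℚ (a ℕ.+ suc b)) ∎
    where
    open ≤-Reasoning
    T = ⟦ 3 ⟧ ^ℚ (a ℕ.+ b)
    lemma : ∀ T → fromℤ (+ 2) * (fromℤ (+ 3) * (fromℤ (+ 3) * T))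
      ≡ fromℤ (+ 2) * (fromℤ (+ 3) * T) + fromℤ (+ 2) * (fromℤ (+ 3) * T) + (+ 1 / 4) * (fromℤ (+ 2) * T) + (+ 11 / 2) * T
    lemma = solve-∀ ring

-- Distance of the Padé approximants from √(1 - x)

module Approximation (s : ℚ) (∣x∣≤¼ : ∣ PadéTable.x s ∣ ≤ ¼) where

  open PadéTable s
  open Estimates s ∣x∣≤¼

  ∣D∣≤tight : ∀ a b → ∣ D a b ∣ ≤ X ^ℚ suc a * t ^ℚ b
  ∣D∣≤tight a zero = begin
    ∣ P (suc a) 0 * Q a 0 - P a 0 * Q (suc a) 0 ∣   ≡⟨ cong (λ q → ∣ P (suc a) 0 * q - P a 0 * 1ℚ ∣) (Q-zeroʳ a) ⟩
    ∣ P (suc a) 0 * 1ℚ - P a 0 * 1ℚ ∣               ≡⟨ cong ∣_∣ (lemma (P a 0) (y (suc a) * s ^ℚ suc a)) ⟩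
    ∣ y (suc a) * s ^ℚ suc a ∣                      ≤⟨ ∣term∣≤ (y (suc a)) (suc a) (∣y∣≤4^ a) ⟩
    X ^ℚ suc a                                      ≡⟨ *-identityʳ (X ^ℚ suc a) ⟨
    X ^ℚ suc a * 1ℚ                                 ∎
    where
    open ≤-Reasoning
    lemma : ∀ p m → (p + m) * 1ℚ - p * 1ℚ ≡ m
    lemma = solve-∀ ring
  ∣D∣≤tight a (suc b) = *-cancelˡ-≤ (⟦ b ⟧ + 1ℚ) (0<⟦suc⟧ b) (begin
    (⟦ b ⟧ + 1ℚ) * ∣ D a (suc b) ∣         ≡⟨ scale (⟦ b ⟧ + 1ℚ) (D a (suc b)) (<⇒≤ (0<⟦suc⟧ b)) ⟨
    ∣ (⟦ b ⟧ + 1ℚ) * D a (suc b) ∣         ≡⟨ cong ∣_∣ (D-suc a b) ⟩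
    ∣ (⟦ b ⟧ + 1ℚ + ½) * x * D a b ∣       ≡⟨ ∣p*q∣≡∣p∣*∣q∣ ((⟦ b ⟧ + 1ℚ + ½) * x) (D a b) ⟩
    ∣ (⟦ b ⟧ + 1ℚ + ½) * x ∣ * ∣ D a b ∣   ≡⟨ cong (_* ∣ D a b ∣) (scale (⟦ b ⟧ + 1ℚ + ½) x (0≤+ (<⇒≤ (0<⟦suc⟧ b)) (≤ᵇ⇒≤ _))) ⟩
    (⟦ b ⟧ + 1ℚ + ½) * X * ∣ D a b ∣       ≤⟨ *-mono-≤ (0≤* (0≤+ (<⇒≤ (0<⟦suc⟧ b)) (≤ᵇ⇒≤ _)) 0≤X) (0≤∣p∣ (D a b))
                                               (*-monoʳ-≤ X 0≤X (≤-by-difference {⟦ b ⟧ + 1ℚ + ½} (⟦ b ⟧ + ½) (0≤+ (0≤⟦⟧ b) (≤ᵇ⇒≤ _)) (lemma ⟦ b ⟧))) (∣D∣≤tight a b) ⟩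
    (⟦ b ⟧ + 1ℚ) * ⟦ 2 ⟧ * X * (X ^ℚ suc a * t ^ℚ b)   ≡⟨ lemma′ (⟦ b ⟧ + 1ℚ) X (X ^ℚ suc a) (t ^ℚ b) ⟩
    (⟦ b ⟧ + 1ℚ) * (X ^ℚ suc a * (t * t ^ℚ b)) ∎)
    where
    open ≤-Reasoning
    scale : ∀ p q → 0ℚ ≤ p → ∣ p * q ∣ ≡ p * ∣ q ∣
    scale p q 0≤p = trans (∣p*q∣≡∣p∣*∣q∣ p q) (cong (_* ∣ q ∣) (0≤p⇒∣p∣≡p 0≤p))
    lemma : ∀ b → (b + 1ℚ) * fromℤ (+ 2) ≡ b + 1ℚ + ½ + (b + ½)
    lemma = solve-∀ ring
    lemma′ : ∀ n X p q → n * fromℤ (+ 2) * X * (p * q) ≡ n * (p * (fromℤ (+ 2) * X * q))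
    lemma′ = solve-∀ ring

  ∣D∣≤ : ∀ a b → ∣ D a b ∣ ≤ X * t ^ℚ (a ℕ.+ b)
  ∣D∣≤ a b = begin
    ∣ D a b ∣                    ≤⟨ ∣D∣≤tight a b ⟩
    X * X ^ℚ a * t ^ℚ b          ≤⟨ *-monoʳ-≤ (t ^ℚ b) (0≤^ℚ 0≤t b) (*-monoˡ-≤ X 0≤X (^ℚ-monoˡ-≤ 0≤X X≤t a)) ⟩
    X * t ^ℚ a * t ^ℚ b          ≡⟨ *-assoc X (t ^ℚ a) (t ^ℚ b) ⟩
    X * (t ^ℚ a * t ^ℚ b)        ≡⟨ cong (X *_) (^ℚ-+ t a b) ⟨
    X * t ^ℚ (a ℕ.+ b)           ∎
    where open ≤-Reasoning

  ∣V∣≤ : ∀ a b → ∣ V a b ∣ ≤ X * t ^ℚ (a ℕ.+ b)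
  ∣V∣≤ a b = begin
    ∣ V a b ∣                              ≤⟨ ≤-by-difference (⟦ b ⟧ * ∣ V a b ∣) (0≤* (0≤⟦⟧ b) (0≤∣p∣ (V a b))) (lemma ⟦ b ⟧ ∣ V a b ∣) ⟩
    (⟦ b ⟧ + 1ℚ) * ∣ V a b ∣               ≡⟨ scale b (V a b) ⟨
    ∣ (⟦ b ⟧ + 1ℚ) * V a b ∣               ≡⟨ cong ∣_∣ (V-D a b) ⟩
    ∣ (⟦ a ⟧ + 1ℚ) * D a b ∣               ≡⟨ scale a (D a b) ⟩
    (⟦ a ⟧ + 1ℚ) * ∣ D a b ∣               ≤⟨ *-mono-≤ (<⇒≤ (0<⟦suc⟧ a)) (0≤∣p∣ (D a b)) (1+n≤2^n a) (∣D∣≤tight a b) ⟩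
    ⟦ 2 ⟧ ^ℚ a * (X * X ^ℚ a * t ^ℚ b)     ≡⟨ lemma′ (⟦ 2 ⟧ ^ℚ a) X (X ^ℚ a) (t ^ℚ b) ⟩
    X * (⟦ 2 ⟧ ^ℚ a * X ^ℚ a * t ^ℚ b)     ≡⟨ cong (λ p → X * (p * t ^ℚ b)) (^ℚ-distrib-* ⟦ 2 ⟧ X a) ⟨
    X * (t ^ℚ a * t ^ℚ b)                  ≡⟨ cong (X *_) (^ℚ-+ t a b) ⟨
    X * t ^ℚ (a ℕ.+ b)                     ∎
    where
    open ≤-Reasoning
    scale : ∀ n q → ∣ (⟦ n ⟧ + 1ℚ) * q ∣ ≡ (⟦ n ⟧ + 1ℚ) * ∣ q ∣
    scale n q = trans (∣p*q∣≡∣p∣*∣q∣ (⟦ n ⟧ + 1ℚ) q) (cong (_* ∣ q ∣) (0≤p⇒∣p∣≡p (<⇒≤ (0<⟦suc⟧ n))))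
    lemma : ∀ b v → (b + 1ℚ) * v ≡ v + b * v
    lemma = solve-∀ ring
    lemma′ : ∀ n X p q → n * (X * p * q) ≡ X * (n * p * q)
    lemma′ = solve-∀ ring

  u : ℕ → ℕ → ℚ
  u a b = P a b * recip (Q a b)

  u-difference : ∀ a b a′ b′ {δ} → ∣ P a b * Q a′ b′ - P a′ b′ * Q a b ∣ ≤ δ → ∣ u a b - u a′ b′ ∣ ≤ 4ℚ * δ
  u-difference a b a′ b′ {δ} det≤δ = begin
    ∣ p * r - p′ * r′ ∣                         ≡⟨ cong ∣_∣ (lemma p r p′ r′) ⟩
    ∣ p * 1ℚ * r - p′ * 1ℚ * r′ ∣               ≡⟨ cong₂ (λ m n → ∣ p * m * r - p′ * n * r′ ∣) (recip-inverseˡ (0<Q a′ b′)) (recip-inverseˡ (0<Q a b)) ⟨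
    ∣ p * (r′ * q′) * r - p′ * (r * q) * r′ ∣   ≡⟨ cong ∣_∣ (lemma′ p q r p′ q′ r′) ⟩
    ∣ r * r′ * (p * q′ - p′ * q) ∣              ≡⟨ ∣p*q∣≡∣p∣*∣q∣ (r * r′) (p * q′ - p′ * q) ⟩
    ∣ r * r′ ∣ * ∣ p * q′ - p′ * q ∣            ≡⟨ cong (_* ∣ p * q′ - p′ * q ∣) (0≤p⇒∣p∣≡p (0≤* (0≤r a b) (0≤r a′ b′))) ⟩
    r * r′ * ∣ p * q′ - p′ * q ∣                ≤⟨ *-mono-≤ (0≤* (0≤r a b) (0≤r a′ b′)) (0≤∣p∣ (p * q′ - p′ * q))
                                                     (*-mono-≤ (0≤r a b) (0≤r a′ b′) (r≤2 a b) (r≤2 a′ b′)) det≤δ ⟩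
    4ℚ * δ                                      ∎
    where
    open ≤-Reasoning
    p = P a b
    q = Q a b
    r = recip q
    p′ = P a′ b′
    q′ = Q a′ b′
    r′ = recip q′
    0≤r : ∀ a b → 0ℚ ≤ recip (Q a b)
    0≤r a b = <⇒≤ (0<recip (0<Q a b))
    r≤2 : ∀ a b → recip (Q a b) ≤ ⟦ 2 ⟧
    r≤2 a b = recip-≤ (0<Q a b) (*-monoˡ-≤ ⟦ 2 ⟧ (0≤⟦⟧ 2) (½≤Q a b))
    lemma : ∀ p r p′ r′ → p * r - p′ * r′ ≡ p * 1ℚ * r - p′ * 1ℚ * r′
    lemma = solve-∀ ring
    lemma′ : ∀ p q r p′ q′ r′ → p * (r′ * q′) * r - p′ * (r * q) * r′ ≡ r * r′ * (p * q′ - p′ * q)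
    lemma′ = solve-∀ ring

  δ : ℕ → ℚ
  δ n = X * t ^ℚ n

  0≤δ : ∀ n → 0ℚ ≤ δ n
  0≤δ n = 0≤* 0≤X (0≤^ℚ 0≤t n)

  4δ-+ : ∀ m n → 4ℚ * δ (m ℕ.+ n) ≡ 4ℚ * δ m * t ^ℚ n
  4δ-+ m n = trans (cong (λ p → 4ℚ * (X * p)) (^ℚ-+ t m n)) (lemma X (t ^ℚ m) (t ^ℚ n))
    where
    lemma : ∀ X p q → fromℤ (+ 4) * (X * (p * q)) ≡ fromℤ (+ 4) * (X * p) * q
    lemma = solve-∀ ring

  u-vertical : ∀ a b n → ∣ u a (n ℕ.+ b) - u a b ∣ ≤ ⟦ 8 ⟧ * δ (a ℕ.+ b)
  u-vertical a b n = ≤-trans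
    (geometric-path (λ n → u a (n ℕ.+ b)) (0≤* (0≤⟦⟧ 4) (0≤δ (a ℕ.+ b))) 0≤t t≤½ step n)
    (≤-reflexive (sym (*-assoc ⟦ 2 ⟧ 4ℚ (δ (a ℕ.+ b)))))
    where
    index : ∀ a b n → a ℕ.+ (n ℕ.+ b) ≡ a ℕ.+ b ℕ.+ n
    index = solveℕ-∀
    step : ∀ n → ∣ u a (suc n ℕ.+ b) - u a (n ℕ.+ b) ∣ ≤ 4ℚ * δ (a ℕ.+ b) * t ^ℚ n
    step n = ≤-trans (u-difference a (suc n ℕ.+ b) a (n ℕ.+ b) (∣V∣≤ a (n ℕ.+ b)))
      (≤-reflexive (trans (cong (λ k → 4ℚ * δ k) (index a b n)) (4δ-+ (a ℕ.+ b) n)))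

  u-horizontal : ∀ b n → ∣ u n b - u 0 b ∣ ≤ ⟦ 8 ⟧ * δ b
  u-horizontal b n = ≤-trans
    (geometric-path (λ n → u n b) (0≤* (0≤⟦⟧ 4) (0≤δ b)) 0≤t t≤½ step n)
    (≤-reflexive (sym (*-assoc ⟦ 2 ⟧ 4ℚ (δ b))))
    where
    step : ∀ n → ∣ u (suc n) b - u n b ∣ ≤ 4ℚ * δ b * t ^ℚ n
    step n = ≤-trans (u-difference (suc n) b n b (∣D∣≤ n b))
      (≤-reflexive (trans (cong (λ k → 4ℚ * δ k) (ℕₚ.+-comm n b)) (4δ-+ b n)))

  -- The path runs through `u a (a + b)`: all its entries have degree sum at least `a + b`, so each
  -- half is a geometric sum that starts no higher than order `δ (a + b)`.
  u-near-left : ∀ a b → ∣ u a b - u 0 (a ℕ.+ b) ∣ ≤ ⟦ 16 ⟧ * δ (a ℕ.+ b)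
  u-near-left a b = begin
    ∣ u a b - u 0 (a ℕ.+ b) ∣
      ≤⟨ ∣p-r∣≤∣p-q∣+∣q-r∣ (u a b) (u a (a ℕ.+ b)) (u 0 (a ℕ.+ b)) ⟩
    ∣ u a b - u a (a ℕ.+ b) ∣ + ∣ u a (a ℕ.+ b) - u 0 (a ℕ.+ b) ∣
      ≤⟨ +-mono-≤ (≤-trans (≤-reflexive (∣p-q∣≡∣q-p∣ (u a b) (u a (a ℕ.+ b)))) (u-vertical a b a)) (u-horizontal (a ℕ.+ b) a) ⟩
    ⟦ 8 ⟧ * δ (a ℕ.+ b) + ⟦ 8 ⟧ * δ (a ℕ.+ b)
      ≡⟨ *-distribʳ-+ (δ (a ℕ.+ b)) ⟦ 8 ⟧ ⟦ 8 ⟧ ⟨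
    ⟦ 16 ⟧ * δ (a ℕ.+ b) ∎
    where open ≤-Reasoning

  -- As `y` consists of the differences `c (suc k) − 4 c k`, multiplying the truncated series of
  -- 1/√(1 - x) by 1 - x reproduces that of √(1 - x) up to one tail term.
  PS-Z : ∀ n → P n 0 - (1ℚ - x) * Q 0 n ≡ x * (c n * s ^ℚ n)
  PS-Z zero    = lemma x
    where
    lemma : ∀ x → 1ℚ - (1ℚ - x) * 1ℚ ≡ x * (1ℚ * 1ℚ)
    lemma = solve-∀ ring
  PS-Z (suc n) = trans (lemma (P n 0) (Q 0 n) (c (suc n)) (c n) s (s ^ℚ n))
    (trans (cong (_+ (x * c (suc n) - 4ℚ * c n) * (s * s ^ℚ n)) (PS-Z n)) (lemma′ (c (suc n)) (c n) s (s ^ℚ n)))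
    where
    lemma : ∀ p q c′ c s T → (p + (c′ - fromℤ (+ 4) * c) * (s * T)) - (1ℚ - fromℤ (+ 4) * s) * (q + c′ * (s * T))
      ≡ p - (1ℚ - fromℤ (+ 4) * s) * q + (fromℤ (+ 4) * s * c′ - fromℤ (+ 4) * c) * (s * T)
    lemma = solve-∀ ring
    lemma′ : ∀ c′ c s T → fromℤ (+ 4) * s * (c * T) + (fromℤ (+ 4) * s * c′ - fromℤ (+ 4) * c) * (s * T) ≡ fromℤ (+ 4) * s * (c′ * (s * T))
    lemma′ = solve-∀ ring

  -- √(1 − x) is the geometric mean of the two numbers v n and v′ n.
  v v′ : ℕ → ℚ
  v n  = (1ℚ - x) * Q 0 n
  v′ n = recip (Q 0 n)

  v*v′ : ∀ n → v n * v′ n ≡ 1ℚ - x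
  v*v′ n = trans (*-assoc (1ℚ - x) (Q 0 n) (v′ n)) (trans (cong ((1ℚ - x) *_) (recip-inverseʳ (0<Q 0 n))) (*-identityʳ (1ℚ - x)))

  0≤v : ∀ n → 0ℚ ≤ v n
  0≤v n = 0≤* (p≤q⇒0≤q-p (≤-trans (≤-trans (p≤∣p∣ x) ∣x∣≤¼) (≤ᵇ⇒≤ {q = 1ℚ} _))) (0≤Q 0 n)

  0≤v′ : ∀ n → 0ℚ ≤ v′ n
  0≤v′ n = <⇒≤ (0<recip (0<Q 0 n))

  u-near-v′ : ∀ a b → ∣ u a b - v′ (a ℕ.+ b) ∣ ≤ ⟦ 33 ⟧ * δ (a ℕ.+ b)
  u-near-v′ a b = ≤-trans (≤-reflexive (cong (λ p → ∣ u a b - p ∣) (sym (*-identityˡ (v′ (a ℕ.+ b))))))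
    (≤-trans (u-near-left a b) (*-monoʳ-≤ (δ (a ℕ.+ b)) (0≤δ (a ℕ.+ b)) (≤ᵇ⇒≤ {⟦ 16 ⟧} {⟦ 33 ⟧} _)))

  -- The path leads over `u 0 S` and the Taylor polynomial `u S 0`; its three parts cost 16, 16 and
  -- 1.
  u-near-v : ∀ a b → ∣ u a b - v (a ℕ.+ b) ∣ ≤ ⟦ 33 ⟧ * δ (a ℕ.+ b)
  u-near-v a b = begin
    ∣ u a b - v S ∣
      ≤⟨ ∣p-r∣≤∣p-q∣+∣q-r∣ (u a b) (u 0 S) (v S) ⟩
    ∣ u a b - u 0 S ∣ + ∣ u 0 S - v S ∣
      ≤⟨ +-mono-≤ (u-near-left a b) (∣p-r∣≤∣p-q∣+∣q-r∣ (u 0 S) (u S 0) (v S)) ⟩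
    ⟦ 16 ⟧ * δ S + (∣ u 0 S - u S 0 ∣ + ∣ u S 0 - v S ∣)
      ≤⟨ +-monoʳ-≤ (⟦ 16 ⟧ * δ S) (+-mono-≤
           (≤-trans (≤-reflexive (∣p-q∣≡∣q-p∣ (u 0 S) (u S 0)))
             (subst (λ n → ∣ u S 0 - u 0 n ∣ ≤ ⟦ 16 ⟧ * δ n) (ℕₚ.+-identityʳ S) (u-near-left S 0)))
           last) ⟩
    ⟦ 16 ⟧ * δ S + (⟦ 16 ⟧ * δ S + δ S)
      ≡⟨ lemma (δ S) ⟩
    ⟦ 33 ⟧ * δ S ∎
    where
    open ≤-Reasoning
    S = a ℕ.+ b
    lemma : ∀ d → fromℤ (+ 16) * d + (fromℤ (+ 16) * d + d) ≡ fromℤ (+ 33) * d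
    lemma = solve-∀ ring
    u-bottom : ∀ n → u n 0 ≡ P n 0
    u-bottom n = trans (cong (λ q → P n 0 * recip q) (Q-zeroʳ n)) (*-identityʳ (P n 0))
    last : ∣ u S 0 - v S ∣ ≤ δ S
    last = begin
      ∣ u S 0 - v S ∣               ≡⟨ cong (λ p → ∣ p - v S ∣) (u-bottom S) ⟩
      ∣ P S 0 - v S ∣               ≡⟨ cong ∣_∣ (PS-Z S) ⟩
      ∣ x * (c S * s ^ℚ S) ∣        ≡⟨ ∣p*q∣≡∣p∣*∣q∣ x (c S * s ^ℚ S) ⟩
      X * ∣ c S * s ^ℚ S ∣          ≤⟨ *-monoˡ-≤ X 0≤X (≤-trans (∣c-term∣≤ S) (^ℚ-monoˡ-≤ 0≤X X≤t S)) ⟩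
      δ S                           ∎

  -- Both `v S` and `v′ S` are at most `w - r`, or both at least `w + r`. Multiplying the two
  -- inequalities compares a square with `v S * v′ S = 1 − x`.
  distance-from-table : ∀ a b {w L r} → L ≤ ∣ w - u a b ∣ → r + ⟦ 33 ⟧ * δ (a ℕ.+ b) ≤ L → DistFromSqrtGe (1ℚ - x) w r
  distance-from-table a b {w} {L} {r} L≤ r+ρ≤L with ≤-total (u a b) w
  ... | inj₁ u≤w = inj₂ (≤-trans (0≤v S) v≤ , subst (_≤ (w - r) * (w - r)) (v*v′ S) (*-mono-≤ (0≤v S) (0≤v′ S) v≤ v′≤))
    where
    S = a ℕ.+ b
    ρ = ⟦ 33 ⟧ * δ S
    lemma : ∀ w r u ρ → w - r ≡ u + ρ + (w - u - (r + ρ))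
    lemma = solve-∀ ring
    u+ρ≤ : u a b + ρ ≤ w - r
    u+ρ≤ = ≤-by-difference (w - u a b - (r + ρ))
      (p≤q⇒0≤q-p (≤-trans r+ρ≤L (≤-trans L≤ (≤-reflexive (0≤p⇒∣p∣≡p (p≤q⇒0≤q-p u≤w)))))) (lemma w r (u a b) ρ)
    v≤ : v S ≤ w - r
    v≤ = ≤-trans (q≤p+∣p-q∣ (u a b) (v S)) (≤-trans (+-monoʳ-≤ (u a b) (u-near-v a b)) u+ρ≤)
    v′≤ : v′ S ≤ w - r
    v′≤ = ≤-trans (q≤p+∣p-q∣ (u a b) (v′ S)) (≤-trans (+-monoʳ-≤ (u a b) (u-near-v′ a b)) u+ρ≤)
  ... | inj₂ w≤u with ≤-total (w + r) 0ℚ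
  ...   | inj₁ w+r≤0 = inj₁ (inj₁ w+r≤0)
  ...   | inj₂ 0≤w+r = inj₁ (inj₂ (subst ((w + r) * (w + r) ≤_) (v*v′ S) (*-mono-≤ 0≤w+r 0≤w+r ≤v ≤v′)))
    where
    S = a ℕ.+ b
    ρ = ⟦ 33 ⟧ * δ S
    lemma : ∀ w r u ρ → u - ρ ≡ w + r + (u - w - (r + ρ))
    lemma = solve-∀ ring
    ≤u-ρ : w + r ≤ u a b - ρ
    ≤u-ρ = ≤-by-difference (u a b - w - (r + ρ))
      (p≤q⇒0≤q-p (≤-trans r+ρ≤L (≤-trans L≤ (≤-reflexive (trans (∣p-q∣≡∣q-p∣ w (u a b)) (0≤p⇒∣p∣≡p (p≤q⇒0≤q-p w≤u))))))) (lemma w r (u a b) ρ)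
    ≤v : w + r ≤ v S
    ≤v = ≤-trans ≤u-ρ (≤-trans (+-monoʳ-≤ (u a b) (neg-antimono-≤ (u-near-v a b))) (p-∣p-q∣≤q (u a b) (v S)))
    ≤v′ : w + r ≤ v′ S
    ≤v′ = ≤-trans ≤u-ρ (≤-trans (+-monoʳ-≤ (u a b) (neg-antimono-≤ (u-near-v′ a b))) (p-∣p-q∣≤q (u a b) (v′ S)))

D-nonZero : ∀ s → s ≢ 0ℚ → ∀ a b → PadéTable.D s a b ≢ 0ℚ
D-nonZero s s≢0 a zero D≡0 = *-nonZero (y-nonZero a) (^ℚ-nonZero s≢0 (suc a)) (trans (sym D-bottom) D≡0)
  where
  open PadéTable s
  lemma : ∀ p m → (p + m) * 1ℚ - p * 1ℚ ≡ m
  lemma = solve-∀ ring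
  D-bottom : D a 0 ≡ y (suc a) * s ^ℚ suc a
  D-bottom = trans (cong (λ q → P (suc a) 0 * q - P a 0 * 1ℚ) (Q-zeroʳ a)) (lemma (P a 0) (y (suc a) * s ^ℚ suc a))
D-nonZero s s≢0 a (suc b) D≡0 =
  *-nonZero (*-nonZero (λ eq → <⇒≢ 0<b+3/2 (sym eq)) (*-nonZero {4ℚ} (λ ()) s≢0)) (D-nonZero s s≢0 a b)
    (trans (sym (D-suc a b)) (trans (cong ((⟦ b ⟧ + 1ℚ) *_) D≡0) (*-zeroʳ (⟦ b ⟧ + 1ℚ))))
  where
  open PadéTable s
  0<b+3/2 : 0ℚ < ⟦ b ⟧ + 1ℚ + ½
  0<b+3/2 = <-≤-trans (0<⟦suc⟧ b) (≤-by-difference ½ (≤ᵇ⇒≤ _) refl)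

-- Clearing denominators

module Integrality (s : ℚ) (h : ℕ) (1≤h : 1 ℕ.≤ h) (e : ℤ) (sH≡e : s * (4ℚ * ⟦ h ⟧) ≡ fromℤ e) where

  open PadéTable s

  H : ℚ
  H = 4ℚ * ⟦ h ⟧

  0<H : 0ℚ < H
  0<H = 0<* {4ℚ} (*<* (ℤ.+<+ (ℕ.s≤s ℕ.z≤n))) (0<⟦⟧ 1≤h)

  H-isInteger : IsInteger H
  H-isInteger = *-isInteger (⟦⟧-isInteger 4) (⟦⟧-isInteger h)

  xH-isInteger : IsInteger (x * H)
  xH-isInteger = subst IsInteger (sym (*-assoc 4ℚ s H))
    (*-isInteger (⟦⟧-isInteger 4) (subst IsInteger (sym sH≡e) (fromℤ-isInteger e)))

  term-isInteger : ∀ {q} k → IsInteger q → IsInteger (q * s ^ℚ k * H ^ℚ k)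
  term-isInteger {q} k q∈ℤ = subst IsInteger
    (trans (cong (λ p → q * p ^ℚ k) (sym sH≡e)) (trans (cong (q *_) (^ℚ-distrib-* s H k)) (sym (*-assoc q (s ^ℚ k) (H ^ℚ k)))))
    (*-isInteger q∈ℤ (^ℚ-isInteger (fromℤ-isInteger e) k))

  c-isInteger : ∀ k → IsInteger (c k)
  c-isInteger k = ⟦⟧-isInteger (central k)

  P-isInteger : ∀ a b → IsInteger (P a b * H ^ℚ a)
  P-isInteger zero b = fromℤ-isInteger (+ 1)
  P-isInteger (suc a) zero = subst IsInteger (lemma (P a 0) (y (suc a) * s ^ℚ suc a) H (H ^ℚ a))
    (+-isInteger (*-isInteger (P-isInteger a zero) H-isInteger)
      (term-isInteger (suc a) (minus-isInteger (c-isInteger (suc a)) (*-isInteger (⟦⟧-isInteger 4) (c-isInteger a)))))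
    where
    lemma : ∀ p m H T → p * T * H + m * (H * T) ≡ (p + m) * (H * T)
    lemma = solve-∀ ring
  P-isInteger (suc a) (suc b) = subst IsInteger (lemma (P (suc a) b) (P a (suc b)) (P a b) x H (H ^ℚ a))
    (minus-isInteger (+-isInteger (P-isInteger (suc a) b) (*-isInteger H-isInteger (P-isInteger a (suc b))))
      (*-isInteger xH-isInteger (P-isInteger a b)))
    where
    lemma : ∀ p₁ p₂ p₀ x H T → p₁ * (H * T) + H * (p₂ * T) - x * H * (p₀ * T) ≡ (p₁ + p₂ - x * p₀) * (H * T)
    lemma = solve-∀ ring

  Q-isInteger : ∀ a b → IsInteger (Q a b * H ^ℚ b)
  Q-isInteger zero    zero    = fromℤ-isInteger (+ 1)
  Q-isInteger (suc a) zero    = fromℤ-isInteger (+ 1)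
  Q-isInteger zero    (suc b) = subst IsInteger (lemma (Q 0 b) (c (suc b) * s ^ℚ suc b) H (H ^ℚ b))
    (+-isInteger (*-isInteger (Q-isInteger zero b) H-isInteger) (term-isInteger (suc b) (c-isInteger (suc b))))
    where
    lemma : ∀ p m H T → p * T * H + m * (H * T) ≡ (p + m) * (H * T)
    lemma = solve-∀ ring
  Q-isInteger (suc a) (suc b) = subst IsInteger (lemma (Q (suc a) b) (Q a (suc b)) (Q a b) x H (H ^ℚ b))
    (minus-isInteger (+-isInteger (*-isInteger H-isInteger (Q-isInteger (suc a) b)) (Q-isInteger a (suc b)))
      (*-isInteger xH-isInteger (Q-isInteger a b)))
    where
    lemma : ∀ p₁ p₂ p₀ x H T → H * (p₁ * T) + p₂ * (H * T) - x * H * (p₀ * T) ≡ (p₁ + p₂ - x * p₀) * (H * T)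
    lemma = solve-∀ ring

  -- `j` witnesses `a ≤ b + k`: the power of `H` that clears `w * Q a b` then clears `P a b` as
  -- well, and a nonzero integer has absolute value at least 1.
  1≤gap : ∀ a b j k {w} → a ℕ.+ j ≡ b ℕ.+ k → IsInteger (w * ⟦ h ⟧ ^ℚ k) → w * Q a b - P a b ≢ 0ℚ →
    1ℚ ≤ ∣ w * Q a b - P a b ∣ * H ^ℚ (b ℕ.+ k)
  1≤gap a b j k {w} a+j≡b+k w∈ℤ gap≢0 = begin
    1ℚ                                   ≤⟨ 1≤∣integer∣ gap∈ℤ (*-nonZero gap≢0 H^≢0) ⟩
    ∣ (w * Q a b - P a b) * H ^ℚ (b ℕ.+ k) ∣   ≡⟨ ∣p*q∣≡∣p∣*∣q∣ (w * Q a b - P a b) (H ^ℚ (b ℕ.+ k)) ⟩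
    ∣ w * Q a b - P a b ∣ * ∣ H ^ℚ (b ℕ.+ k) ∣ ≡⟨ cong (∣ w * Q a b - P a b ∣ *_) (0≤p⇒∣p∣≡p (0≤^ℚ (0≤* (0≤⟦⟧ 4) (0≤⟦⟧ h)) (b ℕ.+ k))) ⟩
    ∣ w * Q a b - P a b ∣ * H ^ℚ (b ℕ.+ k)     ∎
    where
    open ≤-Reasoning
    lemma : ∀ w q p T → (w * q - p) * T ≡ w * q * T - p * T
    lemma = solve-∀ ring
    lemma′ : ∀ w q B F K → w * q * (B * (F * K)) ≡ w * K * F * (q * B)
    lemma′ = solve-∀ ring
    Q-part : w * Q a b * H ^ℚ (b ℕ.+ k) ≡ w * ⟦ h ⟧ ^ℚ k * 4ℚ ^ℚ k * (Q a b * H ^ℚ b)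
    Q-part = trans (cong (w * Q a b *_) (trans (^ℚ-+ H b k) (cong (H ^ℚ b *_) (^ℚ-distrib-* 4ℚ ⟦ h ⟧ k))))
      (lemma′ w (Q a b) (H ^ℚ b) (4ℚ ^ℚ k) (⟦ h ⟧ ^ℚ k))
    P-part : P a b * H ^ℚ (b ℕ.+ k) ≡ P a b * H ^ℚ a * H ^ℚ j
    P-part = trans (cong (λ n → P a b * H ^ℚ n) (sym a+j≡b+k)) (trans (cong (P a b *_) (^ℚ-+ H a j)) (sym (*-assoc (P a b) (H ^ℚ a) (H ^ℚ j))))
    gap∈ℤ : IsInteger ((w * Q a b - P a b) * H ^ℚ (b ℕ.+ k))
    gap∈ℤ = subst IsInteger
      (sym (trans (lemma w (Q a b) (P a b) (H ^ℚ (b ℕ.+ k))) (cong₂ _-_ Q-part P-part)))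
      (minus-isInteger
        (*-isInteger (*-isInteger w∈ℤ (^ℚ-isInteger (⟦⟧-isInteger 4) k)) (Q-isInteger a b))
        (*-isInteger (P-isInteger a b) (^ℚ-isInteger H-isInteger j)))
    H^≢0 : H ^ℚ (b ℕ.+ k) ≢ 0ℚ
    H^≢0 eq = <⇒≢ (0<^ℚ 0<H (b ℕ.+ k)) (sym eq)

-- Choice of the degrees and the lower bound for √(1 - x)

^ℚ-suc-≤ : ∀ {q} → 1ℚ ≤ q → ∀ n → q ^ℚ n ≤ q ^ℚ suc n
^ℚ-suc-≤ {q} 1≤q n = ≤-trans (≤-reflexive (sym (*-identityˡ (q ^ℚ n)))) (*-monoʳ-≤ (q ^ℚ n) (0≤^ℚ (≤-trans (≤ᵇ⇒≤ _) 1≤q) n) 1≤q)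

^ℚ-monoʳ-≤ : ∀ {q m n} → 1ℚ ≤ q → m ℕ.≤ n → q ^ℚ m ≤ q ^ℚ n
^ℚ-monoʳ-≤ {q} {n = zero}  1≤q ℕ.z≤n = ≤-refl
^ℚ-monoʳ-≤ {q} {n = suc n} 1≤q ℕ.z≤n = ≤-trans (^ℚ-monoʳ-≤ {q} {0} {n} 1≤q ℕ.z≤n) (^ℚ-suc-≤ 1≤q n)
^ℚ-monoʳ-≤ {q} 1≤q (ℕ.s≤s m≤n) = *-monoˡ-≤ q (≤-trans (≤ᵇ⇒≤ _) 1≤q) (^ℚ-monoʳ-≤ 1≤q m≤n)

-- The degree b of the denominators is chosen so that h^b makes up for the constants to the power 2b + k.
balanced-degree : ∀ C h → 1 ℕ.≤ C → C ^ 4 ℕ.≤ h → ∀ k →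
  Σ ℕ λ b → b ℕ.≤ suc k × C ^ (2 ℕ.+ (b ℕ.+ (b ℕ.+ k))) ℕ.≤ h ^ b × h ^ b ℕ.≤ h ℕ.* C ^ (2 ℕ.+ (b ℕ.+ (b ℕ.+ k)))
-- With `b = 1` and `k = 0` the exponent is 4, whence the hypothesis `C ^ 4 ≤ h`.
balanced-degree C h 1≤C C⁴≤h zero = 1 , ℕₚ.≤-refl ,
  ℕₚ.≤-trans C⁴≤h (ℕₚ.≤-reflexive (sym (ℕₚ.*-identityʳ h))) ,
  ℕₚ.*-monoʳ-≤ h (ℕₚ.m^n>0 C 4)
  where instance _ = ℕ.>-nonZero 1≤C
balanced-degree C h 1≤C C⁴≤h (suc k) with balanced-degree C h 1≤C C⁴≤h k
... | b , b≤ , lower , upper with C ^ (2 ℕ.+ (b ℕ.+ (b ℕ.+ suc k))) ℕₚ.≤? h ^ b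
...   | yes lower′ = b , ℕₚ.m≤n⇒m≤1+n b≤ , lower′ ,
  ℕₚ.≤-trans upper (ℕₚ.*-monoʳ-≤ h (ℕₚ.^-monoʳ-≤ C (ℕₚ.+-monoʳ-≤ 2 (ℕₚ.+-monoʳ-≤ b (ℕₚ.+-monoʳ-≤ b (ℕₚ.n≤1+n k))))))
  where instance _ = ℕ.>-nonZero 1≤C
-- Raising `k` and `b` together multiplies the left side by `C ^ 3` and the right side by `h`. The
-- failure of the lower bound at the old `b` is itself the new upper bound.
...   | no  not-lower = suc b , ℕ.s≤s b≤ ,
  (begin
    C ^ (2 ℕ.+ (suc b ℕ.+ (suc b ℕ.+ suc k)))        ≡⟨ cong (C ^_) (exponent b k) ⟩
    C ^ (3 ℕ.+ (2 ℕ.+ (b ℕ.+ (b ℕ.+ k))))            ≡⟨ ℕₚ.^-distribˡ-+-* C 3 (2 ℕ.+ (b ℕ.+ (b ℕ.+ k))) ⟩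
    C ^ 3 ℕ.* C ^ (2 ℕ.+ (b ℕ.+ (b ℕ.+ k)))          ≤⟨ ℕₚ.*-mono-≤ (ℕₚ.≤-trans (ℕₚ.^-monoʳ-≤ C (ℕₚ.n≤1+n 3)) C⁴≤h) lower ⟩
    h ^ suc b                                        ∎) ,
  ℕₚ.*-monoʳ-≤ h (begin
    h ^ b                                            ≤⟨ ℕₚ.<⇒≤ (ℕₚ.≰⇒> not-lower) ⟩
    C ^ (2 ℕ.+ (b ℕ.+ (b ℕ.+ suc k)))                ≤⟨ ℕₚ.^-monoʳ-≤ C (ℕₚ.+-monoʳ-≤ 2 (ℕₚ.+-mono-≤ (ℕₚ.n≤1+n b) (ℕₚ.+-monoˡ-≤ (suc k) (ℕₚ.n≤1+n b)))) ⟩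
    C ^ (2 ℕ.+ (suc b ℕ.+ (suc b ℕ.+ suc k)))        ∎)
  where
  open ℕₚ.≤-Reasoning
  instance _ = ℕ.>-nonZero 1≤C
  exponent : ∀ b k → 2 ℕ.+ (suc b ℕ.+ (suc b ℕ.+ suc k)) ≡ 3 ℕ.+ (2 ℕ.+ (b ℕ.+ (b ℕ.+ k)))
  exponent = solveℕ-∀

half-recip : ∀ {p M} → 0ℚ < M → p * (⟦ 2 ⟧ * M) ≤ 1ℚ → p ≤ ½ * recip M
half-recip {p} {M} 0<M p2M≤1 = *-cancelˡ-≤ (⟦ 2 ⟧ * M) (0<* (0<⟦suc⟧ 1) 0<M) (begin
  ⟦ 2 ⟧ * M * p                ≡⟨ *-comm (⟦ 2 ⟧ * M) p ⟩
  p * (⟦ 2 ⟧ * M)              ≤⟨ p2M≤1 ⟩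
  1ℚ                           ≡⟨ recip-inverseʳ 0<M ⟨
  M * recip M                  ≡⟨ lemma M (recip M) ⟩
  ⟦ 2 ⟧ * M * (½ * recip M)    ∎)
  where
  open ≤-Reasoning
  lemma : ∀ M r → M * r ≡ fromℤ (+ 2) * M * (½ * r)
  lemma = solve-∀ ring

-- In the radius `h` occurs to just one power more than in the denominator of `w`; all else is a
-- power of a constant free of `h`. The 24 is 2 · 3 · 4: the 2 from `t`, the 3 from `Q-upper`, the 4
-- from `H`.
core : ∀ (E h : ℕ) (e : ℤ) (s : ℚ) → 1 ℕ.≤ E → (24 ℕ.* E) ^ 4 ℕ.≤ h → s * (4ℚ * ⟦ h ⟧) ≡ fromℤ e → e ≢ ℤ.0ℤ → ℤ.∣ e ∣ ℕ.≤ E →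
  ∀ k {w} → IsInteger (w * ⟦ h ⟧ ^ℚ suc k) →
  DistFromSqrtGe (1ℚ - PadéTable.x s) w (recip (⟦ 24 ℕ.* E ⟧ ^ℚ (6 ℕ.* suc k ℕ.+ 8) * ⟦ h ⟧ ^ℚ suc (suc k)))
core E h e s 1≤E C⁴≤h sH≡e e≢0 ∣e∣≤E k {w} w∈ℤ with balanced-degree (24 ℕ.* E) h (ℕₚ.≤-trans 1≤E (ℕₚ.m≤n*m E 24)) C⁴≤h (suc k)
... | b , b≤ , lower , upper = conclusion
  where
  open PadéTable s
  1≤C : 1 ℕ.≤ 24 ℕ.* E
  1≤C = ℕₚ.≤-trans 1≤E (ℕₚ.m≤n*m E 24)
  instance
    C-nonZero : ℕ.NonZero (24 ℕ.* E)
    C-nonZero = ℕ.>-nonZero 1≤C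
  C≤h : 24 ℕ.* E ℕ.≤ h
  C≤h = ℕₚ.≤-trans (ℕₚ.m≤m*n (24 ℕ.* E) ((24 ℕ.* E) ^ 3) {{ℕₚ.m^n≢0 (24 ℕ.* E) 3}}) C⁴≤h
  1≤h : 1 ℕ.≤ h
  1≤h = ℕₚ.≤-trans 1≤C C≤h
  C η ε : ℚ
  C = ⟦ 24 ℕ.* E ⟧
  η = ⟦ h ⟧
  ε = ⟦ E ⟧
  C≡ : C ≡ ⟦ 24 ⟧ * ε
  C≡ = ⟦⟧-* 24 E
  0<η : 0ℚ < η
  0<η = 0<⟦⟧ 1≤h
  1≤Cℚ : 1ℚ ≤ C
  1≤Cℚ = ⟦⟧-mono-≤ {1} 1≤C
  0≤C : 0ℚ ≤ C
  0≤C = 0≤⟦⟧ (24 ℕ.* E)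
  n : ℕ
  n = b ℕ.+ (b ℕ.+ suc k)

  ∣x∣η≤ε : ∣ x ∣ * η ≤ ε
  ∣x∣η≤ε = begin
    ∣ x ∣ * η              ≡⟨ cong (∣ x ∣ *_) (0≤p⇒∣p∣≡p (0≤⟦⟧ h)) ⟨
    ∣ x ∣ * ∣ η ∣          ≡⟨ ∣p*q∣≡∣p∣*∣q∣ x η ⟨
    ∣ 4ℚ * s * η ∣         ≡⟨ cong ∣_∣ (trans (lemma s η) sH≡e) ⟩
    ∣ fromℤ e ∣            ≡⟨ ∣fromℤ∣ e ⟩
    ⟦ ℤ.∣ e ∣ ⟧            ≤⟨ ⟦⟧-mono-≤ ∣e∣≤E ⟩
    ε                      ∎
    where
    open ≤-Reasoning
    lemma : ∀ s η → fromℤ (+ 4) * s * η ≡ s * (fromℤ (+ 4) * η)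
    lemma = solve-∀ ring

  ∣x∣≤¼ : ∣ x ∣ ≤ ¼
  ∣x∣≤¼ = *-cancelˡ-≤ η 0<η (begin
    η * ∣ x ∣              ≡⟨ *-comm η ∣ x ∣ ⟩
    ∣ x ∣ * η              ≤⟨ ∣x∣η≤ε ⟩
    ε                      ≤⟨ ≤-by-difference (⟦ 5 ⟧ * ε) (0≤* (0≤⟦⟧ 5) (0≤⟦⟧ E)) (lemma ε) ⟩
    ⟦ 24 ⟧ * ε * ¼         ≡⟨ cong (_* ¼) C≡ ⟨
    C * ¼                  ≤⟨ *-monoʳ-≤ ¼ (≤ᵇ⇒≤ _) (⟦⟧-mono-≤ C≤h) ⟩
    η * ¼                  ∎)
    where
    open ≤-Reasoning
    lemma : ∀ ε → fromℤ (+ 24) * ε * (+ 1 / 4) ≡ ε + fromℤ (+ 5) * ε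
    lemma = solve-∀ ring

  open Estimates s ∣x∣≤¼
  open Approximation s ∣x∣≤¼
  open Integrality s h 1≤h e sH≡e

  tη≤2ε : t * η ≤ ⟦ 2 ⟧ * ε
  tη≤2ε = ≤-trans (≤-reflexive (*-assoc ⟦ 2 ⟧ X η)) (*-monoˡ-≤ ⟦ 2 ⟧ (0≤⟦⟧ 2) ∣x∣η≤ε)

  s≢0 : s ≢ 0ℚ
  s≢0 s≡0 = fromℤ-nonZero e≢0 (trans (sym sH≡e) (trans (cong (_* (4ℚ * η)) s≡0) (*-zeroˡ (4ℚ * η))))

  lowerℚ : C ^ℚ suc (suc n) ≤ η ^ℚ b
  lowerℚ = subst₂ _≤_ (⟦⟧-^ (24 ℕ.* E) (2 ℕ.+ n)) (⟦⟧-^ h b) (⟦⟧-mono-≤ lower)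
  upperℚ : η ^ℚ b ≤ η * C ^ℚ suc (suc n)
  upperℚ = subst₂ _≤_ (⟦⟧-^ h b) (trans (⟦⟧-* h ((24 ℕ.* E) ^ (2 ℕ.+ n))) (cong (η *_) (⟦⟧-^ (24 ℕ.* E) (2 ℕ.+ n)))) (⟦⟧-mono-≤ upper)

  -- `2 G`, below called `M`, bounds the cleared denominator `Q a b * H ^ℚ (b + suc k)` of an entry.
  G : ℚ
  G = ⟦ 3 ⟧ ^ℚ n * H ^ℚ (b ℕ.+ suc k)
  0<G : 0ℚ < G
  0<G = 0<* (0<^ℚ (0<⟦suc⟧ 2) n) (0<^ℚ 0<H (b ℕ.+ suc k))

  H^≤ : H ^ℚ (b ℕ.+ suc k) ≤ 4ℚ ^ℚ n * η ^ℚ (b ℕ.+ suc k)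
  H^≤ = ≤-trans (≤-reflexive (^ℚ-distrib-* 4ℚ η (b ℕ.+ suc k)))
    (*-monoʳ-≤ (η ^ℚ (b ℕ.+ suc k)) (0≤^ℚ (0≤⟦⟧ h) (b ℕ.+ suc k)) (^ℚ-monoʳ-≤ {4ℚ} (≤ᵇ⇒≤ _) (ℕₚ.m≤n+m (b ℕ.+ suc k) b)))

  66≤C² : ⟦ 66 ⟧ ≤ C * C
  66≤C² = ≤-trans (≤ᵇ⇒≤ _) (*-mono-≤ {⟦ 24 ⟧} {C} {⟦ 24 ⟧} (0≤⟦⟧ 24) (0≤⟦⟧ 24) 24≤C 24≤C)
    where
    24≤C : ⟦ 24 ⟧ ≤ C
    24≤C = ⟦⟧-mono-≤ {24} (ℕₚ.m≤m*n 24 E {{ℕ.>-nonZero 1≤E}})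

  constants : ⟦ 66 ⟧ * ((⟦ 2 ⟧ * ε) ^ℚ n * (⟦ 3 ⟧ ^ℚ n * 4ℚ ^ℚ n)) ≤ C ^ℚ suc (suc n)
  constants = begin
    ⟦ 66 ⟧ * ((⟦ 2 ⟧ * ε) ^ℚ n * (⟦ 3 ⟧ ^ℚ n * 4ℚ ^ℚ n))    ≡⟨ cong (λ p → ⟦ 66 ⟧ * ((⟦ 2 ⟧ * ε) ^ℚ n * p)) (^ℚ-distrib-* ⟦ 3 ⟧ 4ℚ n) ⟨
    ⟦ 66 ⟧ * ((⟦ 2 ⟧ * ε) ^ℚ n * (⟦ 3 ⟧ * 4ℚ) ^ℚ n)          ≡⟨ cong (⟦ 66 ⟧ *_) (^ℚ-distrib-* (⟦ 2 ⟧ * ε) (⟦ 3 ⟧ * 4ℚ) n) ⟨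
    ⟦ 66 ⟧ * (⟦ 2 ⟧ * ε * (⟦ 3 ⟧ * 4ℚ)) ^ℚ n                 ≡⟨ cong (λ p → ⟦ 66 ⟧ * p ^ℚ n) (trans (lemma ε) (sym C≡)) ⟩
    ⟦ 66 ⟧ * C ^ℚ n                                          ≤⟨ *-monoʳ-≤ (C ^ℚ n) (0≤^ℚ 0≤C n) 66≤C² ⟩
    C * C * C ^ℚ n                                           ≡⟨ *-assoc C C (C ^ℚ n) ⟩
    C ^ℚ suc (suc n)                                         ∎
    where
    open ≤-Reasoning
    lemma : ∀ ε → fromℤ (+ 2) * ε * (fromℤ (+ 3) * fromℤ (+ 4)) ≡ fromℤ (+ 24) * ε
    lemma = solve-∀ ring

  -- After multiplication by `η ^ℚ b` the powers of `η` number exactly `n` and pair with `t ^ℚ n`,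
  -- leaving only constants, which `lowerℚ` puts below `η ^ℚ b`.
  error-small : ⟦ 66 ⟧ * (t ^ℚ n * G) ≤ 1ℚ
  error-small = *-cancelˡ-≤ (η ^ℚ b) (0<^ℚ 0<η b) (begin
    η ^ℚ b * (⟦ 66 ⟧ * (t ^ℚ n * (⟦ 3 ⟧ ^ℚ n * H ^ℚ (b ℕ.+ suc k))))
      ≤⟨ *-monoˡ-≤ (η ^ℚ b) (0≤^ℚ (0≤⟦⟧ h) b) (*-monoˡ-≤ ⟦ 66 ⟧ (0≤⟦⟧ 66) (*-monoˡ-≤ (t ^ℚ n) (0≤^ℚ 0≤t n) (*-monoˡ-≤ (⟦ 3 ⟧ ^ℚ n) (0≤^ℚ (0≤⟦⟧ 3) n) H^≤))) ⟩
    η ^ℚ b * (⟦ 66 ⟧ * (t ^ℚ n * (⟦ 3 ⟧ ^ℚ n * (4ℚ ^ℚ n * η ^ℚ (b ℕ.+ suc k)))))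
      ≡⟨ lemma (η ^ℚ b) (t ^ℚ n) (⟦ 3 ⟧ ^ℚ n) (4ℚ ^ℚ n) (η ^ℚ (b ℕ.+ suc k)) ⟩
    ⟦ 66 ⟧ * (t ^ℚ n * (η ^ℚ b * η ^ℚ (b ℕ.+ suc k)) * (⟦ 3 ⟧ ^ℚ n * 4ℚ ^ℚ n))
      ≡⟨ cong (λ p → ⟦ 66 ⟧ * (p * (⟦ 3 ⟧ ^ℚ n * 4ℚ ^ℚ n))) (trans (cong (t ^ℚ n *_) (sym (^ℚ-+ η b (b ℕ.+ suc k)))) (sym (^ℚ-distrib-* t η n))) ⟩
    ⟦ 66 ⟧ * ((t * η) ^ℚ n * (⟦ 3 ⟧ ^ℚ n * 4ℚ ^ℚ n))
      ≤⟨ *-monoˡ-≤ ⟦ 66 ⟧ (0≤⟦⟧ 66) (*-monoʳ-≤ (⟦ 3 ⟧ ^ℚ n * 4ℚ ^ℚ n) (0≤* (0≤^ℚ (0≤⟦⟧ 3) n) (0≤^ℚ (0≤⟦⟧ 4) n))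
           (^ℚ-monoˡ-≤ (0≤* 0≤t (0≤⟦⟧ h)) tη≤2ε n)) ⟩
    ⟦ 66 ⟧ * ((⟦ 2 ⟧ * ε) ^ℚ n * (⟦ 3 ⟧ ^ℚ n * 4ℚ ^ℚ n))
      ≤⟨ constants ⟩
    C ^ℚ suc (suc n)
      ≤⟨ lowerℚ ⟩
    η ^ℚ b
      ≡⟨ *-identityʳ (η ^ℚ b) ⟨
    η ^ℚ b * 1ℚ ∎)
    where
    open ≤-Reasoning
    lemma : ∀ p t a c q → p * (fromℤ (+ 66) * (t * (a * (c * q)))) ≡ fromℤ (+ 66) * (t * (p * q) * (a * c))
    lemma = solve-∀ ring

  R : ℚ
  R = C ^ℚ (6 ℕ.* suc k ℕ.+ 8) * η ^ℚ suc (suc k)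
  0<C : 0ℚ < C
  0<C = 0<⟦⟧ 1≤C
  0<R : 0ℚ < R
  0<R = 0<* (0<^ℚ 0<C (6 ℕ.* suc k ℕ.+ 8)) (0<^ℚ 0<η (suc (suc k)))

  -- Here `upperℚ` trades `η ^ℚ b` for powers of `C` and one extra `η`; then `b ≤ k + 2` gives
  -- `2 (n + 2) ≤ 6 (k + 1) + 8`.
  4G≤R : 4ℚ * G ≤ R
  4G≤R = begin
    4ℚ * (⟦ 3 ⟧ ^ℚ n * H ^ℚ (b ℕ.+ suc k))
      ≤⟨ *-monoˡ-≤ 4ℚ (0≤⟦⟧ 4) (*-monoˡ-≤ (⟦ 3 ⟧ ^ℚ n) (0≤^ℚ (0≤⟦⟧ 3) n) H^≤) ⟩
    4ℚ * (⟦ 3 ⟧ ^ℚ n * (4ℚ ^ℚ n * η ^ℚ (b ℕ.+ suc k)))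
      ≡⟨ cong (λ p → 4ℚ * (⟦ 3 ⟧ ^ℚ n * (4ℚ ^ℚ n * p))) (^ℚ-+ η b (suc k)) ⟩
    4ℚ * (⟦ 3 ⟧ ^ℚ n * (4ℚ ^ℚ n * (η ^ℚ b * η ^ℚ suc k)))
      ≡⟨ lemma (⟦ 3 ⟧ ^ℚ n) (4ℚ ^ℚ n) (η ^ℚ b) (η ^ℚ suc k) ⟩
    4ℚ * (1ℚ * (⟦ 3 ⟧ ^ℚ n * 4ℚ ^ℚ n)) * (η ^ℚ b * η ^ℚ suc k)
      -- The factors 4 and 1 are enlarged to 66 and `(2 ε)^n` so that `constants` applies again.
      ≤⟨ *-mono-≤ (0≤* (0≤⟦⟧ 4) (0≤* {1ℚ} (≤ᵇ⇒≤ _) 0≤34)) (0≤* (0≤^ℚ (0≤⟦⟧ h) b) (0≤^ℚ (0≤⟦⟧ h) (suc k)))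
           (*-mono-≤ (0≤⟦⟧ 4) (0≤* {1ℚ} (≤ᵇ⇒≤ _) 0≤34) (≤ᵇ⇒≤ {4ℚ} {⟦ 66 ⟧} _) (*-monoʳ-≤ (⟦ 3 ⟧ ^ℚ n * 4ℚ ^ℚ n) 0≤34 (^ℚ-monoʳ-≤ {m = 0} {n = n} 1≤2ε ℕ.z≤n)))
           (*-monoʳ-≤ (η ^ℚ suc k) (0≤^ℚ (0≤⟦⟧ h) (suc k)) upperℚ) ⟩
    ⟦ 66 ⟧ * ((⟦ 2 ⟧ * ε) ^ℚ n * (⟦ 3 ⟧ ^ℚ n * 4ℚ ^ℚ n)) * (η * C ^ℚ suc (suc n) * η ^ℚ suc k)
      ≤⟨ *-monoʳ-≤ (η * C ^ℚ suc (suc n) * η ^ℚ suc k) (0≤* (0≤* (0≤⟦⟧ h) (0≤^ℚ 0≤C (suc (suc n)))) (0≤^ℚ (0≤⟦⟧ h) (suc k))) constants ⟩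
    C ^ℚ suc (suc n) * (η * C ^ℚ suc (suc n) * η ^ℚ suc k)
      ≡⟨ lemma′ (C ^ℚ suc (suc n)) η (η ^ℚ suc k) ⟩
    C ^ℚ suc (suc n) * C ^ℚ suc (suc n) * η ^ℚ suc (suc k)
      ≡⟨ cong (_* η ^ℚ suc (suc k)) (^ℚ-+ C (suc (suc n)) (suc (suc n))) ⟨
    C ^ℚ (suc (suc n) ℕ.+ suc (suc n)) * η ^ℚ suc (suc k)
      ≤⟨ *-monoʳ-≤ (η ^ℚ suc (suc k)) (0≤^ℚ (0≤⟦⟧ h) (suc (suc k))) (^ℚ-monoʳ-≤ 1≤Cℚ exponent) ⟩
    R ∎
    where
    open ≤-Reasoning
    0≤34 : 0ℚ ≤ ⟦ 3 ⟧ ^ℚ n * 4ℚ ^ℚ n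
    0≤34 = 0≤* (0≤^ℚ (0≤⟦⟧ 3) n) (0≤^ℚ (0≤⟦⟧ 4) n)
    1≤2ε : 1ℚ ≤ ⟦ 2 ⟧ * ε
    1≤2ε = *-mono-≤ {1ℚ} {⟦ 2 ⟧} {1ℚ} (≤ᵇ⇒≤ _) (≤ᵇ⇒≤ _) (≤ᵇ⇒≤ _) (⟦⟧-mono-≤ {1} 1≤E)
    lemma : ∀ a c p q → fromℤ (+ 4) * (a * (c * (p * q))) ≡ fromℤ (+ 4) * (1ℚ * (a * c)) * (p * q)
    lemma = solve-∀ ring
    lemma′ : ∀ c η p → c * (η * c * p) ≡ c * c * (η * p)
    lemma′ = solve-∀ ring
    rearrange : ∀ k → 2 ℕ.+ (suc (suc k) ℕ.+ (suc (suc k) ℕ.+ suc k)) ℕ.+ (2 ℕ.+ (suc (suc k) ℕ.+ (suc (suc k) ℕ.+ suc k))) ≡ 6 ℕ.* suc k ℕ.+ 8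
    rearrange = solveℕ-∀
    2n≤ : 2 ℕ.+ n ℕ.≤ 2 ℕ.+ (suc (suc k) ℕ.+ (suc (suc k) ℕ.+ suc k))
    2n≤ = ℕₚ.+-monoʳ-≤ 2 (ℕₚ.+-mono-≤ b≤ (ℕₚ.+-monoˡ-≤ (suc k) b≤))
    exponent : suc (suc n) ℕ.+ suc (suc n) ℕ.≤ 6 ℕ.* suc k ℕ.+ 8
    exponent = ℕₚ.≤-trans (ℕₚ.+-mono-≤ 2n≤ 2n≤) (ℕₚ.≤-reflexive (rearrange k))

  M : ℚ
  M = ⟦ 2 ⟧ * G
  0<M : 0ℚ < M
  0<M = 0<* (0<⟦suc⟧ 1) 0<G

  -- The entry is at least `recip M` away from `w`. One half of this pays for the radius, the other
  -- for the error `33 δ`; hence the 66 above.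
  from-entry : ∀ a j → a ℕ.+ j ≡ b ℕ.+ suc k → a ℕ.+ b ℕ.≤ n → ⟦ 2 ⟧ * δ (a ℕ.+ b) ≤ t ^ℚ n →
    w * Q a b - P a b ≢ 0ℚ → DistFromSqrtGe (1ℚ - x) w (recip R)
  from-entry a j a+j≡ a+b≤n 2δ≤ gap≢0 = distance-from-table a b {w} {recip M} {recip R} M≤ (begin
    recip R + ⟦ 33 ⟧ * δ (a ℕ.+ b)     ≤⟨ +-mono-≤ (half-recip {recip R} 0<M R-part) (half-recip {⟦ 33 ⟧ * δ (a ℕ.+ b)} 0<M δ-part) ⟩
    ½ * recip M + ½ * recip M          ≡⟨ lemma (recip M) ⟩
    recip M                            ∎)
    where
    open ≤-Reasoning
    lemma : ∀ r → ½ * r + ½ * r ≡ r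
    lemma = solve-∀ ring
    lemma₁ : ∀ r G → r * (fromℤ (+ 2) * (fromℤ (+ 2) * G)) ≡ r * (fromℤ (+ 4) * G)
    lemma₁ = solve-∀ ring
    lemma₂ : ∀ d G → fromℤ (+ 33) * d * (fromℤ (+ 2) * (fromℤ (+ 2) * G)) ≡ fromℤ (+ 66) * (fromℤ (+ 2) * d * G)
    lemma₂ = solve-∀ ring
    lemma₃ : ∀ w q p r → w * (r * q) - p * r ≡ (w * q - p) * r
    lemma₃ = solve-∀ ring
    R-part : recip R * (⟦ 2 ⟧ * M) ≤ 1ℚ
    R-part = begin
      recip R * (⟦ 2 ⟧ * M)     ≡⟨ lemma₁ (recip R) G ⟩
      recip R * (4ℚ * G)        ≤⟨ *-monoˡ-≤ (recip R) (<⇒≤ (0<recip 0<R)) 4G≤R ⟩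
      recip R * R               ≡⟨ recip-inverseˡ 0<R ⟩
      1ℚ                        ∎
    δ-part : ⟦ 33 ⟧ * δ (a ℕ.+ b) * (⟦ 2 ⟧ * M) ≤ 1ℚ
    δ-part = begin
      ⟦ 33 ⟧ * δ (a ℕ.+ b) * (⟦ 2 ⟧ * M)     ≡⟨ lemma₂ (δ (a ℕ.+ b)) G ⟩
      ⟦ 66 ⟧ * (⟦ 2 ⟧ * δ (a ℕ.+ b) * G)     ≤⟨ *-monoˡ-≤ ⟦ 66 ⟧ (0≤⟦⟧ 66) (*-monoʳ-≤ G (<⇒≤ 0<G) 2δ≤) ⟩
      ⟦ 66 ⟧ * (t ^ℚ n * G)                  ≤⟨ error-small ⟩
      1ℚ                                     ∎
    q r : ℚ
    q = Q a b
    r = recip q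
    gap : ℚ
    gap = w * q - P a b
    difference : w - u a b ≡ gap * r
    difference = trans (cong (λ p → p - P a b * r) (trans (sym (*-identityʳ w)) (cong (w *_) (sym (recip-inverseˡ (0<Q a b))))))
      (lemma₃ w q (P a b) r)
    lemma₄ : ∀ g r q T → g * r * (q * T) ≡ g * T * (r * q)
    lemma₄ = solve-∀ ring
    M≤ : recip M ≤ ∣ w - u a b ∣
    M≤ = recip-≤ 0<M (begin
      1ℚ                                                     ≤⟨ 1≤gap a b j (suc k) {w} a+j≡ w∈ℤ gap≢0 ⟩
      ∣ gap ∣ * H ^ℚ (b ℕ.+ suc k)                           ≡⟨ *-identityʳ _ ⟨
      ∣ gap ∣ * H ^ℚ (b ℕ.+ suc k) * 1ℚ                      ≡⟨ cong (∣ gap ∣ * H ^ℚ (b ℕ.+ suc k) *_) (recip-inverseˡ (0<Q a b)) ⟨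
      ∣ gap ∣ * H ^ℚ (b ℕ.+ suc k) * (r * q)                 ≡⟨ lemma₄ ∣ gap ∣ r q (H ^ℚ (b ℕ.+ suc k)) ⟨
      ∣ gap ∣ * r * (q * H ^ℚ (b ℕ.+ suc k))                 ≡⟨ cong (λ p → ∣ gap ∣ * p * (q * H ^ℚ (b ℕ.+ suc k))) (0≤p⇒∣p∣≡p (<⇒≤ (0<recip (0<Q a b)))) ⟨
      ∣ gap ∣ * ∣ r ∣ * (q * H ^ℚ (b ℕ.+ suc k))             ≡⟨ cong (_* (q * H ^ℚ (b ℕ.+ suc k))) (trans (sym (∣p*q∣≡∣p∣*∣q∣ gap r)) (cong ∣_∣ (sym difference))) ⟩
      ∣ w - u a b ∣ * (q * H ^ℚ (b ℕ.+ suc k))               ≤⟨ *-monoˡ-≤ ∣ w - u a b ∣ (0≤∣p∣ (w - u a b))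
                                                                  (*-monoʳ-≤ (H ^ℚ (b ℕ.+ suc k)) (0≤^ℚ (<⇒≤ 0<H) (b ℕ.+ suc k)) q≤) ⟩
      ∣ w - u a b ∣ * (⟦ 2 ⟧ * ⟦ 3 ⟧ ^ℚ n * H ^ℚ (b ℕ.+ suc k)) ≡⟨ cong (∣ w - u a b ∣ *_) (*-assoc ⟦ 2 ⟧ (⟦ 3 ⟧ ^ℚ n) (H ^ℚ (b ℕ.+ suc k))) ⟩
      ∣ w - u a b ∣ * M                                      ∎)
      where
      q≤ : q ≤ ⟦ 2 ⟧ * ⟦ 3 ⟧ ^ℚ n
      q≤ = ≤-trans (Q-upper a b) (*-monoˡ-≤ ⟦ 2 ⟧ (0≤⟦⟧ 2) (^ℚ-monoʳ-≤ {⟦ 3 ⟧} (≤ᵇ⇒≤ _) a+b≤n))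

  index : ∀ b k → suc (b ℕ.+ k ℕ.+ b) ≡ b ℕ.+ (b ℕ.+ suc k)
  index = solveℕ-∀
  index′ : ∀ b k → b ℕ.+ k ℕ.+ 1 ≡ b ℕ.+ suc k
  index′ = solveℕ-∀
  index″ : ∀ b k → suc (b ℕ.+ k) ℕ.+ 0 ≡ b ℕ.+ suc k
  index″ = solveℕ-∀
  -- The degree sum is only `n − 1`, but the factor `X`, half of `t`, in `δ` supplies the missing
  -- power.
  2δ≡ : ⟦ 2 ⟧ * δ (b ℕ.+ k ℕ.+ b) ≡ t ^ℚ n
  2δ≡ = trans (sym (*-assoc ⟦ 2 ⟧ X (t ^ℚ (b ℕ.+ k ℕ.+ b)))) (cong (t ^ℚ_) (index b k))
  δ-suc-≤ : ∀ m → δ (suc m) ≤ δ m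
  δ-suc-≤ m = *-monoˡ-≤ X 0≤X (≤-trans (*-monoʳ-≤ (t ^ℚ m) (0≤^ℚ 0≤t m) (≤-trans t≤½ (≤ᵇ⇒≤ {q = 1ℚ} _))) (≤-reflexive (*-identityˡ (t ^ℚ m))))

  conclusion : DistFromSqrtGe (1ℚ - x) w (recip R)
  conclusion with w * Q (b ℕ.+ k) b - P (b ℕ.+ k) b ≟ 0ℚ | w * Q (suc (b ℕ.+ k)) b - P (suc (b ℕ.+ k)) b ≟ 0ℚ
  ... | no gap≢0 | _ = from-entry (b ℕ.+ k) 1 (index′ b k) (ℕₚ.≤-trans (ℕₚ.n≤1+n _) (ℕₚ.≤-reflexive (index b k))) (≤-reflexive 2δ≡) gap≢0
  ... | yes _ | no gap≢0 = from-entry (suc (b ℕ.+ k)) 0 (index″ b k) (ℕₚ.≤-reflexive (index b k))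
    (≤-trans (*-monoˡ-≤ ⟦ 2 ⟧ (0≤⟦⟧ 2) (δ-suc-≤ (b ℕ.+ k ℕ.+ b))) (≤-reflexive 2δ≡)) gap≢0
  -- The determinant `D` is a linear combination of the two gaps.
  ... | yes gap≡0 | yes gap′≡0 = ⊥-elim (D-nonZero s s≢0 (b ℕ.+ k) b (trans (lemma w (Q (b ℕ.+ k) b) (P (b ℕ.+ k) b) (Q (suc (b ℕ.+ k)) b) (P (suc (b ℕ.+ k)) b))
    (trans (cong₂ (λ g g′ → g * Q (suc (b ℕ.+ k)) b - g′ * Q (b ℕ.+ k) b) gap≡0 gap′≡0) (zeros (Q (suc (b ℕ.+ k)) b) (Q (b ℕ.+ k) b)))))
    where
    lemma : ∀ w q p q′ p′ → p′ * q - p * q′ ≡ (w * q - p) * q′ - (w * q′ - p′) * q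
    lemma = solve-∀ ring
    zeros : ∀ q q′ → 0ℚ * q - 0ℚ * q′ ≡ 0ℚ
    zeros = solve-∀ ring

-- Values of the form B p² - A q² at the convergents

module ContinuedFraction (d : ℚ) (1≤A : 1 ℕ.≤ ℤ.∣ ↥ d ∣) (nonsquare : ∀ r → r ℕ.* r ≢ radicand d) where

  A B D s : ℕ
  A = ℤ.∣ ↥ d ∣
  B = ↧ₙ d
  D = radicand d
  s = isqrt D

  P Q Q′ a : ℕ → ℕ
  P k = proj₁ (completeQuotient d k)
  Q k = proj₂ (completeQuotient d k)
  -- The denominator with index -1, namely `D / B`, so that `Q * Q′ + P * P = D` holds from the
  -- start.
  Q′ zero    = A
  Q′ (suc k) = Q k
  a k = partialQuotient d k

  reduced : ∀ k → Reduced D s (P k) (Q k) (Q′ k)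
  reduced zero = record
    { 1≤Q = ℕ.s≤s ℕ.z≤n ; 1≤Q′ = 1≤A ; P≤s = ℕ.z≤n
    ; QQ′+P² = trans (ℕₚ.+-identityʳ (B ℕ.* A)) (ℕₚ.*-comm B A) ; P≤aQ = ℕ.z≤n }
  reduced (suc k) = Step.reduced⁺ D s (isqrt-correct D) nonsquare (reduced k)

  module S (k : ℕ) = Step D s (isqrt-correct D) nonsquare (reduced k)

  p q p′ q′ : ℕ → ℕ
  p k  = proj₁ (convergent d k)
  q k  = proj₂ (convergent d k)
  p′ k = proj₁ (proj₂ (proj₂ (convergentData d k)))
  q′ k = proj₂ (proj₂ (proj₂ (convergentData d k)))

  -- The polar form of `B m² − A n²`.
  form : ℕ → ℕ → ℕ → ℕ → ℤ
  form m n m′ n′ = + B ℤ.* (+ m ℤ.* + m′) ℤ.- + A ℤ.* (+ n ℤ.* + n′)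

  sign : ℕ → ℤ
  sign zero    = + 1
  sign (suc k) = ℤ.- sign k

  ∣sign∣ : ∀ k → ℤ.∣ sign k ∣ ≡ 1
  ∣sign∣ zero    = refl
  ∣sign∣ (suc k) = trans (ℤₚ.∣-i∣≡∣i∣ (sign k)) (∣sign∣ k)

  form-pp : ℕ → ℤ
  form-pp k = form (p k) (q k) (p k) (q k)

  +P⁺ : ∀ k → + P (suc k) ≡ + a k ℤ.* + Q k ℤ.- + P k
  +P⁺ k = trans (lemma (+ P (suc k)) (+ P k)) (cong (λ x → x ℤ.- + P k)
    (trans (sym (ℤₚ.pos-+ (P (suc k)) (P k))) (trans (cong +_ (S.P⁺+P k)) (ℤₚ.pos-* (a k) (Q k)))))
    where
    lemma : ∀ x y → x ≡ x ℤ.+ y ℤ.- y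
    lemma = solveℤ-∀

  +Q⁺ : ∀ k → + Q (suc k) ≡ + Q′ k ℤ.+ + P k ℤ.* + a k ℤ.- + P (suc k) ℤ.* + a k
  +Q⁺ k = trans (lemma (+ Q (suc k)) (+ P (suc k) ℤ.* + a k)) (cong (λ x → x ℤ.- + P (suc k) ℤ.* + a k) (begin
    + Q (suc k) ℤ.+ + P (suc k) ℤ.* + a k   ≡⟨ cong (λ x → + Q (suc k) ℤ.+ x) (ℤₚ.pos-* (P (suc k)) (a k)) ⟨
    + (Q (suc k) ℕ.+ P (suc k) ℕ.* a k)     ≡⟨ cong +_ (S.Q⁺+P⁺a k) ⟩
    + (Q′ k ℕ.+ P k ℕ.* a k)                ≡⟨ cong (λ x → + Q′ k ℤ.+ x) (ℤₚ.pos-* (P k) (a k)) ⟩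
    + Q′ k ℤ.+ + P k ℤ.* + a k              ∎))
    where
    open ≡-Reasoning
    lemma : ∀ x y → x ≡ x ℤ.+ y ℤ.- y
    lemma = solveℤ-∀

  -- Substituting `a p + p′` and `a q + q′` into the quadratic form produces all three values, so
  -- they have to be carried along together.
  record Norms (k : ℕ) : Set where
    field
      previous : form (p′ k) (q′ k) (p′ k) (q′ k) ≡ sign k ℤ.* + Q k
      mixed    : form (p k) (q k) (p′ k) (q′ k) ≡ sign k ℤ.* + P (suc k)
      current  : form-pp k ≡ ℤ.- sign k ℤ.* + Q (suc k)

  +step : ∀ a m m′ → + (a ℕ.* m ℕ.+ m′) ≡ + a ℤ.* + m ℤ.+ + m′
  +step a m m′ = cong (λ x → x ℤ.+ + m′) (ℤₚ.pos-* a m)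

  norms : ∀ k → Norms k
  norms zero = record
    { previous = lemma₁ (+ A) (+ B)
    ; mixed    = trans (lemma₂ (+ a 0) (+ A) (+ B)) (cong (λ x → + 1 ℤ.* x) (sym (+P⁺ 0)))
    ; current  = trans (lemma₃ (+ a 0) (+ A) (+ B)) (cong (λ x → ℤ.- + 1 ℤ.* x) (sym (trans (+Q⁺ 0) (cong (λ x → + A ℤ.+ + 0 ℤ.* + a 0 ℤ.- x ℤ.* + a 0) (+P⁺ 0)))))
    }
    where
    lemma₁ : ∀ A B → B ℤ.* (+ 1 ℤ.* + 1) ℤ.- A ℤ.* (+ 0 ℤ.* + 0) ≡ + 1 ℤ.* B
    lemma₁ = solveℤ-∀
    lemma₂ : ∀ a A B → B ℤ.* (a ℤ.* + 1) ℤ.- A ℤ.* (+ 1 ℤ.* + 0) ≡ + 1 ℤ.* (a ℤ.* B ℤ.- + 0)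
    lemma₂ = solveℤ-∀
    lemma₃ : ∀ a A B → B ℤ.* (a ℤ.* a) ℤ.- A ℤ.* (+ 1 ℤ.* + 1) ≡ ℤ.- + 1 ℤ.* (A ℤ.+ + 0 ℤ.* a ℤ.- (a ℤ.* B ℤ.- + 0) ℤ.* a)
    lemma₃ = solveℤ-∀
  norms (suc k) = record
    { previous = current
    ; mixed    = mixed⁺
    ; current  = current⁺
    }
    where
    open Norms (norms k)
    open ≡-Reasoning
    α : ℤ
    α = + a (suc k)
    lemma₁ : ∀ A B α p p′ q q′ → B ℤ.* ((α ℤ.* p ℤ.+ p′) ℤ.* p) ℤ.- A ℤ.* ((α ℤ.* q ℤ.+ q′) ℤ.* q)
      ≡ α ℤ.* (B ℤ.* (p ℤ.* p) ℤ.- A ℤ.* (q ℤ.* q)) ℤ.+ (B ℤ.* (p ℤ.* p′) ℤ.- A ℤ.* (q ℤ.* q′))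
    lemma₁ = solveℤ-∀
    lemma₂ : ∀ σ α Q P → α ℤ.* (ℤ.- σ ℤ.* Q) ℤ.+ σ ℤ.* P ≡ ℤ.- σ ℤ.* (α ℤ.* Q ℤ.- P)
    lemma₂ = solveℤ-∀
    mixed⁺ : form (p (suc k)) (q (suc k)) (p k) (q k) ≡ ℤ.- sign k ℤ.* + P (suc (suc k))
    mixed⁺ = begin
      form (p (suc k)) (q (suc k)) (p k) (q k)
        ≡⟨ cong₂ (λ x y → + B ℤ.* (x ℤ.* + p k) ℤ.- + A ℤ.* (y ℤ.* + q k)) (+step (a (suc k)) (p k) (p′ k)) (+step (a (suc k)) (q k) (q′ k)) ⟩
      + B ℤ.* ((α ℤ.* + p k ℤ.+ + p′ k) ℤ.* + p k) ℤ.- + A ℤ.* ((α ℤ.* + q k ℤ.+ + q′ k) ℤ.* + q k)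
        ≡⟨ lemma₁ (+ A) (+ B) α (+ p k) (+ p′ k) (+ q k) (+ q′ k) ⟩
      α ℤ.* form-pp k ℤ.+ form (p k) (q k) (p′ k) (q′ k)
        ≡⟨ cong₂ (λ x y → α ℤ.* x ℤ.+ y) current mixed ⟩
      α ℤ.* (ℤ.- sign k ℤ.* + Q (suc k)) ℤ.+ sign k ℤ.* + P (suc k)
        ≡⟨ lemma₂ (sign k) α (+ Q (suc k)) (+ P (suc k)) ⟩
      ℤ.- sign k ℤ.* (α ℤ.* + Q (suc k) ℤ.- + P (suc k))
        ≡⟨ cong (λ x → ℤ.- sign k ℤ.* x) (+P⁺ (suc k)) ⟨
      ℤ.- sign k ℤ.* + P (suc (suc k)) ∎
    lemma₃ : ∀ A B α p p′ q q′ → B ℤ.* ((α ℤ.* p ℤ.+ p′) ℤ.* (α ℤ.* p ℤ.+ p′)) ℤ.- A ℤ.* ((α ℤ.* q ℤ.+ q′) ℤ.* (α ℤ.* q ℤ.+ q′))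
      ≡ α ℤ.* α ℤ.* (B ℤ.* (p ℤ.* p) ℤ.- A ℤ.* (q ℤ.* q)) ℤ.+ + 2 ℤ.* α ℤ.* (B ℤ.* (p ℤ.* p′) ℤ.- A ℤ.* (q ℤ.* q′))
        ℤ.+ (B ℤ.* (p′ ℤ.* p′) ℤ.- A ℤ.* (q′ ℤ.* q′))
    lemma₃ = solveℤ-∀
    lemma₄ : ∀ σ α Q P Q′ → α ℤ.* α ℤ.* (ℤ.- σ ℤ.* Q) ℤ.+ + 2 ℤ.* α ℤ.* (σ ℤ.* P) ℤ.+ σ ℤ.* Q′
      ≡ ℤ.- (ℤ.- σ) ℤ.* (Q′ ℤ.+ P ℤ.* α ℤ.- (α ℤ.* Q ℤ.- P) ℤ.* α)
    lemma₄ = solveℤ-∀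
    current⁺ : form-pp (suc k) ≡ ℤ.- (ℤ.- sign k) ℤ.* + Q (suc (suc k))
    current⁺ = begin
      form-pp (suc k)
        ≡⟨ cong₂ (λ x y → + B ℤ.* (x ℤ.* x) ℤ.- + A ℤ.* (y ℤ.* y)) (+step (a (suc k)) (p k) (p′ k)) (+step (a (suc k)) (q k) (q′ k)) ⟩
      + B ℤ.* ((α ℤ.* + p k ℤ.+ + p′ k) ℤ.* (α ℤ.* + p k ℤ.+ + p′ k)) ℤ.- + A ℤ.* ((α ℤ.* + q k ℤ.+ + q′ k) ℤ.* (α ℤ.* + q k ℤ.+ + q′ k))
        ≡⟨ lemma₃ (+ A) (+ B) α (+ p k) (+ p′ k) (+ q k) (+ q′ k) ⟩
      α ℤ.* α ℤ.* form-pp k ℤ.+ + 2 ℤ.* α ℤ.* form (p k) (q k) (p′ k) (q′ k) ℤ.+ form (p′ k) (q′ k) (p′ k) (q′ k)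
        ≡⟨ cong₂ ℤ._+_ (cong₂ (λ x y → α ℤ.* α ℤ.* x ℤ.+ + 2 ℤ.* α ℤ.* y) current mixed) previous ⟩
      α ℤ.* α ℤ.* (ℤ.- sign k ℤ.* + Q (suc k)) ℤ.+ + 2 ℤ.* α ℤ.* (sign k ℤ.* + P (suc k)) ℤ.+ sign k ℤ.* + Q k
        ≡⟨ lemma₄ (sign k) α (+ Q (suc k)) (+ P (suc k)) (+ Q k) ⟩
      ℤ.- (ℤ.- sign k) ℤ.* (+ Q k ℤ.+ + P (suc k) ℤ.* α ℤ.- (α ℤ.* + Q (suc k) ℤ.- + P (suc k)) ℤ.* α)
        ≡⟨ cong (λ x → ℤ.- (ℤ.- sign k) ℤ.* (+ Q k ℤ.+ + P (suc k) ℤ.* α ℤ.- x ℤ.* α)) (+P⁺ (suc k)) ⟨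
      ℤ.- (ℤ.- sign k) ℤ.* (+ Q k ℤ.+ + P (suc k) ℤ.* α ℤ.- + P (suc (suc k)) ℤ.* α)
        ≡⟨ cong (λ x → ℤ.- (ℤ.- sign k) ℤ.* x) (+Q⁺ (suc k)) ⟨
      ℤ.- (ℤ.- sign k) ℤ.* + Q (suc (suc k)) ∎

  ∣form-pp∣ : ∀ k → ℤ.∣ form-pp k ∣ ≡ Q (suc k)
  ∣form-pp∣ k = begin
    ℤ.∣ form-pp k ∣                       ≡⟨ cong ℤ.∣_∣ (Norms.current (norms k)) ⟩
    ℤ.∣ sign (suc k) ℤ.* + Q (suc k) ∣    ≡⟨ ℤₚ.abs-* (sign (suc k)) (+ Q (suc k)) ⟩
    ℤ.∣ sign (suc k) ∣ ℕ.* Q (suc k)      ≡⟨ cong (ℕ._* Q (suc k)) (∣sign∣ (suc k)) ⟩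
    1 ℕ.* Q (suc k)                       ≡⟨ ℕₚ.*-identityˡ (Q (suc k)) ⟩
    Q (suc k)                             ∎
    where open ≡-Reasoning

  ∣form-pp∣≤D : ∀ k → ℤ.∣ form-pp k ∣ ℕ.≤ D
  ∣form-pp∣≤D k = begin
    ℤ.∣ form-pp k ∣                                          ≡⟨ ∣form-pp∣ k ⟩
    Q (suc k)                                                ≤⟨ ℕₚ.m≤m*n (Q (suc k)) (Q k) {{ℕ.>-nonZero 1≤Q′}} ⟩
    Q (suc k) ℕ.* Q k                                        ≤⟨ ℕₚ.m≤m+n _ (P (suc k) ℕ.* P (suc k)) ⟩
    Q (suc k) ℕ.* Q k ℕ.+ P (suc k) ℕ.* P (suc k)            ≡⟨ QQ′+P² ⟩
    D                                                        ∎
    where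
    open ℕₚ.≤-Reasoning
    open Reduced (reduced (suc k))

  form-pp≢0 : ∀ k → form-pp k ≢ ℤ.0ℤ
  form-pp≢0 k eq = ℕₚ.<⇒≢ (Reduced.1≤Q (reduced (suc k))) (trans (sym (cong ℤ.∣_∣ eq)) (∣form-pp∣ k))

-- From √(1 - e/h) to √d and from powers of h to powers of γ

/-*-cancel : ∀ n k → (n / suc k) * ⟦ suc k ⟧ ≡ fromℤ n
/-*-cancel n k = trans (cong ((n / suc k) *_) (⟦⟧≡fromℤ (suc k))) (toℚᵘ-injective (begin-equality
  toℚᵘ ((n / suc k) * fromℤ (+ suc k))          ≃⟨ toℚᵘ-homo-* (n / suc k) (fromℤ (+ suc k)) ⟩
  toℚᵘ (n / suc k) ℚᵘ.* ℚᵘ.mkℚᵘ (+ suc k) 0        ≃⟨ ℚᵘₚ.*-congʳ {ℚᵘ.mkℚᵘ (+ suc k) 0} (toℚᵘ-fromℚᵘ (ℚᵘ.mkℚᵘ n k)) ⟩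
  ℚᵘ.mkℚᵘ n k ℚᵘ.* ℚᵘ.mkℚᵘ (+ suc k) 0                ≃⟨ ℚᵘ.*≡* (trans (ℤₚ.*-identityʳ (n ℤ.* + suc k)) (cong (λ m → n ℤ.* + m) (sym (ℕₚ.*-identityʳ (suc k))))) ⟩
  ℚᵘ.mkℚᵘ n 0                                      ∎))
  where open ℚᵘₚ.≤-Reasoning

frac-* : ∀ n {k} → 1 ℕ.≤ k → frac n k * ⟦ k ⟧ ≡ fromℤ n
frac-* n {suc k} _ = /-*-cancel n k

distance-scale : ∀ {d w r} μ → 0ℚ < μ → DistFromSqrtGe (d * (μ * μ)) (μ * w) (μ * r) → DistFromSqrtGe d w r
distance-scale {d} {w} {r} μ 0<μ = λ where
    (inj₁ (inj₁ μw+μr≤0)) → inj₁ (inj₁ (*-cancelˡ-≤ μ 0<μ (subst₂ _≤_ (sum μ w r) (sym (*-zeroʳ μ)) μw+μr≤0)))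
    (inj₁ (inj₂ below))   → inj₁ (inj₂ (*-cancelˡ-≤ (μ * μ) (0<* 0<μ 0<μ) (subst₂ _≤_ (square μ w r) (*-comm d (μ * μ)) below)))
    (inj₂ (0≤ , above))   → inj₂ (*-cancelˡ-≤ μ 0<μ (subst₂ _≤_ (sym (*-zeroʳ μ)) (difference μ w r) 0≤) ,
                                  *-cancelˡ-≤ (μ * μ) (0<* 0<μ 0<μ) (subst₂ _≤_ (*-comm d (μ * μ)) (square′ μ w r) above))
  where
  sum : ∀ μ w r → μ * w + μ * r ≡ μ * (w + r)
  sum = solve-∀ ring
  difference : ∀ μ w r → μ * w - μ * r ≡ μ * (w - r)
  difference = solve-∀ ring
  square : ∀ μ w r → (μ * w + μ * r) * (μ * w + μ * r) ≡ μ * μ * ((w + r) * (w + r))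
  square = solve-∀ ring
  square′ : ∀ μ w r → (μ * w - μ * r) * (μ * w - μ * r) ≡ μ * μ * ((w - r) * (w - r))
  square′ = solve-∀ ring

distance-mono : ∀ {d w r r′} → r′ ≤ r → DistFromSqrtGe d w r → DistFromSqrtGe d w r′
distance-mono {w = w} {r} {r′} r′≤r (inj₁ (inj₁ w+r≤0)) = inj₁ (inj₁ (≤-trans (+-monoʳ-≤ w r′≤r) w+r≤0))
-- Squaring is monotone only on nonnegative numbers; a negative `w + r′` falls under the other
-- alternative.
distance-mono {w = w} {r} {r′} r′≤r (inj₁ (inj₂ below)) with ≤-total (w + r′) 0ℚ
... | inj₁ w+r′≤0 = inj₁ (inj₁ w+r′≤0)
... | inj₂ 0≤w+r′ = inj₁ (inj₂ (≤-trans (*-mono-≤ 0≤w+r′ 0≤w+r′ (+-monoʳ-≤ w r′≤r) (+-monoʳ-≤ w r′≤r)) below))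
distance-mono {w = w} {r} {r′} r′≤r (inj₂ (0≤w-r , above)) =
  inj₂ (≤-trans 0≤w-r w-r≤ , ≤-trans above (*-mono-≤ 0≤w-r 0≤w-r w-r≤ w-r≤))
  where
  w-r≤ : w - r ≤ w - r′
  w-r≤ = +-monoʳ-≤ w (neg-antimono-≤ r′≤r)

^-distribʳ-* : ∀ m n o → (m ℕ.* n) ^ o ≡ m ^ o ℕ.* n ^ o
^-distribʳ-* m n zero    = refl
^-distribʳ-* m n (suc o) = trans (cong (m ℕ.* n ℕ.*_) (^-distribʳ-* m n o)) (lemma m n (m ^ o) (n ^ o))
  where
  lemma : ∀ m n p q → m ℕ.* n ℕ.* (p ℕ.* q) ≡ m ℕ.* p ℕ.* (n ℕ.* q)
  lemma = solveℕ-∀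

n<2^n : ∀ n → n ℕ.< 2 ^ n
n<2^n zero    = ℕ.s≤s ℕ.z≤n
n<2^n (suc n) = ℕₚ.≤-trans (ℕₚ.+-mono-≤ (ℕₚ.m^n>0 2 n) (n<2^n n)) (ℕₚ.+-monoʳ-≤ (2 ^ n) (ℕₚ.m≤m+n (2 ^ n) 0))

-- Needed since `h` contains `γ` squared: `h ^ suc k` has to clear `γ ^ m` and one further `γ` from
-- the scaling factor, and `j` repairs the parity.
round-up-to-even : ∀ m → Σ ℕ λ k → Σ ℕ λ j → j ℕ.≤ 1 × m ℕ.+ 1 ℕ.+ j ≡ suc k ℕ.+ suc k
round-up-to-even zero          = 0 , 1 , ℕ.s≤s ℕ.z≤n , refl
round-up-to-even (suc zero)    = 0 , 0 , ℕ.z≤n , refl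
round-up-to-even (suc (suc m)) with round-up-to-even m
... | k , j , j≤1 , eq = suc k , j , j≤1 , cong suc (trans (cong suc eq) (sym (ℕₚ.+-suc (suc k) (suc k))))

-- Both halves of the theorem: √d · c / (G γ) = √(1 − e/h) with h = G γ², where (γ, G, c) is (α, B, β B) or (β, A, α B).
module PowersOf (γ G c E : ℕ) (1≤γ : 1 ℕ.≤ γ) (1≤G : 1 ℕ.≤ G) (1≤c : 1 ℕ.≤ c) (1≤E : 1 ℕ.≤ E) where

  C h : ℕ
  C = 24 ℕ.* E
  h = G ℕ.* (γ ℕ.* γ)

  private instance
    γ-nonZero : ℕ.NonZero γ
    γ-nonZero = ℕ.>-nonZero 1≤γ
    G-nonZero : ℕ.NonZero G
    G-nonZero = ℕ.>-nonZero 1≤G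
    C-nonZero : ℕ.NonZero C
    C-nonZero = ℕ.>-nonZero (ℕₚ.≤-trans 1≤E (ℕₚ.m≤n*m E 24))

  -- What remains in `growth` after all m-th powers are split off. It does not depend on `m`, so
  -- from `m = threshold` on it is below `2 ^ m`.
  threshold : ℕ
  threshold = c ℕ.* (C ^ 14 ℕ.* (G ^ 2 ℕ.* γ ^ 4))

  growth : ∀ m k j → threshold ℕ.≤ m → j ℕ.≤ 1 → m ℕ.+ 1 ℕ.+ j ≡ suc k ℕ.+ suc k →
    c ℕ.* (C ^ (6 ℕ.* suc k ℕ.+ 8) ℕ.* h ^ suc (suc k)) ℕ.≤ (2 ℕ.* C ^ 3 ℕ.* G ℕ.* γ) ^ m
  growth m k j threshold≤m j≤1 m+1+j = begin
    c ℕ.* (C ^ (6 ℕ.* suc k ℕ.+ 8) ℕ.* h ^ suc (suc k))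
      ≡⟨ cong (λ n → c ℕ.* (C ^ (6 ℕ.* suc k ℕ.+ 8) ℕ.* n)) (trans (^-distribʳ-* G (γ ℕ.* γ) (suc (suc k)))
           (cong (G ^ suc (suc k) ℕ.*_) (trans (^-distribʳ-* γ γ (suc (suc k))) (sym (ℕₚ.^-distribˡ-+-* γ (suc (suc k)) (suc (suc k))))))) ⟩
    c ℕ.* (C ^ (6 ℕ.* suc k ℕ.+ 8) ℕ.* (G ^ suc (suc k) ℕ.* γ ^ (suc (suc k) ℕ.+ suc (suc k))))
      ≤⟨ ℕₚ.*-monoʳ-≤ c (ℕₚ.*-mono-≤ (ℕₚ.^-monoʳ-≤ C C-exponent) (ℕₚ.*-mono-≤ (ℕₚ.^-monoʳ-≤ G G-exponent) (ℕₚ.^-monoʳ-≤ γ γ-exponent))) ⟩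
    c ℕ.* (C ^ (3 ℕ.* m ℕ.+ 14) ℕ.* (G ^ (m ℕ.+ 2) ℕ.* γ ^ (m ℕ.+ 4)))
      ≡⟨ cong (c ℕ.*_) (cong₂ ℕ._*_ (trans (ℕₚ.^-distribˡ-+-* C (3 ℕ.* m) 14) (cong (ℕ._* C ^ 14) (sym (ℕₚ.^-*-assoc C 3 m))))
           (cong₂ ℕ._*_ (ℕₚ.^-distribˡ-+-* G m 2) (ℕₚ.^-distribˡ-+-* γ m 4))) ⟩
    c ℕ.* ((C ^ 3) ^ m ℕ.* C ^ 14 ℕ.* (G ^ m ℕ.* G ^ 2 ℕ.* (γ ^ m ℕ.* γ ^ 4)))
      ≡⟨ rearrange c ((C ^ 3) ^ m) (C ^ 14) (G ^ m) (G ^ 2) (γ ^ m) (γ ^ 4) ⟩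
    threshold ℕ.* (C ^ 3) ^ m ℕ.* G ^ m ℕ.* γ ^ m
      ≤⟨ ℕₚ.*-monoˡ-≤ (γ ^ m) (ℕₚ.*-monoˡ-≤ (G ^ m) (ℕₚ.*-monoˡ-≤ ((C ^ 3) ^ m) (ℕₚ.≤-trans threshold≤m (ℕₚ.<⇒≤ (n<2^n m))))) ⟩
    2 ^ m ℕ.* (C ^ 3) ^ m ℕ.* G ^ m ℕ.* γ ^ m
      ≡⟨ cong (λ n → n ℕ.* G ^ m ℕ.* γ ^ m) (^-distribʳ-* 2 (C ^ 3) m) ⟨
    (2 ℕ.* C ^ 3) ^ m ℕ.* G ^ m ℕ.* γ ^ m
      ≡⟨ cong (ℕ._* γ ^ m) (^-distribʳ-* (2 ℕ.* C ^ 3) G m) ⟨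
    (2 ℕ.* C ^ 3 ℕ.* G) ^ m ℕ.* γ ^ m
      ≡⟨ ^-distribʳ-* (2 ℕ.* C ^ 3 ℕ.* G) γ m ⟨
    (2 ℕ.* C ^ 3 ℕ.* G ℕ.* γ) ^ m ∎
    where
    open ℕₚ.≤-Reasoning
    rearrange : ∀ c p q r s t u → c ℕ.* (p ℕ.* q ℕ.* (r ℕ.* s ℕ.* (t ℕ.* u))) ≡ c ℕ.* (q ℕ.* (s ℕ.* u)) ℕ.* p ℕ.* r ℕ.* t
    rearrange = solveℕ-∀
    2K≤ : suc k ℕ.+ suc k ℕ.≤ m ℕ.+ 1 ℕ.+ 1
    2K≤ = subst (ℕ._≤ m ℕ.+ 1 ℕ.+ 1) m+1+j (ℕₚ.+-monoʳ-≤ (m ℕ.+ 1) j≤1)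
    C-exponent : 6 ℕ.* suc k ℕ.+ 8 ℕ.≤ 3 ℕ.* m ℕ.+ 14
    C-exponent = subst₂ ℕ._≤_ (left k) (right m) (ℕₚ.+-monoˡ-≤ 8 (ℕₚ.*-monoʳ-≤ 3 2K≤))
      where
      left : ∀ k → 3 ℕ.* (suc k ℕ.+ suc k) ℕ.+ 8 ≡ 6 ℕ.* suc k ℕ.+ 8
      left = solveℕ-∀
      right : ∀ m → 3 ℕ.* (m ℕ.+ 1 ℕ.+ 1) ℕ.+ 8 ≡ 3 ℕ.* m ℕ.+ 14
      right = solveℕ-∀
    γ-exponent : suc (suc k) ℕ.+ suc (suc k) ℕ.≤ m ℕ.+ 4
    γ-exponent = subst₂ ℕ._≤_ (left k) (right m) (ℕₚ.+-monoˡ-≤ 2 2K≤)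
      where
      left : ∀ k → suc k ℕ.+ suc k ℕ.+ 2 ≡ suc (suc k) ℕ.+ suc (suc k)
      left = solveℕ-∀
      right : ∀ m → m ℕ.+ 1 ℕ.+ 1 ℕ.+ 2 ≡ m ℕ.+ 4
      right = solveℕ-∀
    G-exponent : suc (suc k) ℕ.≤ m ℕ.+ 2
    G-exponent = ℕₚ.≤-trans (subst (suc (suc k) ℕ.≤_) (left k) (ℕₚ.m≤m+n (suc (suc k)) k)) (subst (suc k ℕ.+ suc k ℕ.≤_) (right m) 2K≤)
      where
      left : ∀ k → suc (suc k) ℕ.+ k ≡ suc k ℕ.+ suc k
      left = solveℕ-∀
      right : ∀ m → m ℕ.+ 1 ℕ.+ 1 ≡ m ℕ.+ 2
      right = solveℕ-∀

  distance-from-√ : ∀ {d e} → d * (⟦ c ⟧ * ⟦ c ⟧) ≡ ⟦ G ⟧ * (⟦ G ⟧ * (⟦ γ ⟧ * ⟦ γ ⟧) - fromℤ e) → e ≢ ℤ.0ℤ → ℤ.∣ e ∣ ℕ.≤ E → C ^ 4 ℕ.≤ γ →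
    ∀ m → threshold ℕ.≤ m → ∀ n → DistFromSqrtGe d (frac n (γ ^ m)) (recip ((⟦ 2 ℕ.* C ^ 3 ℕ.* G ⟧ * (+ γ / 1)) ^ℚ m))
  distance-from-√ {d} {e} dc² e≢0 ∣e∣≤E C⁴≤γ m threshold≤m n with round-up-to-even m
  ... | k , j , j≤1 , m+1+j = distance-scale {d} {w} {recip T} μ 0<μ (distance-mono {d * (μ * μ)} {μ * w} {recip R} r-bound
          (subst (λ D → DistFromSqrtGe D (μ * w) (recip R)) (sym dμ²) (core E h e s 1≤E C⁴≤h sh e≢0 ∣e∣≤E k {μ * w} w-integral)))
    where
    g Γ ρ μ w s R T : ℚ
    g = ⟦ G ⟧
    Γ = ⟦ γ ⟧
    ρ = recip (g * Γ)
    μ = ⟦ c ⟧ * ρ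
    w = frac n (γ ^ m)
    s = fromℤ e * recip (4ℚ * ⟦ h ⟧)
    R = ⟦ C ⟧ ^ℚ (6 ℕ.* suc k ℕ.+ 8) * ⟦ h ⟧ ^ℚ suc (suc k)
    T = (⟦ 2 ℕ.* C ^ 3 ℕ.* G ⟧ * (+ γ / 1)) ^ℚ m

    0<gΓ : 0ℚ < g * Γ
    0<gΓ = 0<* (0<⟦⟧ 1≤G) (0<⟦⟧ 1≤γ)
    0<μ : 0ℚ < μ
    0<μ = 0<* (0<⟦⟧ 1≤c) (0<recip 0<gΓ)
    h≡ : ⟦ h ⟧ ≡ g * (Γ * Γ)
    h≡ = trans (⟦⟧-* G (γ ℕ.* γ)) (cong (g *_) (⟦⟧-* γ γ))
    γ≤h : γ ℕ.≤ h
    γ≤h = ℕₚ.≤-trans (ℕₚ.m≤m*n γ γ) (ℕₚ.m≤n*m (γ ℕ.* γ) G)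
    C⁴≤h : C ^ 4 ℕ.≤ h
    C⁴≤h = ℕₚ.≤-trans C⁴≤γ γ≤h
    0<h : 0ℚ < ⟦ h ⟧
    0<h = 0<⟦⟧ (ℕₚ.≤-trans 1≤γ γ≤h)
    sh : s * (4ℚ * ⟦ h ⟧) ≡ fromℤ e
    sh = trans (*-assoc (fromℤ e) (recip (4ℚ * ⟦ h ⟧)) (4ℚ * ⟦ h ⟧))
      (trans (cong (fromℤ e *_) (recip-inverseˡ (0<* (0<⟦suc⟧ 3) 0<h))) (*-identityʳ (fromℤ e)))

    dμ² : d * (μ * μ) ≡ 1ℚ - PadéTable.x s
    dμ² = *-cancelˡ-≡ (g * Γ * (g * Γ)) (0<* 0<gΓ 0<gΓ) (begin
      g * Γ * (g * Γ) * (d * (μ * μ))                           ≡⟨ lemma₁ (g * Γ) d ⟦ c ⟧ ρ ⟩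
      (ρ * (g * Γ)) * (ρ * (g * Γ)) * (d * (⟦ c ⟧ * ⟦ c ⟧))     ≡⟨ cong₂ (λ p q → p * p * q) (recip-inverseˡ 0<gΓ) dc² ⟩
      1ℚ * 1ℚ * (g * (g * (Γ * Γ) - fromℤ e))                   ≡⟨ cong (λ p → 1ℚ * 1ℚ * (g * (g * (Γ * Γ) - p))) (trans (sym sh) (cong (λ p → s * (4ℚ * p)) h≡)) ⟩
      1ℚ * 1ℚ * (g * (g * (Γ * Γ) - s * (4ℚ * (g * (Γ * Γ)))))  ≡⟨ lemma₂ g Γ s ⟩
      g * Γ * (g * Γ) * (1ℚ - 4ℚ * s)                           ∎)
      where
      open ≡-Reasoning
      lemma₁ : ∀ f d c ρ → f * f * (d * (c * ρ * (c * ρ))) ≡ (ρ * f) * (ρ * f) * (d * (c * c))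
      lemma₁ = solve-∀ ring
      lemma₂ : ∀ g Γ s → 1ℚ * 1ℚ * (g * (g * (Γ * Γ) - s * (fromℤ (+ 4) * (g * (Γ * Γ))))) ≡ g * Γ * (g * Γ) * (1ℚ - fromℤ (+ 4) * s)
      lemma₂ = solve-∀ ring

    h^K : ⟦ h ⟧ ^ℚ suc k ≡ g * g ^ℚ k * (Γ ^ℚ m * Γ * Γ ^ℚ j)
    h^K = begin
      ⟦ h ⟧ ^ℚ suc k                               ≡⟨ cong (_^ℚ suc k) h≡ ⟩
      (g * (Γ * Γ)) ^ℚ suc k                       ≡⟨ ^ℚ-distrib-* g (Γ * Γ) (suc k) ⟩
      g ^ℚ suc k * (Γ * Γ) ^ℚ suc k                ≡⟨ cong (g ^ℚ suc k *_) (trans (^ℚ-distrib-* Γ Γ (suc k)) (sym (^ℚ-+ Γ (suc k) (suc k)))) ⟩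
      g ^ℚ suc k * Γ ^ℚ (suc k ℕ.+ suc k)          ≡⟨ cong (λ i → g ^ℚ suc k * Γ ^ℚ i) m+1+j ⟨
      g ^ℚ suc k * Γ ^ℚ (m ℕ.+ 1 ℕ.+ j)            ≡⟨ cong (g ^ℚ suc k *_) (trans (^ℚ-+ Γ (m ℕ.+ 1) j) (cong (_* Γ ^ℚ j) (trans (^ℚ-+ Γ m 1) (cong (Γ ^ℚ m *_) (*-identityʳ Γ))))) ⟩
      g * g ^ℚ k * (Γ ^ℚ m * Γ * Γ ^ℚ j)           ∎
      where open ≡-Reasoning

    wΓ^m : w * Γ ^ℚ m ≡ fromℤ n
    wΓ^m = trans (cong (w *_) (sym (⟦⟧-^ γ m))) (frac-* n (ℕₚ.m^n>0 γ m))

    -- One `g` and one `Γ` out of `h ^ suc k` cancel the denominator of `μ`, and `Γ ^ℚ m` cancels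
    -- that of `w`.
    w-integral : IsInteger (μ * w * ⟦ h ⟧ ^ℚ suc k)
    w-integral = subst IsInteger (sym (begin
      ⟦ c ⟧ * ρ * w * ⟦ h ⟧ ^ℚ suc k                                     ≡⟨ cong (⟦ c ⟧ * ρ * w *_) h^K ⟩
      ⟦ c ⟧ * ρ * w * (g * g ^ℚ k * (Γ ^ℚ m * Γ * Γ ^ℚ j))               ≡⟨ lemma ⟦ c ⟧ ρ w g (g ^ℚ k) (Γ ^ℚ m) Γ (Γ ^ℚ j) ⟩
      ⟦ c ⟧ * (ρ * (g * Γ)) * (w * Γ ^ℚ m) * (g ^ℚ k * Γ ^ℚ j)           ≡⟨ cong₂ (λ p q → ⟦ c ⟧ * p * q * (g ^ℚ k * Γ ^ℚ j)) (recip-inverseˡ 0<gΓ) wΓ^m ⟩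
      ⟦ c ⟧ * 1ℚ * fromℤ n * (g ^ℚ k * Γ ^ℚ j)                           ∎))
      (*-isInteger (*-isInteger (*-isInteger (⟦⟧-isInteger c) (fromℤ-isInteger (+ 1))) (fromℤ-isInteger n))
        (*-isInteger (^ℚ-isInteger (⟦⟧-isInteger G) k) (^ℚ-isInteger (⟦⟧-isInteger γ) j)))
      where
      open ≡-Reasoning
      lemma : ∀ c ρ w g p q Γ r → c * ρ * w * (g * p * (q * Γ * r)) ≡ c * (ρ * (g * Γ)) * (w * q) * (p * r)
      lemma = solve-∀ ring

    0<R : 0ℚ < R
    0<R = 0<* (0<^ℚ (0<⟦⟧ (ℕₚ.≤-trans 1≤E (ℕₚ.m≤n*m E 24))) (6 ℕ.* suc k ℕ.+ 8)) (0<^ℚ 0<h (suc (suc k)))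

    T≡ : T ≡ ⟦ (2 ℕ.* C ^ 3 ℕ.* G ℕ.* γ) ^ m ⟧
    T≡ = trans (cong (_^ℚ m) (trans (cong (⟦ 2 ℕ.* C ^ 3 ℕ.* G ⟧ *_) (trans (/1≡fromℤ (+ γ)) (sym (⟦⟧≡fromℤ γ))))
      (sym (⟦⟧-* (2 ℕ.* C ^ 3 ℕ.* G) γ)))) (sym (⟦⟧-^ (2 ℕ.* C ^ 3 ℕ.* G ℕ.* γ) m))

    cR≤T : ⟦ c ⟧ * R ≤ T
    cR≤T = subst₂ _≤_
      (trans (⟦⟧-* c (C ^ (6 ℕ.* suc k ℕ.+ 8) ℕ.* h ^ suc (suc k))) (cong (⟦ c ⟧ *_) (trans (⟦⟧-* (C ^ (6 ℕ.* suc k ℕ.+ 8)) (h ^ suc (suc k)))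
        (cong₂ _*_ (⟦⟧-^ C (6 ℕ.* suc k ℕ.+ 8)) (⟦⟧-^ h (suc (suc k)))))))
      (sym T≡) (⟦⟧-mono-≤ (growth m k j threshold≤m j≤1 m+1+j))

    0<T : 0ℚ < T
    0<T = <-≤-trans (0<* (0<⟦⟧ 1≤c) 0<R) cR≤T

    ρ≤1 : ρ ≤ 1ℚ
    ρ≤1 = recip-≤ 0<gΓ (≤-trans (*-mono-≤ {1ℚ} {g} {1ℚ} {Γ} (≤ᵇ⇒≤ _) (≤ᵇ⇒≤ _) (⟦⟧-mono-≤ {1} 1≤G) (⟦⟧-mono-≤ {1} 1≤γ)) (≤-reflexive (sym (*-identityˡ (g * Γ)))))

    -- Scaling by `μ` enlarges the radius by at most the factor `c`, as `ρ ≤ 1`; this is why `c`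
    -- appears in `growth`.
    r-bound : μ * recip T ≤ recip R
    r-bound = *-cancelˡ-≤ R 0<R (begin
      R * (⟦ c ⟧ * ρ * recip T)     ≡⟨ lemma R ⟦ c ⟧ ρ (recip T) ⟩
      ρ * (⟦ c ⟧ * R * recip T)     ≤⟨ *-mono-≤ (<⇒≤ (0<recip 0<gΓ)) (0≤* (0≤* (0≤⟦⟧ c) (<⇒≤ 0<R)) (<⇒≤ (0<recip 0<T))) ρ≤1
                                         (*-monoʳ-≤ (recip T) (<⇒≤ (0<recip 0<T)) cR≤T) ⟩
      1ℚ * (T * recip T)            ≡⟨ cong (1ℚ *_) (recip-inverseʳ 0<T) ⟩
      1ℚ                            ≡⟨ recip-inverseʳ 0<R ⟨
      R * recip R                   ∎)
      where
      open ≤-Reasoning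
      lemma : ∀ R c ρ t → R * (c * ρ * t) ≡ ρ * (c * R * t)
      lemma = solve-∀ ring

-- Arithmetic of d = A/B and the two inequalities

0<d⇒0<↥d : ∀ {d} → 0ℚ < d → 1 ℕ.≤ ℤ.∣ ↥ d ∣
0<d⇒0<↥d {mkℚ +0       _ _} (*<* (ℤ.+<+ ()))
0<d⇒0<↥d {mkℚ +[1+ n ] _ _} _ = ℕ.s≤s ℕ.z≤n
0<d⇒0<↥d {mkℚ -[1+ n ] _ _} _ = ℕ.s≤s ℕ.z≤n

d*↧d : ∀ d → 0ℚ < d → d * ⟦ ↧ₙ d ⟧ ≡ ⟦ ℤ.∣ ↥ d ∣ ⟧
d*↧d d@(mkℚ (+ n) k _) _ = trans (cong (_* ⟦ suc k ⟧) (sym (↥p/↧p≡p d))) (trans (/-*-cancel (+ n) k) (sym (⟦⟧≡fromℤ n)))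
d*↧d (mkℚ -[1+ n ] k _) (*<* ())

-- From `r² = A B` it would follow that `r / B` is a rational square root of `A / B`.
radicand-nonsquare : ∀ d → 0ℚ < d → ¬ (Σ ℚ λ r → r * r ≡ d) → ∀ r → r ℕ.* r ≢ radicand d
radicand-nonsquare d 0<d irrational r r² = irrational (⟦ r ⟧ * recip b , *-cancelˡ-≡ (b * b) (0<* 0<b 0<b) (begin
  b * b * (⟦ r ⟧ * recip b * (⟦ r ⟧ * recip b))   ≡⟨ lemma₁ b ⟦ r ⟧ (recip b) ⟩
  (b * recip b) * (b * recip b) * (⟦ r ⟧ * ⟦ r ⟧) ≡⟨ cong₂ (λ p q → p * p * q) (recip-inverseʳ 0<b) r²ℚ ⟩
  1ℚ * 1ℚ * (d * b * b)                           ≡⟨ lemma₂ b d ⟩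
  b * b * d                                       ∎))
  where
  open ≡-Reasoning
  b : ℚ
  b = ⟦ ↧ₙ d ⟧
  0<b : 0ℚ < b
  0<b = 0<⟦⟧ {↧ₙ d} (ℕ.s≤s ℕ.z≤n)
  r²ℚ : ⟦ r ⟧ * ⟦ r ⟧ ≡ d * b * b
  r²ℚ = trans (sym (⟦⟧-* r r)) (trans (cong ⟦_⟧ r²) (trans (⟦⟧-* ℤ.∣ ↥ d ∣ (↧ₙ d)) (cong (_* b) (sym (d*↧d d 0<d)))))
  lemma₁ : ∀ b r β → b * b * (r * β * (r * β)) ≡ (b * β) * (b * β) * (r * r)
  lemma₁ = solve-∀ ring
  lemma₂ : ∀ b d → 1ℚ * 1ℚ * (d * b * b) ≡ b * b * d
  lemma₂ = solve-∀ ring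

theorem6 : (d : ℚ) → 0ℚ < d → ¬ (Σ ℚ λ r → r * r ≡ d) →
    Σ ℚ λ η → Σ ℚ λ κ → 0ℚ < η × 0ℚ < κ × Σ ℕ λ N →
      (k : ℕ) →
      let α = proj₁ (convergent d k)
          β = proj₂ (convergent d k)
      in 1 ℕ.≤ α → 1 ℕ.≤ β → N ℕ.≤ α → N ℕ.≤ β →
         Σ ℕ λ M → (m : ℕ) → M ℕ.≤ m → (n : ℤ) →
           DistFromSqrtGe d (frac n (α ^ m)) (recip ((η * (+ α / 1)) ^ℚ m))
           × DistFromSqrtGe d (frac n (β ^ m)) (recip ((κ * (+ β / 1)) ^ℚ m))
theorem6 d 0<d irrational =
  -- `C ^ 3` comes from the exponent `6 K` of `C` with `2 K` about `m`, and `B` or `A` from the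
  -- factor `G` of `h`. The bound `C ^ 4` on α and β secures `C ^ 4 ≤ h`, as `balanced-degree`
  -- requires.
  ⟦ 2 ℕ.* C ^ 3 ℕ.* B ⟧ , ⟦ 2 ℕ.* C ^ 3 ℕ.* A ⟧ , 0<⟦⟧ (positive-constant 1≤B) , 0<⟦⟧ (positive-constant 1≤A) , C ^ 4 , bound
  where
  A B E C : ℕ
  A = ℤ.∣ ↥ d ∣
  B = ↧ₙ d
  E = radicand d
  C = 24 ℕ.* E
  1≤A : 1 ℕ.≤ A
  1≤A = 0<d⇒0<↥d 0<d
  1≤B : 1 ℕ.≤ B
  1≤B = ℕ.s≤s ℕ.z≤n
  1≤E : 1 ℕ.≤ E
  1≤E = ℕₚ.*-mono-≤ 1≤A 1≤B
  positive-constant : ∀ {G} → 1 ℕ.≤ G → 1 ℕ.≤ 2 ℕ.* C ^ 3 ℕ.* G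
  positive-constant 1≤G = ℕₚ.*-mono-≤ (ℕₚ.*-mono-≤ {1} {2} (ℕ.s≤s ℕ.z≤n) (ℕₚ.m^n>0 C {{ℕ.>-nonZero (ℕₚ.≤-trans 1≤E (ℕₚ.m≤n*m E 24))}} 3)) 1≤G
  open ContinuedFraction d 1≤A (radicand-nonsquare d 0<d irrational) using (form-pp; form-pp≢0; ∣form-pp∣≤D)
  module _ (k : ℕ) where
    α β : ℕ
    α = proj₁ (convergent d k)
    β = proj₂ (convergent d k)
    e : ℤ
    e = form-pp k
    a : ℚ
    a = ⟦ A ⟧
    b : ℚ
    b = ⟦ B ⟧
    eℚ : fromℤ e ≡ b * (⟦ α ⟧ * ⟦ α ⟧) - a * (⟦ β ⟧ * ⟦ β ⟧)
    eℚ = trans (fromℤ-+ (+ B ℤ.* (+ α ℤ.* + α)) (ℤ.- (+ A ℤ.* (+ β ℤ.* + β))))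
      (cong₂ _+_ (product B α) (trans (fromℤ-neg (+ A ℤ.* (+ β ℤ.* + β))) (cong -_ (product A β))))
      where
      product : ∀ m n → fromℤ (+ m ℤ.* (+ n ℤ.* + n)) ≡ ⟦ m ⟧ * (⟦ n ⟧ * ⟦ n ⟧)
      product m n = trans (fromℤ-* (+ m) (+ n ℤ.* + n)) (cong₂ _*_ (sym (⟦⟧≡fromℤ m))
        (trans (fromℤ-* (+ n) (+ n)) (cong₂ _*_ (sym (⟦⟧≡fromℤ n)) (sym (⟦⟧≡fromℤ n)))))
    α-equation : d * (⟦ β ℕ.* B ⟧ * ⟦ β ℕ.* B ⟧) ≡ b * (b * (⟦ α ⟧ * ⟦ α ⟧) - fromℤ e)
    α-equation = begin
      d * (⟦ β ℕ.* B ⟧ * ⟦ β ℕ.* B ⟧)                            ≡⟨ cong (λ p → d * (p * p)) (⟦⟧-* β B) ⟩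
      d * (⟦ β ⟧ * b * (⟦ β ⟧ * b))                              ≡⟨ lemma₁ d ⟦ β ⟧ b ⟩
      d * b * (⟦ β ⟧ * ⟦ β ⟧) * b                                ≡⟨ cong (λ p → p * (⟦ β ⟧ * ⟦ β ⟧) * b) (d*↧d d 0<d) ⟩
      a * (⟦ β ⟧ * ⟦ β ⟧) * b                                    ≡⟨ lemma₂ a b ⟦ α ⟧ ⟦ β ⟧ ⟩
      b * (b * (⟦ α ⟧ * ⟦ α ⟧) - (b * (⟦ α ⟧ * ⟦ α ⟧) - a * (⟦ β ⟧ * ⟦ β ⟧)))  ≡⟨ cong (λ p → b * (b * (⟦ α ⟧ * ⟦ α ⟧) - p)) eℚ ⟨
      b * (b * (⟦ α ⟧ * ⟦ α ⟧) - fromℤ e)                        ∎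
      where
      open ≡-Reasoning
      lemma₁ : ∀ d β b → d * (β * b * (β * b)) ≡ d * b * (β * β) * b
      lemma₁ = solve-∀ ring
      lemma₂ : ∀ a b α β → a * (β * β) * b ≡ b * (b * (α * α) - (b * (α * α) - a * (β * β)))
      lemma₂ = solve-∀ ring
    -- Now `B α²` is expressed as `A β² + e`, so `e` enters with the opposite sign.
    β-equation : d * (⟦ α ℕ.* B ⟧ * ⟦ α ℕ.* B ⟧) ≡ a * (a * (⟦ β ⟧ * ⟦ β ⟧) - fromℤ (ℤ.- e))
    β-equation = begin
      d * (⟦ α ℕ.* B ⟧ * ⟦ α ℕ.* B ⟧)                            ≡⟨ cong (λ p → d * (p * p)) (⟦⟧-* α B) ⟩
      d * (⟦ α ⟧ * b * (⟦ α ⟧ * b))                              ≡⟨ lemma₁ d ⟦ α ⟧ b ⟩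
      d * b * (⟦ α ⟧ * ⟦ α ⟧) * b                                ≡⟨ cong (λ p → p * (⟦ α ⟧ * ⟦ α ⟧) * b) (d*↧d d 0<d) ⟩
      a * (⟦ α ⟧ * ⟦ α ⟧) * b                                    ≡⟨ lemma₂ a b ⟦ α ⟧ ⟦ β ⟧ ⟩
      a * (a * (⟦ β ⟧ * ⟦ β ⟧) - - (b * (⟦ α ⟧ * ⟦ α ⟧) - a * (⟦ β ⟧ * ⟦ β ⟧)))  ≡⟨ cong (λ p → a * (a * (⟦ β ⟧ * ⟦ β ⟧) - p)) (trans (fromℤ-neg e) (cong -_ eℚ)) ⟨
      a * (a * (⟦ β ⟧ * ⟦ β ⟧) - fromℤ (ℤ.- e))                  ∎
      where
      open ≡-Reasoning
      lemma₁ : ∀ d β b → d * (β * b * (β * b)) ≡ d * b * (β * β) * b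
      lemma₁ = solve-∀ ring
      lemma₂ : ∀ a b α β → a * (α * α) * b ≡ a * (a * (β * β) - - (b * (α * α) - a * (β * β)))
      lemma₂ = solve-∀ ring
    bound : 1 ℕ.≤ α → 1 ℕ.≤ β → C ^ 4 ℕ.≤ α → C ^ 4 ℕ.≤ β → Σ ℕ λ M → (m : ℕ) → M ℕ.≤ m → (n : ℤ) →
      DistFromSqrtGe d (frac n (α ^ m)) (recip ((⟦ 2 ℕ.* C ^ 3 ℕ.* B ⟧ * (+ α / 1)) ^ℚ m))
      × DistFromSqrtGe d (frac n (β ^ m)) (recip ((⟦ 2 ℕ.* C ^ 3 ℕ.* A ⟧ * (+ β / 1)) ^ℚ m))
    bound 1≤α 1≤β N≤α N≤β = Mα.threshold ℕ.⊔ Mβ.threshold , λ m M≤m n →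
      Mα.distance-from-√ α-equation (form-pp≢0 k) (∣form-pp∣≤D k) N≤α m (ℕₚ.≤-trans (ℕₚ.m≤m⊔n Mα.threshold Mβ.threshold) M≤m) n ,
      Mβ.distance-from-√ β-equation -e≢0 (ℕₚ.≤-trans (ℕₚ.≤-reflexive (ℤₚ.∣-i∣≡∣i∣ e)) (∣form-pp∣≤D k)) N≤β m (ℕₚ.≤-trans (ℕₚ.m≤n⊔m Mα.threshold Mβ.threshold) M≤m) n
      where
      module Mα = PowersOf α B (β ℕ.* B) E 1≤α 1≤B (ℕₚ.*-mono-≤ 1≤β 1≤B) 1≤E
      module Mβ = PowersOf β A (α ℕ.* B) E 1≤β 1≤A (ℕₚ.*-mono-≤ 1≤α 1≤B) 1≤E
      -e≢0 : ℤ.- e ≢ ℤ.0ℤ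
      -e≢0 eq = form-pp≢0 k (trans (sym (ℤₚ.neg-involutive e)) (cong ℤ.-_ eq))
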